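{- Let $G=(V,E)$ be an undirected graph with $n$ vertices and let $f\ge1$ be an integer. There is a randomized labeling function $L_V:V\to\{0,1\}^{O(f^2\log^6 n)}$ such that, for any query $\langle s,t,F\rangle$ with $s,t\in V$, $F\subset V$, $|F|\le f$, with high probability (probability $1-1/\mathrm{poly}(n)$ over the randomness of the labeling) one can determine whether $s$ and $t$ are connected in $G-F$ by inspecting only $L_V(s)$, $L_V(t)$ and $\{L_V(v)\mid v\in F\}$.
   Context: $G-F$ is the graph obtained from $G$ by deleting the vertices of $F$ and their incident edges. Labels are assigned in preprocessing (knowing $G$ and $f$, using random bits); queries are answered by a fixed decoding procedure with access only to the stated labels. -}

module Defs where

open import Data.Nat using (ℕ; suc; _+_; _*_; _∸_; _^_; _≤_)
open import Data.Nat.Logarithm using (⌈log₂_⌉)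
open import Data.Bool using (Bool; true; false)
open import Data.Fin using (Fin)
open import Data.Vec using (Vec)
open import Data.List using (List; length; map)
open import Data.List.Membership.Propositional using (_∉_)
open import Data.List.Relation.Unary.Unique.Propositional using (Unique)
open import Data.List.Relation.Unary.All using (All)
open import Data.Product using (Σ; ∃; ∃-syntax; _×_)
open import Function.Bundles using (_⇔_)
open import Relation.Binary.PropositionalEquality using (_≡_)

record Graph (n : ℕ) : Set where
  field
    adj    : Fin n → Fin n → Bool
    sym    : ∀ u v → adj u v ≡ adj v u
    irrefl : ∀ v → adj v v ≡ false
open Graph public

data WalkAvoiding {n : ℕ} (G : Graph n) (F : List (Fin n)) : Fin n → Fin n → Set where
  here : ∀ {v} → v ∉ F → WalkAvoiding G F v v
  step : ∀ {u v w} → u ∉ F → adj G u v ≡ true → WalkAvoiding G F v w → WalkAvoiding G F u w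

-- s and t are connected in G - F (false if s or t lies in F).
ConnectedIn- : ∀ {n} → Graph n → List (Fin n) → Fin n → Fin n → Set
ConnectedIn- G F s t = WalkAvoiding G F s t

labelLen : ℕ → ℕ → ℕ → ℕ
labelLen C n f = C * (f ^ 2) * ((1 + ⌈log₂ n ⌉) ^ 6)

-- Decoder: sees only L(s), L(t) and the labels of F (as a list).
Decoder : ℕ → Set
Decoder ℓ = Vec Bool ℓ → Vec Bool ℓ → List (Vec Bool ℓ) → Bool

-- Randomized labeling using r random bits.
Labeling : ℕ → ℕ → ℕ → Set
Labeling r n ℓ = Vec Bool r → Fin n → Vec Bool ℓ

Correct : ∀ {n ℓ r} → Graph n → Decoder ℓ → Labeling r n ℓ →
          Vec Bool r → Fin n → Fin n → List (Fin n) → Set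
Correct G dec L ρ s t F =
  (dec (L ρ s) (L ρ t) (map (L ρ) F) ≡ true) ⇔ ConnectedIn- G F s t

-- Success probability ≥ 1 - 1/n^c over uniform ρ ∈ {0,1}^r:
-- there are distinct good strings whose number g satisfies (2^r - g)·n^c ≤ 2^r.
SucceedsWHP : ∀ {n ℓ r} → ℕ → Graph n → Decoder ℓ → Labeling r n ℓ →
              Fin n → Fin n → List (Fin n) → Set
SucceedsWHP {n} {r = r} c G dec L s t F =
  ∃[ goods ] (Unique goods × All (λ ρ → Correct G dec L ρ s t F) goods
              × ((2 ^ r ∸ length goods) * (n ^ c) ≤ 2 ^ r))

{-# OPTIONS --safe #-}
module Submission where

-- Fix a spanning forest in which every edge of G joins an ancestor to a descendant, and call a vertex light unless its
-- subtree is the largest among its siblings' subtrees; every vertex has at most 1 + log n light ancestors.  A query affects only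
-- the light subtrees containing s, t or a failed vertex, and cutting the forest at their roots and at F leaves
-- O(f log n) regions, heavy path segments that the query has to glue together.
--
-- Every edge {w , x} gets the random value α w ⊗ β x over F₂, and a label stores the sum of the values seen by a
-- subtree.  Edges at failed vertices disappear after applying functionals that vanish on α F and β F, so a set of
-- regions with a surviving outgoing edge is recognised except with probability 2^(O(f) - m), which allows a union bound
-- over all 2^O(f log n) sets of regions.
--
-- An unaffected light subtree must behave like a connector of its boundary, which consists of ancestors.  Take a random
-- set of safe vertices of density about 1/f; with constant probability it avoids F and meets every boundary of more
-- than O(f log n) vertices.  A subtree with a safe boundary vertex u moves its total mass to u; otherwise its boundary
-- is small, its outgoing edges are cancelled and replaced by a clique on the boundary with random coefficients.  Both
-- kinds of repair are invisible to the decoder, except for the affected subtrees, whose repairs are stored in the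
-- labels of the vertices below them and can be undone.

open import Defs hiding (sym; here; step)
open import Data.Nat as ℕ using (ℕ; zero; suc; _+_; _*_; _^_; _∸_; _≤_; _<_; _⊔_; z≤n; s≤s; s≤s⁻¹; ⌈_/2⌉; NonZero)
import Data.Nat.Properties as ℕₚ
open import Data.Nat.DivMod using (_/_; _%_; m≡m%n+[m/n]*n; m<n*o⇒m/o<n; m%n<n)
open import Data.Nat.Induction using (<-wellFounded)
open import Data.Nat.Logarithm using (⌈log₂_⌉; ⌈log₂⌉-mono-≤; ⌈log₂⌈n/2⌉⌉≡⌈log₂n⌉∸1)
open import Induction.WellFounded using (Acc; acc)
open import Data.Bool using (Bool; true; false; _∧_; _∨_; not; _xor_; if_then_else_)
open import Data.Bool.ListAction using (any)
import Data.Bool.Properties as 𝔹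
open import Data.Bool.Solver using (module xor-∧-Solver)
open import Data.Fin using (Fin; zero; suc; toℕ; fromℕ<; punchIn)
import Data.Fin.Properties as Fₚ
open import Data.Maybe using (Maybe; just; nothing; maybe′)
open import Data.Maybe.Properties using (just-injective; ≡-dec)
open import Data.Vec using (Vec; []; _∷_; lookup; tabulate; replicate; removeAt) renaming (_++_ to _++ᵛ_)
import Data.Vec.Properties as Vecₚ
open import Data.List as List using (List; []; _∷_; _++_; map; length; concatMap; filterᵇ)
import Data.List.Properties as Listₚ
open import Data.List.Membership.Propositional using (_∈_; _∉_; find; lose)
open import Data.List.Membership.Propositional.Properties using (∈-map⁻; ∈-++⁺ˡ; ∈-++⁺ʳ; ∈-concatMap⁺; ∈-concatMap⁻)
open import Data.List.Membership.DecPropositional using () renaming (_∈?_ to mem?)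
open import Data.List.Relation.Unary.All as All using (All; []; _∷_)
import Data.List.Relation.Unary.All.Properties as Allₚ
open import Data.List.Relation.Unary.AllPairs using ([]; _∷_)
open import Data.List.Relation.Unary.Any as Any using (here; there)
open import Data.List.Relation.Unary.Unique.Propositional using (Unique)
import Data.List.Relation.Unary.Unique.Propositional.Properties as Uniqueₚ
open import Data.Product using (∃; ∃-syntax; _×_; _,_; proj₁; proj₂)
open import Data.Sum using (_⊎_; inj₁; inj₂)
open import Data.Empty using (⊥; ⊥-elim)
open import Relation.Nullary using (¬_; Dec; yes; no; does)
open import Relation.Nullary.Decidable using (dec-true; dec-false; decidable-stable; map′; ¬?; _×-dec_; _⊎-dec_; _→-dec_)
open import Relation.Binary.Definitions using (tri<; tri≈; tri>)
open import Relation.Binary.PropositionalEquality using (_≡_; _≢_; refl; sym; trans; cong; cong₂; subst; module ≡-Reasoning)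
open import Function using (_∘_; mk⇔)
open import Algebra.Properties.CommutativeSemigroup ℕₚ.+-commutativeSemigroup using () renaming (interchange to +-middle)
open import Algebra.Properties.CommutativeSemigroup ℕₚ.*-commutativeSemigroup using () renaming (interchange to *-middle)

-- Sums over finite index sets

-- The union bound is affordable only because a candidate set is described by affected light roots
-- and failed vertices. Such a set cannot choose a side for each of the many unaffected light
-- subtrees, and a wrong side would show outgoing edges that no true component has. Hence these
-- subtrees are emptied: over F₂ a set sees an edge exactly when the contributions of its two
-- endpoints do not cancel, and once the whole sum of a subtree has moved to its boundary, the side
-- of the subtree no longer matters.
--
-- F is unknown in preprocessing, so edge values are tensors: the vectors of F alone determine
-- functionals that erase every edge at F, and a sum of edges with a common endpoint compresses to
-- one vector.
--
-- Graph edges and cliques of several subtrees can fall on the same pair and cancel; O(log n)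
-- independent copies of the random coefficients prevent this. Likewise O(log n) safe sets amplify
-- the constant success probability of one.
--
-- The error is one-sided: the component of s always passes as a set without outgoing edges, so
-- acceptance proves connectivity, and only connected pairs need a probability estimate.

true≢false : ∀ {ℓ} {A : Set ℓ} {b : Bool} → b ≡ true → b ≡ false → A
true≢false refl ()

does-true : ∀ {ℓ} {P : Set ℓ} (d : Dec P) → does d ≡ true → P
does-true (yes p) _ = p

does-false : ∀ {ℓ} {P : Set ℓ} (d : Dec P) → does d ≡ false → ¬ P
does-false (no ¬p) _ = ¬p

∧-true : ∀ {a b} → a ∧ b ≡ true → a ≡ true × b ≡ true
∧-true {true} {true} _ = refl , refl

xor-self-false : ∀ {a b} → a ≡ b → a xor b ≡ false
xor-self-false {a} refl = 𝔹.xor-same a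

xor-false⇒≡ : ∀ a b → a xor b ≡ false → a ≡ b
xor-false⇒≡ true  true  _ = refl
xor-false⇒≡ false false _ = refl

xor-cancelʳ : ∀ a b → (a xor b) xor b ≡ a
xor-cancelʳ a b = trans (𝔹.xor-assoc a b b) (trans (cong (a xor_) (𝔹.xor-same b)) (𝔹.xor-identityʳ a))

∧-left : ∀ a b c → a ∧ (b ∧ c) ≡ b ∧ (a ∧ c)
∧-left a b c = trans (sym (𝔹.∧-assoc a b c)) (trans (cong (_∧ c) (𝔹.∧-comm a b)) (𝔹.∧-assoc b a c))

xor-middle : ∀ a b c d → (a xor b) xor (c xor d) ≡ (a xor c) xor (b xor d)
xor-middle false b c d = trans (sym (𝔹.xor-assoc b c d)) (trans (cong (_xor d) (𝔹.xor-comm b c)) (𝔹.xor-assoc c b d))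
xor-middle true  b c d = trans (sym (𝔹.not-distribˡ-xor b (c xor d))) (trans (cong not (xor-middle false b c d)) (𝔹.not-distribˡ-xor c (b xor d)))

_==_ : ∀ {n} → Fin n → Fin n → Bool
i == j = does (i Fₚ.≟ j)

==-refl : ∀ {n} (i : Fin n) → (i == i) ≡ true
==-refl i = dec-true (i Fₚ.≟ i) refl

==-≢ : ∀ {n} {i j : Fin n} → i ≢ j → (i == j) ≡ false
==-≢ {i = i} {j} = dec-false (i Fₚ.≟ j)

⟦_⟧ : Bool → ℕ
⟦ b ⟧ = if b then 1 else 0

count : ∀ {n} → (Fin n → Bool) → ℕ
count {zero}  N = 0
count {suc n} N = ⟦ N zero ⟧ + count (N ∘ suc)

⨁ᴸ : {A : Set} → (A → Bool) → List A → Bool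
⨁ᴸ f []       = false
⨁ᴸ f (x ∷ xs) = f x xor ⨁ᴸ f xs

⨁ᴸ-map : ∀ {A B : Set} (f : B → Bool) (g : A → B) xs → ⨁ᴸ f (List.map g xs) ≡ ⨁ᴸ (f ∘ g) xs
⨁ᴸ-map f g []       = refl
⨁ᴸ-map f g (x ∷ xs) = cong (f (g x) xor_) (⨁ᴸ-map f g xs)

⨁ᴸ-cong : ∀ {A : Set} {f g : A → Bool} → (∀ x → f x ≡ g x) → ∀ xs → ⨁ᴸ f xs ≡ ⨁ᴸ g xs
⨁ᴸ-cong h []       = refl
⨁ᴸ-cong h (x ∷ xs) = cong₂ _xor_ (h x) (⨁ᴸ-cong h xs)

opaque

  ⨁ : ∀ {n} → (Fin n → Bool) → Bool
  ⨁ {zero}  f = false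
  ⨁ {suc n} f = f zero xor ⨁ (f ∘ suc)

  ∑ℕ : ∀ {n} → (Fin n → ℕ) → ℕ
  ∑ℕ {zero}  f = 0
  ∑ℕ {suc n} f = f zero + ∑ℕ (f ∘ suc)

  ⨁-cong : ∀ {n} {f g : Fin n → Bool} → (∀ i → f i ≡ g i) → ⨁ f ≡ ⨁ g
  ⨁-cong {zero}  h = refl
  ⨁-cong {suc n} h = cong₂ _xor_ (h zero) (⨁-cong (h ∘ suc))

  ⨁-zero : ∀ {n} {f : Fin n → Bool} → (∀ i → f i ≡ false) → ⨁ f ≡ false
  ⨁-zero {zero}  h = refl
  ⨁-zero {suc n} h = cong₂ _xor_ (h zero) (⨁-zero (h ∘ suc))

  ⨁-xor : ∀ {n} (f g : Fin n → Bool) → ⨁ (λ i → f i xor g i) ≡ ⨁ f xor ⨁ g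
  ⨁-xor {zero}  f g = refl
  ⨁-xor {suc n} f g = trans (cong ((f zero xor g zero) xor_) (⨁-xor (f ∘ suc) (g ∘ suc))) (xor-middle (f zero) (g zero) _ _)

  ⨁-∧ˡ : ∀ {n} b (f : Fin n → Bool) → ⨁ (λ i → b ∧ f i) ≡ b ∧ ⨁ f
  ⨁-∧ˡ {n} false f = ⨁-zero {n} (λ _ → refl)
  ⨁-∧ˡ     true  f = refl

  ⨁-∧ʳ : ∀ {n} (f : Fin n → Bool) b → ⨁ (λ i → f i ∧ b) ≡ ⨁ f ∧ b
  ⨁-∧ʳ f b = trans (⨁-cong (λ i → 𝔹.∧-comm (f i) b)) (trans (⨁-∧ˡ b f) (𝔹.∧-comm b (⨁ f)))

  ⨁-swap : ∀ {m n} (f : Fin m → Fin n → Bool) → ⨁ (λ i → ⨁ (f i)) ≡ ⨁ (λ j → ⨁ (λ i → f i j))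
  ⨁-swap {zero} {n} f = sym (⨁-zero {n} (λ _ → refl))
  ⨁-swap {suc m} f = trans (cong (⨁ (f zero) xor_) (⨁-swap (f ∘ suc))) (sym (⨁-xor (f zero) _))

  ⨁-single : ∀ {n} (k : Fin n) (f : Fin n → Bool) → (∀ i → i ≢ k → f i ≡ false) → ⨁ f ≡ f k
  ⨁-single zero    f h = trans (cong (f zero xor_) (⨁-zero (λ i → h (suc i) λ ()))) (𝔹.xor-identityʳ _)
  ⨁-single (suc k) f h = trans (cong (_xor ⨁ (f ∘ suc)) (h zero λ ())) (⨁-single k (f ∘ suc) (λ i i≢k → h (suc i) (i≢k ∘ Fₚ.suc-injective)))

  ⨁-true : ∀ {n} (f : Fin n → Bool) → ⨁ f ≡ true → ∃ λ i → f i ≡ true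
  ⨁-true {suc n} f h with f zero in f0
  ... | true  = zero , f0
  ... | false with i , fi ← ⨁-true (f ∘ suc) h = suc i , fi

  ⨁-punchIn : ∀ {n} (i : Fin (suc n)) (f : Fin (suc n) → Bool) → ⨁ f ≡ f i xor ⨁ (f ∘ punchIn i)
  ⨁-punchIn zero f = refl
  ⨁-punchIn {suc n} (suc i) f = trans (cong (f zero xor_) (⨁-punchIn i (f ∘ suc))) (xor-left (f zero) (f (suc i)) _)
    where
    xor-left : ∀ a b c → a xor (b xor c) ≡ b xor (a xor c)
    xor-left a b c = trans (sym (𝔹.xor-assoc a b c)) (trans (cong (_xor c) (𝔹.xor-comm a b)) (𝔹.xor-assoc b a c))

  select : ∀ {n} → (Fin n → Bool) → List (Fin n)
  select {zero}  N = []
  select {suc n} N = if N zero then zero ∷ List.map suc (select (N ∘ suc)) else List.map suc (select (N ∘ suc))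

  length-select : ∀ {n} (N : Fin n → Bool) → length (select N) ≡ count N
  length-select {zero}  N = refl
  length-select {suc n} N with N zero
  ... | true  = cong suc (trans (Listₚ.length-map suc (select (N ∘ suc))) (length-select (N ∘ suc)))
  ... | false = trans (Listₚ.length-map suc (select (N ∘ suc))) (length-select (N ∘ suc))

  ⨁ᴸ-select : ∀ {n} (f N : Fin n → Bool) → ⨁ᴸ f (select N) ≡ ⨁ (λ i → N i ∧ f i)
  ⨁ᴸ-select {zero}  f N = refl
  ⨁ᴸ-select {suc n} f N with N zero
  ... | true  = cong (f zero xor_) (trans (⨁ᴸ-map f suc (select (N ∘ suc))) (⨁ᴸ-select (f ∘ suc) (N ∘ suc)))
  ... | false = trans (⨁ᴸ-map f suc (select (N ∘ suc))) (⨁ᴸ-select (f ∘ suc) (N ∘ suc))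

  ⨁-additive : ∀ {n} {A : Set} (Φ : (A → Bool) → Bool) →
               (∀ g h → Φ (λ y → g y xor h y) ≡ Φ g xor Φ h) → (h : Fin n → A → Bool) →
               Φ (λ y → ⨁ (λ t → h t y)) ≡ ⨁ (λ t → Φ (h t))
  ⨁-additive {zero}  Φ Φ-xor h = trans (Φ-xor (λ _ → false) (λ _ → false)) (𝔹.xor-same (Φ (λ _ → false)))
  ⨁-additive {suc n} Φ Φ-xor h = trans (Φ-xor (h zero) _) (cong (Φ (h zero) xor_) (⨁-additive Φ Φ-xor (h ∘ suc)))

  ∑-mono : ∀ {n} {f g : Fin n → ℕ} → (∀ i → f i ≤ g i) → ∑ℕ f ≤ ∑ℕ g
  ∑-mono {zero}  h = z≤n
  ∑-mono {suc n} h = ℕₚ.+-mono-≤ (h zero) (∑-mono (h ∘ suc))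

  ∑-mono-< : ∀ {n} {f g : Fin n → ℕ} (k : Fin n) → (∀ i → f i ≤ g i) → f k < g k → ∑ℕ f < ∑ℕ g
  ∑-mono-< zero    h lt = ℕₚ.+-mono-<-≤ lt (∑-mono (h ∘ suc))
  ∑-mono-< (suc k) h lt = ℕₚ.+-mono-≤-< (h zero) (∑-mono-< k (h ∘ suc) lt)

  ∑-const : ∀ n b → ∑ℕ {n} (λ _ → b) ≡ n * b
  ∑-const zero    b = refl
  ∑-const (suc n) b = cong (b +_) (∑-const n b)

  ∑-*ʳ : ∀ {n} (f : Fin n → ℕ) b → ∑ℕ (λ i → f i * b) ≡ ∑ℕ f * b
  ∑-*ʳ {zero}  f b = refl
  ∑-*ʳ {suc n} f b = trans (cong (f zero * b +_) (∑-*ʳ (f ∘ suc) b)) (sym (ℕₚ.*-distribʳ-+ b (f zero) _))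

  ∑-+ : ∀ {n} (f g : Fin n → ℕ) → ∑ℕ (λ i → f i + g i) ≡ ∑ℕ f + ∑ℕ g
  ∑-+ {zero}  f g = refl
  ∑-+ {suc n} f g = trans (cong (f zero + g zero +_) (∑-+ (f ∘ suc) (g ∘ suc))) (+-middle (f zero) (g zero) _ _)

⨁-δ : ∀ {n} (k : Fin n) (f : Fin n → Bool) → ⨁ (λ i → (i == k) ∧ f i) ≡ f k
⨁-δ k f = trans (⨁-single k _ (λ i i≢k → cong (_∧ f i) (==-≢ i≢k))) (cong (_∧ f k) (==-refl k))

-- Normal spanning forests

record Forest {n : ℕ} (G : Graph n) : Set where
  field
    par        : Fin n → Maybe (Fin n)
    depth      : Fin n → ℕ
    par-adj    : ∀ {y p} → par y ≡ just p → adj G p y ≡ true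
    par-depth  : ∀ {y p} → par y ≡ just p → depth y ≡ suc (depth p)
    root-depth : ∀ {y} → par y ≡ nothing → depth y ≡ 0

  infix 4 _≼_ _≼?_
  data _≼_ (t : Fin n) : Fin n → Set where
    ≼-refl : t ≼ t
    ≼-up   : ∀ {y p} → par y ≡ just p → t ≼ p → t ≼ y

  ascend : ∀ {ℓ} (P : Fin n → Set ℓ) → (∀ y → (∀ {p} → par y ≡ just p → P p) → P y) → ∀ y → P y
  ascend P step y = go y (<-wellFounded (depth y))
    where
    go : ∀ y → Acc _<_ (depth y) → P y
    go y (acc rec) = step y (λ {p} eq → go p (rec (subst (depth p <_) (sym (par-depth eq)) ℕₚ.≤-refl)))

  ≼-inv : ∀ {t y} → t ≼ y → t ≡ y ⊎ ∃ λ p → par y ≡ just p × t ≼ p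
  ≼-inv ≼-refl       = inj₁ refl
  ≼-inv (≼-up eq le) = inj₂ (_ , eq , le)

  ≼-par : ∀ {t y p} → par y ≡ just p → t ≼ y → t ≢ y → t ≼ p
  ≼-par eq le t≢y with ≼-inv le
  ... | inj₁ t≡y = ⊥-elim (t≢y t≡y)
  ... | inj₂ (q , eq′ , le′) = subst (_ ≼_) (just-injective (trans (sym eq′) eq)) le′

  ≼-root : ∀ {t y} → par y ≡ nothing → t ≼ y → t ≡ y
  ≼-root eq le with ≼-inv le
  ... | inj₁ t≡y = t≡y
  ... | inj₂ (q , eq′ , _) with () ← trans (sym eq) eq′

  opaque

    _≼?_ : ∀ t y → Dec (t ≼ y)
    t ≼? y = ascend (λ y → Dec (t ≼ y)) step y
      where
      step : ∀ y → (∀ {p} → par y ≡ just p → Dec (t ≼ p)) → Dec (t ≼ y)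
      step y rec with t Fₚ.≟ y
      ... | yes refl = yes ≼-refl
      ... | no t≢y with par y in eq
      ...   | nothing = no (t≢y ∘ ≼-root eq)
      ...   | just p with rec refl
      ...     | yes le = yes (≼-up eq le)
      ...     | no ¬le = no (λ le → ¬le (≼-par eq le t≢y))

  ≼-trans : ∀ {t u y} → t ≼ u → u ≼ y → t ≼ y
  ≼-trans tu ≼-refl       = tu
  ≼-trans tu (≼-up eq uy) = ≼-up eq (≼-trans tu uy)

  ≼-depth : ∀ {t y} → t ≼ y → depth t ≤ depth y
  ≼-depth ≼-refl       = ℕₚ.≤-refl
  ≼-depth (≼-up eq le) = ℕₚ.≤-trans (≼-depth le) (ℕₚ.≤-trans (ℕₚ.n≤1+n _) (ℕₚ.≤-reflexive (sym (par-depth eq))))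

  ≼-depth-< : ∀ {t y} → t ≼ y → t ≢ y → depth t < depth y
  ≼-depth-< ≼-refl       t≢y = ⊥-elim (t≢y refl)
  ≼-depth-< (≼-up eq le) _   = ℕₚ.≤-trans (s≤s (≼-depth le)) (ℕₚ.≤-reflexive (sym (par-depth eq)))

  ≼-depth-≡ : ∀ {t y} → t ≼ y → depth t ≡ depth y → t ≡ y
  ≼-depth-≡ {t} {y} le eq with t Fₚ.≟ y
  ... | yes t≡y = t≡y
  ... | no t≢y = ⊥-elim (ℕₚ.<-irrefl eq (≼-depth-< le t≢y))

  ≼-antisym : ∀ {t y} → t ≼ y → y ≼ t → t ≡ y
  ≼-antisym le ge = ≼-depth-≡ le (ℕₚ.≤-antisym (≼-depth le) (≼-depth ge))

  ≼-linear : ∀ {t u y} → t ≼ y → u ≼ y → t ≼ u ⊎ u ≼ t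
  ≼-linear ≼-refl uy = inj₂ uy
  ≼-linear ty@(≼-up _ _) ≼-refl = inj₁ ty
  ≼-linear (≼-up eq tp) (≼-up eq′ uq) with refl ← just-injective (trans (sym eq) eq′) = ≼-linear tp uq

  -- The absence of cross edges, as in a depth-first search forest. It forces the boundary of every
  -- subtree onto a single root path.
  Normal : Set
  Normal = ∀ {x y} → adj G x y ≡ true → x ≼ y ⊎ y ≼ x

  ancestorAt : ∀ y i → i ≤ depth y → ∃ λ t → t ≼ y × depth t ≡ i
  ancestorAt y i = ascend (λ y → i ≤ depth y → ∃ λ t → t ≼ y × depth t ≡ i) step y
    where
    step : ∀ y → (∀ {p} → par y ≡ just p → i ≤ depth p → ∃ λ t → t ≼ p × depth t ≡ i) → i ≤ depth y → ∃ λ t → t ≼ y × depth t ≡ i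
    step y rec i≤ with ℕₚ.m≤n⇒m<n∨m≡n i≤
    ... | inj₂ refl = y , ≼-refl , refl
    ... | inj₁ i<d with par y in eq
    ...   | nothing with () ← subst (i <_) (root-depth eq) i<d
    ...   | just p with t , t≼p , d ← rec refl (s≤s⁻¹ (subst (i <_) (par-depth eq) i<d)) = t , ≼-up eq t≼p , d

  -- Pigeonhole: the ancestors of y at depths 0 up to `depth y` are pairwise distinct.
  depth<n : ∀ y → depth y < n
  depth<n y = Fₚ.injective⇒≤ {f = anc} inj
    where
    at : (i : Fin (suc (depth y))) → ∃ λ t → t ≼ y × depth t ≡ toℕ i
    at i = ancestorAt y (toℕ i) (s≤s⁻¹ (Fₚ.toℕ<n i))
    anc : Fin (suc (depth y)) → Fin n
    anc i = proj₁ (at i)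
    inj : ∀ {i j} → anc i ≡ anc j → i ≡ j
    inj {i} {j} eq = Fₚ.toℕ-injective (trans (sym (proj₂ (proj₂ (at i)))) (trans (cong depth eq) (proj₂ (proj₂ (at j)))))

module _ {n : ℕ} (G : Graph n) where

  edgeless : Forest G
  edgeless = record
    { par = λ _ → nothing ; depth = λ _ → 0 ; par-adj = λ () ; par-depth = λ () ; root-depth = λ _ → refl }

  -- The hypothesis `y⋠x` keeps x outside the moved subtree, so no cycle arises; since y is no
  -- deeper than x, every moved vertex gains at least one level.
  module Rehang (T : Forest G) {x y : Fin n} (xy : adj G x y ≡ true)
                (y⋠x : ¬ Forest._≼_ T y x) (deeper : Forest.depth T y ≤ Forest.depth T x) where

    open Forest T

    shift : ℕ
    shift = suc (depth x) ∸ depth y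

    par′ : Fin n → Maybe (Fin n)
    par′ z with z Fₚ.≟ y
    ... | yes _ = just x
    ... | no _  = par z

    depth′ : Fin n → ℕ
    depth′ z with y ≼? z
    ... | yes _ = depth z + shift
    ... | no _  = depth z

    depth′-in : ∀ {z} → y ≼ z → depth′ z ≡ depth z + shift
    depth′-in {z} le with y ≼? z
    ... | yes _ = refl
    ... | no ¬le = ⊥-elim (¬le le)

    depth′-out : ∀ {z} → ¬ y ≼ z → depth′ z ≡ depth z
    depth′-out {z} ¬le with y ≼? z
    ... | yes le = ⊥-elim (¬le le)
    ... | no _ = refl

    depth′-y : depth′ y ≡ suc (depth x)
    depth′-y = trans (depth′-in ≼-refl) (ℕₚ.m+[n∸m]≡n (ℕₚ.m≤n⇒m≤1+n deeper))

    depth≤depth′ : ∀ z → depth z ≤ depth′ z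
    depth≤depth′ z with y ≼? z
    ... | yes _ = ℕₚ.m≤m+n _ _
    ... | no _ = ℕₚ.≤-refl

    par-adj′ : ∀ {z p} → par′ z ≡ just p → adj G p z ≡ true
    par-adj′ {z} eq with z Fₚ.≟ y
    par-adj′ refl | yes refl = xy
    ... | no _ = par-adj eq

    par-depth′ : ∀ {z p} → par′ z ≡ just p → depth′ z ≡ suc (depth′ p)
    par-depth′ {z} {p} eq with z Fₚ.≟ y
    par-depth′ refl | yes refl = trans depth′-y (cong suc (sym (depth′-out y⋠x)))
    ... | no z≢y with y ≼? z
    ...   | yes le = trans (cong (_+ shift) (par-depth eq)) (cong suc (sym (depth′-in (≼-par eq le (z≢y ∘ sym)))))
    ...   | no ¬le = trans (par-depth eq) (cong suc (sym (depth′-out (λ le → ¬le (≼-up eq le)))))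

    root-depth′ : ∀ {z} → par′ z ≡ nothing → depth′ z ≡ 0
    root-depth′ {z} eq with z Fₚ.≟ y
    ... | no z≢y = trans (depth′-out (λ le → z≢y (sym (≼-root eq le)))) (root-depth eq)

    rehang : Forest G
    rehang = record { par = par′ ; depth = depth′ ; par-adj = par-adj′ ; par-depth = par-depth′ ; root-depth = root-depth′ }

    rehang-deeper : ∑ℕ depth < ∑ℕ depth′
    rehang-deeper = ∑-mono-< y depth≤depth′ (subst (depth y <_) (sym depth′-y) (s≤s deeper))

  -- A forest of maximal total depth is normal: an edge between incomparable vertices would allow
  -- to hang the shallower endpoint, with its subtree, below the other one.
  normalForest : ∃ λ (T : Forest G) → Forest.Normal T
  -- Every depth is below n, so the total depth never exceeds n * n, while each rehanging raises it
  -- by at least one.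
  normalForest = search (suc (n * n)) edgeless (ℕₚ.m≤n+m (suc (n * n)) _)
    where
    violated? : (T : Forest G) → Dec (∃ λ x → ∃ λ y → adj G x y ≡ true × ¬ Forest._≼_ T x y × ¬ Forest._≼_ T y x)
    violated? T = Fₚ.any? λ x → Fₚ.any? λ y → (adj G x y 𝔹.≟ true) ×-dec (¬? (x ≼? y) ×-dec ¬? (y ≼? x))
      where
      open Forest T

    total≤ : (T : Forest G) → ∑ℕ (Forest.depth T) ≤ n * n
    total≤ T = subst (∑ℕ (Forest.depth T) ≤_) (∑-const n n) (∑-mono (λ y → ℕₚ.<⇒≤ (Forest.depth<n T y)))

    search : ∀ fuel (T : Forest G) → n * n < ∑ℕ (Forest.depth T) + fuel → ∃ λ (T : Forest G) → Forest.Normal T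
    search zero T lt = ⊥-elim (ℕₚ.<-irrefl refl (ℕₚ.<-≤-trans lt (subst (_≤ n * n) (sym (ℕₚ.+-identityʳ _)) (total≤ T))))
    search (suc fuel) T lt with violated? T
    ... | no ok = T , normal
      where
      open Forest T
      normal : Normal
      normal {x} {y} xy with x ≼? y | y ≼? x
      ... | yes le | _ = inj₁ le
      ... | no _ | yes le = inj₂ le
      ... | no p | no q = ⊥-elim (ok (x , y , xy , p , q))
    ... | yes (x , y , xy , x⋠y , y⋠x) with ℕₚ.≤-total (Forest.depth T y) (Forest.depth T x)
    ...   | inj₁ le = search fuel rehang (ℕₚ.<-≤-trans lt (ℕₚ.≤-trans (ℕₚ.≤-reflexive (ℕₚ.+-suc _ fuel)) (ℕₚ.+-monoˡ-≤ fuel rehang-deeper)))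
      where open Rehang T {x} {y} xy y⋠x le
    ...   | inj₂ ge = search fuel rehang (ℕₚ.<-≤-trans lt (ℕₚ.≤-trans (ℕₚ.≤-reflexive (ℕₚ.+-suc _ fuel)) (ℕₚ.+-monoˡ-≤ fuel rehang-deeper)))
      where open Rehang T {y} {x} (trans (Graph.sym G y x) xy) x⋠y ge

-- Heavy paths and addresses

n≤2^⌈log₂n⌉ : ∀ n → n ≤ 2 ^ ⌈log₂ n ⌉
n≤2^⌈log₂n⌉ n = go n (<-wellFounded n)
  where
  go : ∀ n → Acc _<_ n → n ≤ 2 ^ ⌈log₂ n ⌉
  go 0 _ = z≤n
  go 1 _ = s≤s z≤n
  go n@(suc (suc k)) (acc rec) = begin
    n  ≤⟨ n≤2*half n ⟩
    2 * ⌈ n /2⌉  ≤⟨ ℕₚ.*-monoʳ-≤ 2 (go ⌈ n /2⌉ (rec (ℕₚ.⌈n/2⌉<n k))) ⟩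
    2 * 2 ^ ⌈log₂ ⌈ n /2⌉ ⌉  ≡⟨ cong (λ e → 2 ^ suc e) (⌈log₂⌈n/2⌉⌉≡⌈log₂n⌉∸1 n) ⟩
    2 ^ suc (⌈log₂ n ⌉ ∸ 1)  ≡⟨ cong (2 ^_) (ℕₚ.m+[n∸m]≡n {1} {⌈log₂ n ⌉} (⌈log₂⌉-mono-≤ {2} {n} (s≤s (s≤s z≤n)))) ⟩
    2 ^ ⌈log₂ n ⌉  ∎
    where
    open ℕₚ.≤-Reasoning
    n≤2*half : ∀ n → n ≤ 2 * ⌈ n /2⌉
    n≤2*half 0 = z≤n
    n≤2*half 1 = s≤s z≤n
    n≤2*half (suc (suc n)) = ℕₚ.≤-trans (s≤s (s≤s (n≤2*half n))) (ℕₚ.≤-reflexive (sym (ℕₚ.*-suc 2 ⌈ n /2⌉)))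

2^-cancel-≤ : ∀ {i j} → 2 ^ i ≤ 2 ^ j → i ≤ j
2^-cancel-≤ {i} {j} le with i ℕₚ.≤? j
... | yes p = p
... | no ¬p = ⊥-elim (ℕₚ.<⇒≱ (ℕₚ.^-monoʳ-< 2 (s≤s (s≤s z≤n)) (ℕₚ.≰⇒> ¬p)) le)

Address : ℕ → Set
Address n = List (Fin n × Fin n)

reaches : ∀ {n} → Fin n × Fin n → Fin n × Fin n → Bool
reaches (c , i) (c′ , j) = (c == c′) ∧ does (toℕ i ℕₚ.≤? toℕ j)

-- The first entry of an address names the heavy path of the vertex and its depth there. The vertex
-- is an ancestor exactly when the root path of the other vertex uses that heavy path at least as
-- far down.
isAncestor : ∀ {n} → Address n → Address n → Bool
isAncestor []      _ = false
isAncestor (e ∷ _) b = any (reaches e) b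

module HeavyLight {n : ℕ} {G : Graph n} (T : Forest G) where
  open Forest T

  opaque

    below : Fin n → Fin n → Bool
    below t y = does (t ≼? y)

    below⇒ : ∀ {t y} → below t y ≡ true → t ≼ y
    below⇒ {t} {y} = does-true (t ≼? y)

    ⇒below : ∀ {t y} → t ≼ y → below t y ≡ true
    ⇒below {t} {y} = dec-true (t ≼? y)

    ¬⇒below : ∀ {t y} → ¬ t ≼ y → below t y ≡ false
    ¬⇒below {t} {y} = dec-false (t ≼? y)

  size : Fin n → ℕ
  size y = ∑ℕ (λ z → ⟦ below y z ⟧)

  -- The index breaks ties between equally large siblings, so that `heavy-unique` holds.
  Better : Fin n → Fin n → Set
  Better z y = size y < size z ⊎ (size y ≡ size z × toℕ z < toℕ y)

  better? : ∀ z y → Dec (Better z y)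
  better? z y = (size y ℕₚ.<? size z) ⊎-dec ((size y ℕₚ.≟ size z) ×-dec (toℕ z ℕₚ.<? toℕ y))

  -- Vacuous at a root, so that every heavy path, also the one through a root, starts at a light
  -- vertex.
  Light : Fin n → Set
  Light y = ∀ {p} → par y ≡ just p → ∃ λ z → par z ≡ just p × Better z y

  opaque

    light? : ∀ y → Dec (Light y)
    light? y with par y in eq
    ... | nothing = yes (λ ())
    ... | just p with Fₚ.any? (λ z → ≡-dec Fₚ._≟_ (par z) (just p) ×-dec better? z y)
    ...   | yes w = yes (λ { refl → w })
    ...   | no ¬w = no (λ l → ¬w (l refl))

  heavy-unique : ∀ {p y z} → par y ≡ just p → par z ≡ just p → ¬ Light y → ¬ Light z → y ≡ z
  heavy-unique {p} {y} {z} py pz ¬ly ¬lz with ℕₚ.<-cmp (size y) (size z)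
  ... | tri< lt _ _ = ⊥-elim (¬ly (λ eq → z , trans pz (trans (sym py) eq) , inj₁ lt))
  ... | tri> _ _ gt = ⊥-elim (¬lz (λ eq → y , trans py (trans (sym pz) eq) , inj₁ gt))
  ... | tri≈ _ sz _ with ℕₚ.<-cmp (toℕ y) (toℕ z)
  ...   | tri< lt _ _ = ⊥-elim (¬lz (λ eq → y , trans py (trans (sym pz) eq) , inj₂ (sym sz , lt)))
  ...   | tri> _ _ gt = ⊥-elim (¬ly (λ eq → z , trans pz (trans (sym py) eq) , inj₂ (sz , gt)))
  ...   | tri≈ _ eq _ = Fₚ.toℕ-injective eq

  ⟦⟧-mono : ∀ {a b} → (a ≡ true → b ≡ true) → ⟦ a ⟧ ≤ ⟦ b ⟧
  ⟦⟧-mono {false} _ = z≤n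
  ⟦⟧-mono {true}  h rewrite h refl = ℕₚ.≤-refl

  size-mono : ∀ {t y} → t ≼ y → size y ≤ size t
  size-mono le = ∑-mono (λ z → ⟦⟧-mono (λ b → ⇒below (≼-trans le (below⇒ b))))

  size≤n : ∀ y → size y ≤ n
  size≤n y = ℕₚ.≤-trans (∑-mono {g = λ _ → 1} (λ z → ⟦⟧-mono {below y z} {true} (λ _ → refl)))
                        (ℕₚ.≤-reflexive (trans (∑-const n 1) (ℕₚ.*-identityʳ n)))

  -- A light child has a sibling at least as large, and the two disjoint subtrees both lie below p.
  light-halves : ∀ {c p} → par c ≡ just p → Light c → 2 * size c ≤ size p
  light-halves {c} {p} eq l with z , pz , b ← l eq = begin
    2 * size c  ≡⟨ cong (size c +_) (ℕₚ.+-identityʳ _) ⟩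
    size c + size c  ≤⟨ ℕₚ.+-monoʳ-≤ (size c) (c≤z b) ⟩
    size c + size z  ≡⟨ ∑-+ _ _ ⟨
    ∑ℕ (λ y → ⟦ below c y ⟧ + ⟦ below z y ⟧)  ≤⟨ ∑-mono disjoint ⟩
    size p  ∎
    where
    open ℕₚ.≤-Reasoning
    c≤z : Better z c → size c ≤ size z
    c≤z (inj₁ lt)       = ℕₚ.<⇒≤ lt
    c≤z (inj₂ (eq , _)) = ℕₚ.≤-reflexive eq
    irreflexive : ∀ {y} → ¬ Better y y
    irreflexive (inj₁ lt)       = ℕₚ.<-irrefl refl lt
    irreflexive (inj₂ (_ , lt)) = ℕₚ.<-irrefl refl lt
    c≢z : c ≢ z
    c≢z c≡z = irreflexive (subst (Better z) c≡z b)
    siblings : ∀ {y} → c ≼ y → z ≼ y → ⊥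
    siblings cy zy with ≼-linear cy zy
    ... | inj₁ cz = c≢z (≼-depth-≡ cz (trans (par-depth eq) (sym (par-depth pz))))
    ... | inj₂ zc = c≢z (sym (≼-depth-≡ zc (trans (par-depth pz) (sym (par-depth eq)))))
    disjoint : ∀ y → ⟦ below c y ⟧ + ⟦ below z y ⟧ ≤ ⟦ below p y ⟧
    disjoint y with c ≼? y | z ≼? y
    ... | yes cy | yes zy = ⊥-elim (siblings cy zy)
    ... | yes cy | no ¬zy rewrite ⇒below cy | ¬⇒below ¬zy | ⇒below (≼-trans (≼-up eq ≼-refl) cy) = ℕₚ.≤-refl
    ... | no ¬cy | yes zy rewrite ¬⇒below ¬cy | ⇒below zy | ⇒below (≼-trans (≼-up pz ≼-refl) zy) = ℕₚ.≤-refl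
    ... | no ¬cy | no ¬zy rewrite ¬⇒below ¬cy | ¬⇒below ¬zy = z≤n

  depthF : Fin n → Fin n
  depthF y = fromℕ< (depth<n y)

  toℕ-depthF : ∀ y → toℕ (depthF y) ≡ depth y
  toℕ-depthF y = Fₚ.toℕ-fromℕ< (depth<n y)

  opaque

    extend : Fin n → Address n → Address n
    extend y a with light? y | a
    ... | yes _ | a           = (y , depthF y) ∷ a
    ... | no _  | []          = []
    ... | no _  | (c , _) ∷ a = (c , depthF y) ∷ a

    extend-light : ∀ {y} a → Light y → extend y a ≡ (y , depthF y) ∷ a
    extend-light {y} a l with light? y
    ... | yes _ = refl
    ... | no ¬l = ⊥-elim (¬l l)

    extend-heavy : ∀ {y c i} a → ¬ Light y → extend y ((c , i) ∷ a) ≡ (c , depthF y) ∷ a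
    extend-heavy {y} a ¬l with light? y
    ... | yes l = ⊥-elim (¬l l)
    ... | no _ = refl

  addressFuel : ℕ → Fin n → Address n
  addressFuel zero    y = []
  addressFuel (suc k) y = extend y (maybe′ (addressFuel k) [] (par y))

  opaque

    -- The light ancestors of y, deepest first, each with the depth of the deepest ancestor of y on its heavy path.
    address : Fin n → Address n
    address y = addressFuel (suc (depth y)) y

    address-root : ∀ {y} → par y ≡ nothing → address y ≡ extend y []
    address-root {y} eq = cong (λ q → extend y (maybe′ (addressFuel (depth y)) [] q)) eq

    address-par : ∀ {y p} → par y ≡ just p → address y ≡ extend y (address p)
    address-par {y} {p} eq = trans (cong (λ q → extend y (maybe′ (addressFuel (depth y)) [] q)) eq) (cong (λ k → extend y (addressFuel k p)) (par-depth eq))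

  root-light : ∀ {y} → par y ≡ nothing → Light y
  root-light eq eq′ with () ← trans (sym eq) eq′

  data AddressView (y : Fin n) : Set where
    root  : par y ≡ nothing → address y ≡ (y , depthF y) ∷ [] → AddressView y
    light : ∀ {p} → par y ≡ just p → Light y → address y ≡ (y , depthF y) ∷ address p → AddressView y
    heavy : ∀ {p c i a} → par y ≡ just p → ¬ Light y → address p ≡ (c , i) ∷ a → address y ≡ (c , depthF y) ∷ a → AddressView y

  addressView : ∀ y → AddressView y
  addressView = ascend AddressView go
    where
    nonempty : ∀ {p} → AddressView p → ∃ λ c → ∃ λ i → ∃ λ a → address p ≡ (c , i) ∷ a
    nonempty (root _ h)      = _ , _ , _ , h
    nonempty (light _ _ h)   = _ , _ , _ , h
    nonempty (heavy _ _ _ h) = _ , _ , _ , h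
    go : ∀ y → (∀ {p} → par y ≡ just p → AddressView p) → AddressView y
    go y rec with light? y | par y in eq
    ... | yes l | nothing = root eq (trans (address-root eq) (extend-light [] l))
    ... | yes l | just p  = light eq l (trans (address-par eq) (extend-light _ l))
    ... | no ¬l | nothing = ⊥-elim (¬l (root-light eq))
    ... | no ¬l | just p with c , i , a , h ← nonempty (rec refl) = heavy eq ¬l h (trans (address-par eq) (trans (cong (extend y) h) (extend-heavy a ¬l)))

  address-nonempty : ∀ y → ∃ λ c → ∃ λ a → address y ≡ (c , depthF y) ∷ a
  address-nonempty y with addressView y
  ... | root _ h      = _ , _ , h
  ... | light _ _ h   = _ , _ , h
  ... | heavy _ _ _ h = _ , _ , h

  opaque

    top : Fin n → Fin n
    top y = proj₁ (address-nonempty y)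

    address-top : ∀ y → ∃ λ a → address y ≡ (top y , depthF y) ∷ a
    address-top y = proj₂ (address-nonempty y)

  ∷-headˡ : ∀ {A B : Set} {x x′ : A} {i i′ : B} {a a′ : List (A × B)} → (x , i) ∷ a ≡ (x′ , i′) ∷ a′ → x ≡ x′
  ∷-headˡ refl = refl

  top-head : ∀ {y c i a} → address y ≡ (c , i) ∷ a → top y ≡ c
  top-head {y} h with a′ , h′ ← address-top y = ∷-headˡ (trans (sym h′) h)

  lights : Fin n → List (Fin n)
  lights y = map proj₁ (address y)

  lights⇒ : ∀ {c} y → c ∈ lights y → Light c × c ≼ y
  lights⇒ {c} = ascend _ go
    where
    go : ∀ y → (∀ {p} → par y ≡ just p → c ∈ lights p → Light c × c ≼ p) → c ∈ lights y → Light c × c ≼ y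
    go y rec m with addressView y
    go y rec m | root eq h rewrite h with here refl ← m = root-light eq , ≼-refl
    go y rec m | light eq l h rewrite h with m
    ... | here refl = l , ≼-refl
    ... | there m′ with lc , le ← rec eq m′ = lc , ≼-up eq le
    go y rec m | heavy eq ¬l hp h rewrite h with lc , le ← rec eq (subst (λ a → c ∈ map proj₁ a) (sym hp) m) = lc , ≼-up eq le

  ⇒lights : ∀ {c} y → Light c → c ≼ y → c ∈ lights y
  ⇒lights {c} y lc = ascend (λ y → c ≼ y → c ∈ lights y) go y
    where
    go : ∀ y → (∀ {p} → par y ≡ just p → c ≼ p → c ∈ lights p) → c ≼ y → c ∈ lights y
    go y rec le with addressView y
    go y rec le | root eq h rewrite h = here (≼-root eq le)
    go y rec le | light eq l h rewrite h with ≼-inv le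
    ... | inj₁ e = here e
    ... | inj₂ (q , eq′ , le′) with refl ← just-injective (trans (sym eq) eq′) = there (rec eq le′)
    go y rec le | heavy eq ¬l hp h rewrite h with ≼-inv le
    ... | inj₁ refl = ⊥-elim (¬l lc)
    ... | inj₂ (q , eq′ , le′) with refl ← just-injective (trans (sym eq) eq′) = subst (λ a → c ∈ map proj₁ a) hp (rec eq le′)

  size≥1 : ∀ y → 1 ≤ size y
  size≥1 y = ℕₚ.≤-trans (s≤s z≤n) (∑-mono-< {f = λ _ → 0} y (λ _ → z≤n) (subst (λ b → 0 < ⟦ b ⟧) (sym (⇒below ≼-refl)) (s≤s z≤n)))

  -- A potential argument: a light step doubles the first factor and at least halves the second, a
  -- heavy step keeps the address length. The factor 2 on the right pays for the entry of the root.
  2^length-address : ∀ y → 2 ^ length (address y) * size y ≤ 2 * n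
  2^length-address = ascend _ go
    where
    open ℕₚ.≤-Reasoning
    go : ∀ y → (∀ {p} → par y ≡ just p → 2 ^ length (address p) * size p ≤ 2 * n) → 2 ^ length (address y) * size y ≤ 2 * n
    go y rec with addressView y
    ... | root eq h rewrite h = ℕₚ.*-monoʳ-≤ 2 (size≤n y)
    ... | light {p} eq l h rewrite h = begin
      2 * 2 ^ length (address p) * size y  ≡⟨ cong (_* size y) (ℕₚ.*-comm 2 (2 ^ length (address p))) ⟩
      2 ^ length (address p) * 2 * size y  ≡⟨ ℕₚ.*-assoc (2 ^ length (address p)) 2 (size y) ⟩
      2 ^ length (address p) * (2 * size y)  ≤⟨ ℕₚ.*-monoʳ-≤ (2 ^ length (address p)) (light-halves eq l) ⟩
      2 ^ length (address p) * size p  ≤⟨ rec eq ⟩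
      2 * n  ∎
    ... | heavy {p} {c} {i} {a} eq ¬l hp h rewrite h = ℕₚ.≤-trans (ℕₚ.*-monoʳ-≤ (2 ^ suc (length a)) (size-mono (≼-up eq ≼-refl)))
                                     (subst (λ a → 2 ^ length a * size p ≤ 2 * n) hp (rec eq))

  length-address : ∀ y → length (address y) ≤ suc ⌈log₂ n ⌉
  length-address y = 2^-cancel-≤ (begin
    2 ^ length (address y)  ≡⟨ ℕₚ.*-identityʳ _ ⟨
    2 ^ length (address y) * 1  ≤⟨ ℕₚ.*-monoʳ-≤ (2 ^ length (address y)) (size≥1 y) ⟩
    2 ^ length (address y) * size y  ≤⟨ 2^length-address y ⟩
    2 * n  ≤⟨ ℕₚ.*-monoʳ-≤ 2 (n≤2^⌈log₂n⌉ n) ⟩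
    2 ^ suc ⌈log₂ n ⌉  ∎)
    where open ℕₚ.≤-Reasoning

  Entry : Fin n → Fin n × Fin n → Set
  Entry y (c , i) = ∃ λ e → e ≼ y × top e ≡ c × depthF e ≡ i

  address-entry : ∀ {e} y → e ∈ address y → Entry y e
  address-entry {e} = ascend _ go
    where
    up : ∀ {y p} → par y ≡ just p → Entry p e → Entry y e
    up eq (z , le , r) = z , ≼-up eq le , r
    go : ∀ y → (∀ {p} → par y ≡ just p → e ∈ address p → Entry p e) → e ∈ address y → Entry y e
    go y rec m with addressView y
    go y rec m | root eq h rewrite h with here refl ← m = y , ≼-refl , top-head h , refl
    go y rec m | light eq l h rewrite h with m
    ... | here refl = y , ≼-refl , top-head h , refl
    ... | there m′ = up eq (rec eq m′)
    go y rec m | heavy eq ¬l hp h rewrite h with m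
    ... | here refl = y , ≼-refl , top-head h , refl
    ... | there m′ = up eq (rec eq (subst (e ∈_) (sym hp) (there m′)))

  top-≼ : ∀ y → Light (top y) × top y ≼ y
  top-≼ y with a , h ← address-top y = lights⇒ y (subst (λ a → top y ∈ map proj₁ a) (sym h) (here refl))

  top-light : ∀ {y} → Light y → top y ≡ y
  top-light {y} l with addressView y
  ... | root _ h = top-head h
  ... | light _ _ h = top-head h
  ... | heavy _ ¬l _ _ = ⊥-elim (¬l l)

  top-heavy : ∀ {y} → ¬ Light y → ∃ λ p → par y ≡ just p × top p ≡ top y
  top-heavy {y} ¬l with addressView y
  ... | root eq _ = ⊥-elim (¬l (root-light eq))
  ... | light _ l _ = ⊥-elim (¬l l)
  ... | heavy eq _ hp h = _ , eq , trans (top-head hp) (sym (top-head h))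

  -- Descending a heavy path leaves no choice, by `heavy-unique`, so a path has at most one vertex
  -- per depth.
  samePath-≡ : ∀ {t} y → top t ≡ top y → depth t ≡ depth y → t ≡ y
  samePath-≡ {t} y = ascend (λ y → ∀ {t} → top t ≡ top y → depth t ≡ depth y → t ≡ y) go y
    where
    go : ∀ y → (∀ {p} → par y ≡ just p → ∀ {t} → top t ≡ top p → depth t ≡ depth p → t ≡ p) → ∀ {t} → top t ≡ top y → depth t ≡ depth y → t ≡ y
    go y rec {t} tp d with light? y | light? t
    ... | yes ly | _ = sym (≼-depth-≡ (subst (_≼ t) (trans tp (top-light ly)) (proj₂ (top-≼ t))) (sym d))
    ... | no _ | yes lt = ≼-depth-≡ (subst (_≼ y) (trans (sym tp) (top-light lt)) (proj₂ (top-≼ y))) d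
    ... | no ¬ly | no ¬lt with p , ep , tpp ← top-heavy ¬ly | q , eq , tpq ← top-heavy ¬lt
      with refl ← rec ep {q} (trans tpq (trans tp (sym tpp))) (ℕₚ.suc-injective (trans (sym (par-depth eq)) (trans d (par-depth ep))))
      = heavy-unique eq ep ¬lt ¬ly

  samePath-≼ : ∀ {t} e → top t ≡ top e → depth t ≤ depth e → t ≼ e
  samePath-≼ {t} = ascend (λ e → top t ≡ top e → depth t ≤ depth e → t ≼ e) go
    where
    go : ∀ e → (∀ {p} → par e ≡ just p → top t ≡ top p → depth t ≤ depth p → t ≼ p) → top t ≡ top e → depth t ≤ depth e → t ≼ e
    go e rec tp d with ℕₚ.m≤n⇒m<n∨m≡n d
    ... | inj₂ d≡ = subst (t ≼_) (samePath-≡ e tp d≡) ≼-refl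
    ... | inj₁ d< with light? e
    ...   | yes le = ⊥-elim (ℕₚ.<⇒≱ d< (≼-depth (subst (_≼ t) (trans tp (top-light le)) (proj₂ (top-≼ t)))))
    ...   | no ¬le with p , ep , tpp ← top-heavy ¬le = ≼-up ep (rec ep (trans tp (sym tpp)) (s≤s⁻¹ (subst (depth t <_) (par-depth ep) d<)))

  reaches⇒ : ∀ {t} y e → e ∈ address y → reaches (top t , depthF t) e ≡ true → t ≼ y
  reaches⇒ {t} y (c , i) m r with z , le , tz , dz ← address-entry y m | c≡ , d ← ∧-true r
    = ≼-trans (samePath-≼ z (trans (does-true (top t Fₚ.≟ c) c≡) (sym tz))
                (ℕₚ.≤-trans (ℕₚ.≤-reflexive (sym (toℕ-depthF t))) (ℕₚ.≤-trans (does-true (_ ℕₚ.≤? _) d) (ℕₚ.≤-reflexive (trans (cong toℕ (sym dz)) (toℕ-depthF z)))))) le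

  any⇒ : ∀ {A : Set} (p : A → Bool) xs → any p xs ≡ true → ∃ λ x → x ∈ xs × p x ≡ true
  any⇒ p (x ∷ xs) h with p x in px
  ... | true = x , here refl , px
  ... | false with z , m , pz ← any⇒ p xs h = z , there m , pz

  ⇒any : ∀ {A : Set} (p : A → Bool) {xs x} → x ∈ xs → p x ≡ true → any p xs ≡ true
  ⇒any p (here refl) px rewrite px = refl
  ⇒any p {x′ ∷ _} (there m) px = trans (cong (p x′ ∨_) (⇒any p m px)) (𝔹.∨-zeroʳ (p x′))

  ⇒reaches : ∀ {t} y → t ≼ y → any (reaches (top t , depthF t)) (address y) ≡ true
  ⇒reaches {t} = ascend _ go
    where
    self : ∀ {i} → depth t ≤ toℕ i → reaches (top t , depthF t) (top t , i) ≡ true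
    self {i} le rewrite ==-refl (top t) = dec-true (_ ℕₚ.≤? _) (subst (_≤ toℕ i) (sym (toℕ-depthF t)) le)
    atTop : ∀ {y c a} → address y ≡ (c , depthF y) ∷ a → t ≼ y → top t ≡ c → any (reaches (top t , depthF t)) (address y) ≡ true
    atTop {y} {a = a} h le refl rewrite h = ⇒any (reaches (top t , depthF t)) {(top t , depthF y) ∷ a} (here refl) (self (ℕₚ.≤-trans (≼-depth le) (ℕₚ.≤-reflexive (sym (toℕ-depthF y)))))
    go : ∀ y → (∀ {p} → par y ≡ just p → t ≼ p → any (reaches (top t , depthF t)) (address p) ≡ true) → t ≼ y → any (reaches (top t , depthF t)) (address y) ≡ true
    go y rec le with addressView y
    ... | root eq h = atTop h le (trans (cong top (≼-root eq le)) (top-head h))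
    ... | light eq l h with ≼-inv le
    ...   | inj₁ refl = atTop h le (top-head h)
    ...   | inj₂ (q , eq′ , le′) with refl ← just-injective (trans (sym eq) eq′) with e , m , r ← any⇒ _ (address q) (rec eq le′)
          = subst (λ a → any (reaches (top t , depthF t)) a ≡ true) (sym h) (⇒any (reaches (top t , depthF t)) {(y , depthF y) ∷ address q} (there m) r)
    go y rec le | heavy {p} {c} {i} {a} eq ¬l hp h with ≼-inv le
    ...   | inj₁ refl = atTop h le (top-head h)
    ...   | inj₂ (q , eq′ , le′) with refl ← just-injective (trans (sym eq) eq′) with e , m , r ← any⇒ _ (address q) (rec eq le′)
          with subst (e ∈_) hp m
    ...     | here refl = atTop h le (does-true (top t Fₚ.≟ c) (proj₁ (∧-true r)))
    ...     | there m′ = subst (λ a → any (reaches (top t , depthF t)) a ≡ true) (sym h) (⇒any (reaches (top t , depthF t)) {(c , depthF y) ∷ a} (there m′) r)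

  isAncestor-below : ∀ t y → isAncestor (address t) (address y) ≡ below t y
  isAncestor-below t y with a , h ← address-top t rewrite h with t ≼? y
  ... | yes le rewrite ⇒below le = ⇒reaches y le
  ... | no ¬le rewrite ¬⇒below ¬le with any (reaches (top t , depthF t)) (address y) in eq
  ...   | false = refl
  ...   | true with e , m , r ← any⇒ _ _ eq = ⊥-elim (¬le (reaches⇒ y e m r))

-- Moving mass up the forest

module Transfers {n : ℕ} {G : Graph n} (T : Forest G) where
  open Forest T
  open HeavyLight T

  opaque

    -- Reversed depth: rounds of moves run through increasing rank, so a subtree moves only after
    -- the smaller subtrees inside it, together with whatever they have left in it.
    rank : Fin n → ℕ
    rank c = n ∸ depth c

    rank-< : ∀ {c y} → c ≼ y → c ≢ y → rank y < rank c
    rank-< {c} {y} le c≢y = ℕₚ.∸-monoʳ-< (≼-depth-< le c≢y) (ℕₚ.<⇒≤ (depth<n y))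

    rank≤n : ∀ c → rank c < suc n
    rank≤n c = s≤s (ℕₚ.m∸n≤m n (depth c))

  opaque

    _≟ᵃ_ : (i j : ℕ) → Dec (i ≡ j)
    _≟ᵃ_ = ℕₚ._≟_

    _<?ᵃ_ : (i j : ℕ) → Dec (i < j)
    _<?ᵃ_ = ℕₚ._<?_

  level : ℕ → Fin n → Bool
  level j c = does (rank c ≟ᵃ j)

  earlier : ℕ → Fin n → Bool
  earlier j c = does (rank c <?ᵃ j)

  earlier-suc : ∀ j c → earlier (suc j) c ≡ earlier j c xor level j c
  earlier-suc j c with rank c ≟ᵃ j | rank c <?ᵃ j
  ... | yes e | yes lt = ⊥-elim (ℕₚ.<-irrefl e lt)
  ... | yes e | no _   = dec-true (_ <?ᵃ _) (s≤s (ℕₚ.≤-reflexive e))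
  ... | no _  | yes lt = dec-true (_ <?ᵃ _) (ℕₚ.m<n⇒m<1+n lt)
  ... | no ≢  | no ≮   = dec-false (_ <?ᵃ _) (λ lt → ≮ (ℕₚ.≤∧≢⇒< (s≤s⁻¹ lt) ≢))

  -- balance counts, for the edge {w , x}, the mass the two endpoints contribute to the set g after every
  -- subtree c with active c, deepest first, has moved its total mass from c to target c.
  module Balance (active : Fin n → Bool) (target : Fin n → Fin n) (w x : Fin n) where

    balance : ℕ → (Fin n → Bool) → Bool
    balance zero    g = g x xor g w
    balance (suc j) g = balance j g xor ⨁ (λ c → (active c ∧ level j c) ∧ (balance j (below c) ∧ (g c xor g (target c))))

    balance-cong : ∀ j {g h} → (∀ y → g y ≡ h y) → balance j g ≡ balance j h
    balance-cong zero    e = cong₂ _xor_ (e x) (e w)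
    balance-cong (suc j) e = cong₂ _xor_ (balance-cong j e)
      (⨁-cong (λ c → cong (λ b → (active c ∧ level j c) ∧ (balance j (below c) ∧ b)) (cong₂ _xor_ (e c) (e (target c)))))

    balance-xor : ∀ j g h → balance j (λ y → g y xor h y) ≡ balance j g xor balance j h
    balance-xor zero    g h = xor-middle (g x) (h x) (g w) (h w)
    balance-xor (suc j) g h = trans (cong₂ _xor_ (balance-xor j g h) (trans (⨁-cong split) (⨁-xor _ _))) (xor-middle (balance j g) (balance j h) _ _)
      where
      split : ∀ c → (active c ∧ level j c) ∧ (balance j (below c) ∧ ((g c xor h c) xor (g (target c) xor h (target c))))
                  ≡ ((active c ∧ level j c) ∧ (balance j (below c) ∧ (g c xor g (target c)))) xor ((active c ∧ level j c) ∧ (balance j (below c) ∧ (h c xor h (target c))))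
      split c with active c ∧ level j c | balance j (below c)
      ... | false | _     = refl
      ... | true  | false = refl
      ... | true  | true  = xor-middle (g c) (h c) _ _

    balance-∧ : ∀ j b g → balance j (λ y → b ∧ g y) ≡ b ∧ balance j g
    balance-∧ j true  g = refl
    balance-∧ j false g = trans (balance-xor j (λ _ → false) (λ _ → false)) (𝔹.xor-same (balance j (λ _ → false)))

    -- The mass of the subtree at the moment of its own move, which happens in round `rank c`.
    amount : Fin n → Bool
    amount c = balance (rank c) (below c)

    moved : (Fin n → Bool) → Fin n → Bool
    moved g c = amount c ∧ (g c xor g (target c))

    balance-unfold : ∀ j g → balance j g ≡ (g x xor g w) xor ⨁ (λ c → (active c ∧ earlier j c) ∧ moved g c)
    balance-unfold zero g = sym (trans (cong ((g x xor g w) xor_) (⨁-zero none)) (𝔹.xor-identityʳ _))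
      where
      none : ∀ c → (active c ∧ earlier 0 c) ∧ moved g c ≡ false
      none c rewrite dec-false (rank c <?ᵃ 0) (λ ()) = cong (_∧ moved g c) (𝔹.∧-zeroʳ (active c))
    balance-unfold (suc j) g = begin
      balance j g xor ⨁ new  ≡⟨ cong (_xor ⨁ new) (balance-unfold j g) ⟩
      ((g x xor g w) xor ⨁ old) xor ⨁ new  ≡⟨ 𝔹.xor-assoc (g x xor g w) _ _ ⟩
      (g x xor g w) xor (⨁ old xor ⨁ new)  ≡⟨ cong ((g x xor g w) xor_) (⨁-xor old new) ⟨
      (g x xor g w) xor ⨁ (λ c → old c xor new c)  ≡⟨ cong ((g x xor g w) xor_) (⨁-cong merge) ⟩
      (g x xor g w) xor ⨁ (λ c → (active c ∧ earlier (suc j) c) ∧ moved g c) ∎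
      where
      open ≡-Reasoning
      old new : Fin n → Bool
      old c = (active c ∧ earlier j c) ∧ moved g c
      new c = (active c ∧ level j c) ∧ (balance j (below c) ∧ (g c xor g (target c)))
      new-moved : ∀ c → new c ≡ (active c ∧ level j c) ∧ moved g c
      new-moved c with rank c ≟ᵃ j
      ... | yes refl = refl
      ... | no _ rewrite 𝔹.∧-zeroʳ (active c) = refl
      merge : ∀ c → old c xor new c ≡ (active c ∧ earlier (suc j) c) ∧ moved g c
      merge c = begin
        old c xor new c  ≡⟨ cong (old c xor_) (new-moved c) ⟩
        old c xor ((active c ∧ level j c) ∧ moved g c)  ≡⟨ 𝔹.∧-distribʳ-xor (moved g c) (active c ∧ earlier j c) (active c ∧ level j c) ⟨
        ((active c ∧ earlier j c) xor (active c ∧ level j c)) ∧ moved g c  ≡⟨ cong (_∧ moved g c) (𝔹.∧-distribˡ-xor (active c) (earlier j c) (level j c)) ⟨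
        (active c ∧ (earlier j c xor level j c)) ∧ moved g c  ≡⟨ cong (λ b → (active c ∧ b) ∧ moved g c) (earlier-suc j c) ⟨
        (active c ∧ earlier (suc j) c) ∧ moved g c  ∎

    total : (Fin n → Bool) → Bool
    total = balance (suc n)

    total-unfold : ∀ g → total g ≡ (g x xor g w) xor ⨁ (λ c → active c ∧ moved g c)
    total-unfold g = trans (balance-unfold (suc n) g) (cong ((g x xor g w) xor_) (⨁-cong all))
      where
      all : ∀ c → (active c ∧ earlier (suc n) c) ∧ moved g c ≡ active c ∧ moved g c
      all c rewrite dec-true (rank c <?ᵃ suc n) (rank≤n c) = cong (_∧ moved g c) (𝔹.∧-identityʳ (active c))

    -- Dual description: instead of moving mass, pull the set g back along the moves, shallowest first.
    pull : ℕ → (Fin n → Bool) → Fin n → Bool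
    pull j g y = g y xor ⨁ (λ c → (active c ∧ level j c) ∧ ((g c xor g (target c)) ∧ below c y))

    pullback : ℕ → (Fin n → Bool) → Fin n → Bool
    pullback zero    g = g
    pullback (suc j) g = pullback j (pull j g)

    -- A round of moves is linear in the mass and `pull` is its transpose, so weighing the
    -- pulled-back set before the moves equals weighing the set after them.
    balance-pullback : ∀ j g → balance j g ≡ pullback j g x xor pullback j g w
    balance-pullback zero    g = refl
    balance-pullback (suc j) g = trans (sym pulled) (balance-pullback j (pull j g))
      where
      pulled : balance j (pull j g) ≡ balance (suc j) g
      pulled = trans (balance-xor j g _) (cong (balance j g xor_)
        (trans (⨁-additive (balance j) (balance-xor j) (λ c y → (active c ∧ level j c) ∧ ((g c xor g (target c)) ∧ below c y)))
          (⨁-cong (λ c → trans (balance-∧ j (active c ∧ level j c) _) (cong ((active c ∧ level j c) ∧_)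
            (trans (balance-∧ j (g c xor g (target c)) (below c)) (𝔹.∧-comm (g c xor g (target c)) _)))))))

    pullback-fixed : ∀ {y} → (∀ c → active c ≡ true → ¬ c ≼ y) → ∀ j g → pullback j g y ≡ g y
    pullback-fixed         out zero    g = refl
    pullback-fixed {y} out (suc j) g = trans (pullback-fixed out j (pull j g)) (trans (cong (g y xor_) (⨁-zero none)) (𝔹.xor-identityʳ _))
      where
      none : ∀ c → (active c ∧ level j c) ∧ ((g c xor g (target c)) ∧ below c y) ≡ false
      none c with active c in ac
      ... | false = refl
      ... | true rewrite ¬⇒below (out c ac) | 𝔹.∧-zeroʳ (g c xor g (target c)) = 𝔹.∧-zeroʳ (level j c)

    module Properties (target-≼ : ∀ c → target c ≼ c) (w≼x : w ≼ x) where

      fixed : ∀ {e c} → ¬ e ≼ c → below e c xor below e (target c) ≡ false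
      fixed {e} {c} e⋠c rewrite ¬⇒below e⋠c = ¬⇒below (λ le → e⋠c (≼-trans le (target-≼ c)))

      moved-fixed : ∀ {e c} → ¬ e ≼ c → moved (below e) c ≡ false
      moved-fixed {e} {c} e⋠c = trans (cong (amount c ∧_) (fixed e⋠c)) (𝔹.∧-zeroʳ (amount c))

      -- Moves go upwards, so mass that starts at x and its ancestor w never enters a subtree that
      -- does not contain x.
      amount-outside : ∀ c → ¬ c ≼ x → amount c ≡ false
      amount-outside c = go c (<-wellFounded (rank c))
        where
        go : ∀ c → Acc _<_ (rank c) → ¬ c ≼ x → amount c ≡ false
        go c (acc rec) c⋠x = trans (balance-unfold (rank c) (below c)) (cong₂ _xor_ (cong₂ _xor_ (¬⇒below c⋠x) (¬⇒below (λ le → c⋠x (≼-trans le w≼x)))) (⨁-zero none))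
          where
          none : ∀ e → (active e ∧ earlier (rank c) e) ∧ moved (below c) e ≡ false
          none e with rank e <?ᵃ rank c | c ≼? e
          ... | no _ | _ rewrite 𝔹.∧-zeroʳ (active e) = refl
          ... | yes _ | no c⋠e = trans (cong ((active e ∧ true) ∧_) (moved-fixed c⋠e)) (𝔹.∧-zeroʳ _)
          ... | yes lt | yes c≼e = trans (cong (λ b → (active e ∧ true) ∧ (b ∧ (below c e xor below c (target e)))) (go e (rec lt) (λ le → c⋠x (≼-trans c≼e le)))) (𝔹.∧-zeroʳ _)

      -- Neither the edge nor any move leaves the subtree, so its two endpoint contributions still
      -- cancel inside.
      amount-closed : ∀ c → (c ≼ x → c ≼ w) → (∀ e → active e ≡ true → c ≼ e → c ≼ target e) → amount c ≡ false
      amount-closed c xw stay = trans (balance-unfold (rank c) (below c)) (cong₂ _xor_ ends (⨁-zero none))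
        where
        ends : below c x xor below c w ≡ false
        ends with c ≼? x | c ≼? w
        ... | yes a | yes b rewrite ⇒below a | ⇒below b = refl
        ... | yes a | no b  = ⊥-elim (b (xw a))
        ... | no a  | yes b = ⊥-elim (a (≼-trans b w≼x))
        ... | no a  | no b  rewrite ¬⇒below a | ¬⇒below b = refl
        none : ∀ e → (active e ∧ earlier (rank c) e) ∧ moved (below c) e ≡ false
        none e with active e in ae | c ≼? e
        ... | false | _ = refl
        ... | true | no c⋠e = trans (cong (earlier (rank c) e ∧_) (moved-fixed c⋠e)) (𝔹.∧-zeroʳ _)
        ... | true | yes c≼e rewrite ⇒below c≼e | ⇒below (stay e ae c≼e) | 𝔹.∧-zeroʳ (amount e) = 𝔹.∧-zeroʳ (earlier (rank c) e)

      -- A subtree is empty at the end: its own move carries away exactly what the earlier moves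
      -- left in it, and all later moves start outside and stay outside. If c is its own target,
      -- nothing has to be carried.
      total-below : ∀ {c} → active c ≡ true → (target c ≡ c → amount c ≡ false) → total (below c) ≡ false
      total-below {c} ac stuck = begin
        total (below c)  ≡⟨ total-unfold (below c) ⟩
        base xor ⨁ (λ e → active e ∧ moved (below c) e)  ≡⟨ cong (base xor_) (trans (⨁-cong split) (⨁-xor _ _)) ⟩
        base xor (⨁ early xor ⨁ late)  ≡⟨ 𝔹.xor-assoc base _ _ ⟨
        (base xor ⨁ early) xor ⨁ late  ≡⟨ cong₂ _xor_ (sym (balance-unfold (rank c) (below c))) (trans (⨁-single c late others) own) ⟩
        amount c xor amount c  ≡⟨ 𝔹.xor-same (amount c) ⟩
        false  ∎
        where
        open ≡-Reasoning
        base : Bool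
        base = below c x xor below c w
        early late : Fin n → Bool
        early e = (active e ∧ earlier (rank c) e) ∧ moved (below c) e
        late e = (active e ∧ not (earlier (rank c) e)) ∧ moved (below c) e
        split : ∀ e → active e ∧ moved (below c) e ≡ early e xor late e
        split e with active e | earlier (rank c) e
        ... | false | _ = refl
        ... | true | true = sym (𝔹.xor-identityʳ _)
        ... | true | false = refl
        others : ∀ e → e ≢ c → late e ≡ false
        others e e≢c with c ≼? e
        ... | no c⋠e = trans (cong ((active e ∧ not (earlier (rank c) e)) ∧_) (moved-fixed c⋠e)) (𝔹.∧-zeroʳ _)
        ... | yes c≼e rewrite dec-true (rank e <?ᵃ rank c) (rank-< c≼e (e≢c ∘ sym)) | 𝔹.∧-zeroʳ (active e) = refl
        own : late c ≡ amount c
        own rewrite ac | dec-false (rank c <?ᵃ rank c) (ℕₚ.<-irrefl refl) | ⇒below (≼-refl {c}) with target c Fₚ.≟ c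
        ... | yes e rewrite stuck e = refl
        ... | no ne rewrite ¬⇒below {c} {target c} (λ le → ne (≼-antisym (target-≼ c) le)) = 𝔹.∧-identityʳ _

      total-outside : (∀ c → active c ≡ true → ¬ c ≼ x) → ∀ g → total g ≡ g x xor g w
      total-outside out g = trans (total-unfold g) (trans (cong ((g x xor g w) xor_) (⨁-zero none)) (𝔹.xor-identityʳ _))
        where
        none : ∀ c → active c ∧ moved g c ≡ false
        none c with active c in ac
        ... | false = refl
        ... | true rewrite amount-outside c (out c ac) = refl

      -- Mass of this edge only ever sits at w, x, the roots of active subtrees around x and their
      -- targets, so no other value of h matters.
      total-local : ∀ {c} η (h : Fin n → Bool) → h x ≡ η ∧ below c x → h w ≡ η ∧ below c w →
                    (∀ e → active e ≡ true → e ≼ x → h e ≡ η ∧ below c e × h (target e) ≡ η ∧ below c (target e)) →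
                    total h ≡ η ∧ total (below c)
      total-local {c} η h hx hw he = begin
        total h  ≡⟨ total-unfold h ⟩
        (h x xor h w) xor ⨁ (λ e → active e ∧ moved h e)  ≡⟨ cong₂ _xor_ (cong₂ _xor_ hx hw) (⨁-cong terms) ⟩
        (g x xor g w) xor ⨁ (λ e → active e ∧ moved g e)  ≡⟨ total-unfold g ⟨
        total g  ≡⟨ balance-∧ (suc n) η (below c) ⟩
        η ∧ total (below c)  ∎
        where
        open ≡-Reasoning
        g : Fin n → Bool
        g y = η ∧ below c y
        terms : ∀ e → active e ∧ moved h e ≡ active e ∧ moved g e
        terms e with active e in ae | e ≼? x
        ... | false | _ = refl
        ... | true | no e⋠x rewrite amount-outside e e⋠x = refl
        ... | true | yes e≼x = cong (amount e ∧_) (cong₂ _xor_ (proj₁ (he e ae e≼x)) (proj₂ (he e ae e≼x)))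

  module Agreement (active : Fin n → Bool) (target target′ : Fin n → Fin n) (P : Fin n → Set)
                   (agree : ∀ {y} → P y → ∀ c → active c ≡ true → c ≼ y → P c × P (target c) × target c ≡ target′ c) (w x : Fin n) where
    open Balance active target w x using (pull; pullback)
    open Balance active target′ w x using () renaming (pull to pull′; pullback to pullback′)

    -- P is closed under passing to active roots above and to their targets, so the recursion never
    -- leaves the region where the two target functions coincide.
    pullback-agree : ∀ j {g g′} → (∀ {y} → P y → g y ≡ g′ y) → ∀ {y} → P y → pullback j g y ≡ pullback′ j g′ y
    pullback-agree zero    eq = eq
    pullback-agree (suc j) {g} {g′} eq = pullback-agree j step
      where
      step : ∀ {y} → P y → pull j g y ≡ pull′ j g′ y
      step {y} py = cong₂ _xor_ (eq py) (⨁-cong term)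
        where
        term : ∀ c → (active c ∧ level j c) ∧ ((g c xor g (target c)) ∧ below c y) ≡ (active c ∧ level j c) ∧ ((g′ c xor g′ (target′ c)) ∧ below c y)
        term c with active c in ac | c ≼? y
        ... | false | _ = refl
        ... | true | no ¬le rewrite ¬⇒below ¬le = cong (level j c ∧_) (trans (𝔹.∧-zeroʳ _) (sym (𝔹.∧-zeroʳ _)))
        ... | true | yes le with pc , pt , e ← agree py c ac le = cong (λ b → level j c ∧ (b ∧ below c y)) (cong₂ _xor_ (eq pc) (trans (eq pt) (cong g′ e)))

  module Deactivate (active stop : Fin n → Bool) (target : Fin n → Fin n) (target-≼ : ∀ c → target c ≼ c)
                    (stop-up : ∀ {c e} → c ≼ e → active e ∧ stop e ≡ true → active c ≡ true → stop c ≡ true) (w x : Fin n) where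
    remaining : Fin n → Bool
    remaining c = active c ∧ not (stop c)

    module 𝐀 = Balance active target w x
    module 𝐑 = Balance remaining target w x

    -- Proved together with `amount-remaining`: a set that no stopped move can change does not
    -- notice the stop, and the subtree of a remaining root is such a set.
    balance-invariant : ∀ j h → (∀ c → active c ∧ stop c ≡ true → h c ≡ h (target c)) → 𝐀.balance j h ≡ 𝐑.balance j h

    amount-remaining : ∀ j c → active c ∧ not (stop c) ≡ true → 𝐀.balance j (below c) ≡ 𝐑.balance j (below c)
    amount-remaining j c rc = balance-invariant j (below c) (λ e se → trans (¬⇒below (outside e se)) (sym (¬⇒below (λ le → outside e se (≼-trans le (target-≼ e))))))
      where
      outside : ∀ e → active e ∧ stop e ≡ true → ¬ c ≼ e
      outside e se le with ac , nsc ← ∧-true {active c} rc = true≢false nsc (cong not (stop-up le se ac))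

    balance-invariant zero    h inv = refl
    balance-invariant (suc j) h inv = cong₂ _xor_ (balance-invariant j h inv) (⨁-cong term)
      where
      term : ∀ c → (active c ∧ level j c) ∧ (𝐀.balance j (below c) ∧ (h c xor h (target c))) ≡ (remaining c ∧ level j c) ∧ (𝐑.balance j (below c) ∧ (h c xor h (target c)))
      term c with active c in ac | stop c in sc
      ... | false | _ = refl
      ... | true | true rewrite inv c (cong₂ _∧_ ac sc) | 𝔹.xor-same (h (target c)) | 𝔹.∧-zeroʳ (𝐀.balance j (below c)) = 𝔹.∧-zeroʳ (level j c)
      ... | true | false = cong (λ b → level j c ∧ (b ∧ (h c xor h (target c)))) (amount-remaining j c (cong₂ _∧_ ac (cong not sc)))

    -- Stopped roots are never inside a remaining subtree, so the remaining amounts are the old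
    -- ones. Adding each stopped move a second time therefore undoes it over F₂.
    total-remaining : ∀ g → 𝐑.total g ≡ 𝐀.total g xor ⨁ (λ c → (active c ∧ stop c) ∧ 𝐀.moved g c)
    total-remaining g = begin
      𝐑.total g  ≡⟨ 𝐑.total-unfold g ⟩
      base xor ⨁ (λ c → remaining c ∧ 𝐑.moved g c)  ≡⟨ cong (base xor_) (trans (⨁-cong term) (⨁-xor _ _)) ⟩
      base xor (⨁ (λ c → active c ∧ 𝐀.moved g c) xor ⨁ (λ c → (active c ∧ stop c) ∧ 𝐀.moved g c)) ≡⟨ 𝔹.xor-assoc base _ _ ⟨
      (base xor ⨁ (λ c → active c ∧ 𝐀.moved g c)) xor ⨁ (λ c → (active c ∧ stop c) ∧ 𝐀.moved g c) ≡⟨ cong (_xor ⨁ (λ c → (active c ∧ stop c) ∧ 𝐀.moved g c)) (𝐀.total-unfold g) ⟨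
      𝐀.total g xor ⨁ (λ c → (active c ∧ stop c) ∧ 𝐀.moved g c)  ∎
      where
      open ≡-Reasoning
      base : Bool
      base = g x xor g w
      term : ∀ c → remaining c ∧ 𝐑.moved g c ≡ (active c ∧ 𝐀.moved g c) xor ((active c ∧ stop c) ∧ 𝐀.moved g c)
      term c with active c in ac | stop c in sc
      ... | false | _ = refl
      ... | true | true = sym (𝔹.xor-same (𝐀.moved g c))
      ... | true | false = trans (cong (_∧ (g c xor g (target c))) (sym (amount-remaining (rank c) c (cong₂ _∧_ ac (cong not sc))))) (sym (𝔹.xor-identityʳ _))

-- Edges, shelters and the effect of a query

walk-start : ∀ {n} {G : Graph n} {F y t} → WalkAvoiding G F y t → y ∉ F
walk-start (WalkAvoiding.here y∉F)     = y∉F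
walk-start (WalkAvoiding.step y∉F _ _) = y∉F

module Boundaries {n : ℕ} {G : Graph n} (T : Forest G) (normal : Forest.Normal T) where
  open Forest T

  Boundary : Fin n → Fin n → Set
  Boundary c w = ¬ c ≼ w × ∃ λ x → c ≼ x × adj G x w ≡ true

  -- By normality w is comparable to its neighbour x inside the subtree. It cannot be below x, and
  -- two ancestors of x are comparable. So a boundary is a chain, and moving mass to it moves mass
  -- up.
  boundary-≼ : ∀ {c w} → Boundary c w → w ≼ c
  boundary-≼ (c⋠w , x , c≼x , e) with normal e
  ... | inj₁ x≼w = ⊥-elim (c⋠w (≼-trans c≼x x≼w))
  ... | inj₂ w≼x with ≼-linear w≼x c≼x
  ...   | inj₁ le = le
  ...   | inj₂ le = ⊥-elim (c⋠w le)

  boundary-up : ∀ {c e w} → c ≼ e → ¬ c ≼ w → Boundary e w → Boundary c w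
  boundary-up c≼e c⋠w (_ , x , e≼x , a) = c⋠w , x , ≼-trans c≼e e≼x , a

  opaque

    boundary? : ∀ c w → Dec (Boundary c w)
    boundary? c w = ¬? (c ≼? w) ×-dec Fₚ.any? (λ x → (c ≼? x) ×-dec (adj G x w 𝔹.≟ true))

module Scheme {n : ℕ} {G : Graph n} (T : Forest G) (normal : Forest.Normal T) (safe : Fin n → Bool) where
  open Forest T
  open HeavyLight T
  open Transfers T
  open Boundaries T normal public

  Sheltered : Fin n → Set
  Sheltered c = ∃ λ u → Boundary c u × safe u ≡ true

  opaque

    sheltered? : ∀ c → Dec (Sheltered c)
    sheltered? c = Fₚ.any? (λ u → boundary? c u ×-dec (safe u 𝔹.≟ true))

  -- A shelter serves all edges alike. Without one, mass of the edge {w , x} returns to its upper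
  -- endpoint w and cancels the contribution there; if w is not on the boundary, c itself stands for
  -- no move.
  target : Fin n → Fin n → Fin n
  target w c with sheltered? c | boundary? c w
  ... | yes (u , _) | _     = u
  ... | no _        | yes _ = w
  ... | no _        | no _  = c

  data TargetView (w c : Fin n) : Set where
    shelter : Boundary c (target w c) → safe (target w c) ≡ true → TargetView w c
    back    : ¬ Sheltered c → Boundary c w → target w c ≡ w → TargetView w c
    stuck   : ¬ Sheltered c → ¬ Boundary c w → target w c ≡ c → TargetView w c

  targetView : ∀ w c → TargetView w c
  targetView w c with sheltered? c in es | boundary? c w in eb
  ... | yes (u , b , s) | _ = shelter (subst (Boundary c) (sym eq) b) (trans (cong safe eq) s)
    where
    eq : target w c ≡ u
    eq rewrite es = refl
  ... | no ¬s | yes b = back ¬s b eq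
    where
    eq : target w c ≡ w
    eq rewrite es | eb = refl
  ... | no ¬s | no ¬b = stuck ¬s ¬b eq
    where
    eq : target w c ≡ c
    eq rewrite es | eb = refl

  target-sheltered : ∀ {c} w w′ → Sheltered c → target w c ≡ target w′ c
  target-sheltered {c} w w′ s with sheltered? c
  ... | yes _ = refl
  ... | no ¬s = ⊥-elim (¬s s)

  target-≼ : ∀ w c → target w c ≼ c
  target-≼ w c with targetView w c
  ... | shelter b _  = boundary-≼ b
  ... | back _ b e   = subst (_≼ c) (sym e) (boundary-≼ b)
  ... | stuck _ _ e  = subst (_≼ c) (sym e) ≼-refl

  isLight : Fin n → Bool
  isLight c = does (light? c)

  strictly : Fin n → Fin n → Bool
  strictly w x = below w x ∧ not (w == x)

  strictly⇒ : ∀ {w x} → strictly w x ≡ true → w ≼ x × w ≢ x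
  strictly⇒ {w} {x} h with a , b ← ∧-true h = below⇒ a , λ { refl → true≢false (==-refl w) (trans (sym (𝔹.not-involutive (w == w))) (cong not b)) }

  ⇒strictly : ∀ {w x} → w ≼ x → w ≢ x → strictly w x ≡ true
  ⇒strictly le ne = cong₂ _∧_ (⇒below le) (cong not (==-≢ ne))

  -- An unsheltered subtree has a small boundary, so all pairs inside it can be made extra edges of type c.
  clique : Fin n → Fin n → Fin n → Bool
  clique c w x = strictly w x ∧ ((isLight c ∧ not (does (sheltered? c))) ∧ (does (boundary? c w) ∧ does (boundary? c x)))

  Clique : Fin n → Fin n → Fin n → Set
  Clique c w x = Light c × ¬ Sheltered c × Boundary c w × Boundary c x

  clique⇒ : ∀ {c w x} → clique c w x ≡ true → Clique c w x
  clique⇒ {c} {w} {x} h with _ , h ← ∧-true {strictly w x} h with l , b ← ∧-true h with l , s ← ∧-true l with bw , bx ← ∧-true b =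
    does-true (light? c) l , does-false (sheltered? c) (trans (sym (𝔹.not-involutive _)) (cong not s)) , does-true (boundary? c w) bw , does-true (boundary? c x) bx

  ⇒clique : ∀ {c w x} → w ≼ x → w ≢ x → Clique c w x → clique c w x ≡ true
  ⇒clique {c} {w} {x} le ne (l , s , bw , bx) =
    cong₂ _∧_ (⇒strictly le ne) (cong₂ _∧_ (cong₂ _∧_ (dec-true (light? c) l) (cong not (dec-false (sheltered? c) s)))
                                           (cong₂ _∧_ (dec-true (boundary? c w) bw) (dec-true (boundary? c x) bx)))

  edge : Fin n → Fin n → Bool
  edge w x = strictly w x ∧ adj G w x

  -- The multiplicity over F₂ of the pair {w , x}, on which the graph edge and cliques of several
  -- types may be superposed.
  coefficient : (γ on : Fin n → Bool) → Fin n → Fin n → Bool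
  coefficient γ on w x = edge w x xor ⨁ (λ c → on c ∧ (clique c w x ∧ γ c))

  xor-true : ∀ {a b} → a xor b ≡ true → a ≡ true ⊎ b ≡ true
  xor-true {true}  _ = inj₁ refl
  xor-true {false} h = inj₂ h

  module Query (F marks : List (Fin n)) (F⊆marks : ∀ {v} → v ∈ F → v ∈ marks) (F-unsafe : ∀ {v} → v ∈ F → safe v ≡ false) where

    Affected : Fin n → Set
    Affected c = ∃ λ z → z ∈ marks × c ≼ z

    opaque

      affected? : ∀ c → Dec (Affected c)
      affected? c with Any.any? (c ≼?_) marks
      ... | yes a = yes (find a)
      ... | no ¬a = no (λ { (z , m , le) → ¬a (lose m le) })

    affected : Fin n → Bool
    affected c = does (affected? c)

    intact : Fin n → Bool
    intact c = isLight c ∧ not (affected c)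

    intact⇒ : ∀ {c} → intact c ≡ true → Light c × ¬ Affected c
    intact⇒ {c} h with l , a ← ∧-true h = does-true (light? c) l , does-false (affected? c) (trans (sym (𝔹.not-involutive _)) (cong not a))

    ⇒intact : ∀ {c} → Light c → ¬ Affected c → intact c ≡ true
    ⇒intact {c} l a = cong₂ _∧_ (dec-true (light? c) l) (cong not (dec-false (affected? c) a))

    intact-avoids : ∀ {c y} → intact c ≡ true → c ≼ y → y ∉ F
    intact-avoids ic le y∈F = proj₂ (intact⇒ ic) (_ , F⊆marks y∈F , le)

    safe-avoids : ∀ {u} → safe u ≡ true → u ∉ F
    safe-avoids s u∈F = true≢false s (F-unsafe u∈F)

    -- The part of the forest where a candidate set must agree with a component; it contains `marks`
    -- and everything above an affected root.
    Core : Fin n → Set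
    Core y = ∀ c → intact c ≡ true → ¬ c ≼ y

    core-up : ∀ {t y} → t ≼ y → Core y → Core t
    core-up le core c ic c≼t = core c ic (≼-trans c≼t le)

    core-marks : ∀ {z} → z ∈ marks → Core z
    core-marks m c ic le = proj₂ (intact⇒ ic) (_ , m , le)

    core-affected : ∀ {c y} → Affected c → y ≼ c → Core y
    core-affected (z , m , le) y≼c = core-up (≼-trans y≼c le) (core-marks m)

    topmost : ∀ {P : Fin n → Set} → (∀ c → Dec (P c)) → ∀ {x c} → P c → c ≼ x → ∃ λ t → P t × t ≼ x × (∀ e → P e → e ≼ x → t ≼ e)
    topmost {P} P? {x} {c} pc c≼x = go c pc c≼x (<-wellFounded (depth c))
      where
      go : ∀ c → P c → c ≼ x → Acc _<_ (depth c) → ∃ λ t → P t × t ≼ x × (∀ e → P e → e ≼ x → t ≼ e)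
      go c pc c≼x (acc rec) with Fₚ.any? (λ e → P? e ×-dec ((e ≼? x) ×-dec (depth e ℕₚ.<? depth c)))
      ... | yes (e , pe , e≼x , lt) = go e pe e≼x (rec lt)
      ... | no none = c , pc , c≼x , least
        where
        least : ∀ e → P e → e ≼ x → c ≼ e
        least e pe e≼x with ≼-linear c≼x e≼x
        ... | inj₁ le = le
        ... | inj₂ le with c Fₚ.≟ e
        ...   | yes refl = ≼-refl
        ...   | no ne = ⊥-elim (none (e , pe , e≼x , ≼-depth-< le (ne ∘ sym)))

    module Sound {κ : Fin n → Bool} (κ-adj : ∀ {y z} → adj G y z ≡ true → y ∉ F → z ∉ F → κ y ≡ κ z) where

      κ-below : ∀ {c y} → intact c ≡ true → c ≼ y → κ y ≡ κ c
      κ-below ic ≼-refl = refl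
      κ-below ic le@(≼-up eq le′) = trans (sym (κ-adj (par-adj eq) (intact-avoids ic le′) (intact-avoids ic le))) (κ-below ic le′)

      κ-boundary : ∀ {c w} → intact c ≡ true → Boundary c w → w ∉ F → κ w ≡ κ c
      κ-boundary ic (_ , x , c≼x , a) w∉F = trans (sym (κ-adj a (intact-avoids ic c≼x) w∉F)) (κ-below ic c≼x)

      module _ {g : Fin n → Bool} (g-core : ∀ {y} → Core y → y ∉ F → g y ≡ κ y)
               (g-intact : ∀ {c y} → intact c ≡ true → c ≼ y → g y ≡ g c)
               {γ : Fin n → Bool} {w x : Fin n} (w∉F : w ∉ F) (x∉F : x ∉ F) (valid : coefficient γ (not ∘ affected) w x ≡ true) where

        open Balance intact (target w) w x

        Valid : Set
        Valid = w ≼ x × w ≢ x × (adj G w x ≡ true ⊎ ∃ λ c → intact c ≡ true × Clique c w x)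

        valid⇒ : Valid
        valid⇒ with xor-true valid
        ... | inj₁ e with st , a ← ∧-true {strictly w x} e with le , ne ← strictly⇒ st = le , ne , inj₁ a
        ... | inj₂ s with c , h ← ⨁-true _ s with na , h ← ∧-true {not (affected c)} h with q , _ ← ∧-true {clique c w x} h
                     with st , _ ← ∧-true {strictly w x} q with le , ne ← strictly⇒ st
            = le , ne , inj₂ (c , cong₂ _∧_ (dec-true (light? c) (proj₁ (clique⇒ q))) na , clique⇒ q)

        open Properties (target-≼ w) (proj₁ valid⇒)

        κ-target : ∀ {c} → intact c ≡ true → κ c ≡ κ (target w c)
        κ-target {c} ic with targetView w c
        ... | shelter b s = sym (κ-boundary ic b (safe-avoids s))
        ... | back _ b e  = sym (trans (cong κ e) (κ-boundary ic b w∉F))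
        ... | stuck _ _ e = cong κ (sym e)

        κ-ends : κ x ≡ κ w
        κ-ends with proj₂ (proj₂ valid⇒)
        ... | inj₁ a = sym (κ-adj a w∉F x∉F)
        ... | inj₂ (c , ic , _ , _ , bw , bx) = trans (κ-boundary ic bx x∉F) (sym (κ-boundary ic bw w∉F))

        total-κ : total κ ≡ false
        total-κ = trans (total-unfold κ) (cong₂ _xor_ (xor-self-false κ-ends) (⨁-zero none))
          where
          none : ∀ c → intact c ∧ moved κ c ≡ false
          none c with intact c in ic
          ... | false = refl
          ... | true rewrite xor-self-false (κ-target ic) = 𝔹.∧-zeroʳ (amount c)

        h : Fin n → Bool
        h y = g y xor κ y

        h-core : ∀ {y} → Core y → y ∉ F → h y ≡ false
        h-core core y∉F = xor-self-false (g-core core y∉F)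

        h-intact : ∀ {c y} → intact c ≡ true → c ≼ y → h y ≡ h c
        h-intact ic le = cong₂ _xor_ (g-intact ic le) (κ-below ic le)

        -- If an endpoint or a move from inside left c, the vertex reached would be a boundary
        -- vertex of c by `boundary-up`: either w, or a safe vertex that shelters c. Both would give
        -- c another target.
        stuck-amount : ∀ {c} → intact c ≡ true → target w c ≡ c → amount c ≡ false
        stuck-amount {c} ic tc with targetView w c
        ... | shelter b _ = ⊥-elim (proj₁ b (subst (c ≼_) (sym tc) ≼-refl))
        ... | back _ b e  = ⊥-elim (proj₁ b (subst (c ≼_) (trans (sym tc) e) ≼-refl))
        ... | stuck ¬s ¬b _ = amount-closed c ends stay
          where
          ends : c ≼ x → c ≼ w
          ends c≼x with c ≼? w
          ... | yes le = le
          ... | no c⋠w with proj₂ (proj₂ valid⇒)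
          ...   | inj₁ a = ⊥-elim (¬b (c⋠w , x , c≼x , trans (Graph.sym G x w) a))
          ...   | inj₂ (e , _ , _ , _ , bw , bx) = ⊥-elim (¬b (boundary-up (≼-trans c≼x (boundary-≼ bx)) c⋠w bw))
          stay : ∀ e → intact e ≡ true → c ≼ e → c ≼ target w e
          stay e ie c≼e with targetView w e
          ... | stuck _ _ eq = subst (c ≼_) (sym eq) c≼e
          ... | back _ b eq with c ≼? w
          ...   | yes le = subst (c ≼_) (sym eq) le
          ...   | no c⋠w = ⊥-elim (¬b (boundary-up c≼e c⋠w b))
          stay e ie c≼e | shelter b s with c ≼? target w e
          ...   | yes le = le
          ...   | no c⋠u = ⊥-elim (¬s (_ , boundary-up c≼e c⋠u b , s))

        total-h : total h ≡ false
        total-h with Fₚ.any? (λ c → (intact c 𝔹.≟ true) ×-dec (c ≼? x))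
        ... | no none = trans (total-outside core-x h) (cong₂ _xor_ (h-core core-x x∉F) (h-core (core-up (proj₁ valid⇒) core-x) w∉F))
          where
          core-x : Core x
          core-x c ic le = none (c , ic , le)
        -- The topmost intact subtree around x contains all intact roots that carry mass of this
        -- edge, so to this edge h is a multiple of `below t`, and that subtree has been emptied.
        ... | yes (c₀ , ic₀ , c₀≼x) with t , it , t≼x , least ← topmost (λ c → intact c 𝔹.≟ true) ic₀ c₀≼x
            = trans (total-local (h t) h (inside t≼x) (either (proj₁ valid⇒) w∉F) terms)
                    (trans (cong (h t ∧_) (total-below it (stuck-amount it))) (𝔹.∧-zeroʳ (h t)))
          where
          inside : ∀ {y} → t ≼ y → h y ≡ h t ∧ below t y
          inside le = trans (h-intact it le) (sym (trans (cong (h t ∧_) (⇒below le)) (𝔹.∧-identityʳ (h t))))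
          either : ∀ {y} → y ≼ x → y ∉ F → h y ≡ h t ∧ below t y
          either {y} y≼x y∉F with t ≼? y
          ... | yes le = inside le
          ... | no t⋠y = trans (h-core (λ c ic c≼y → t⋠y (≼-trans (least c ic (≼-trans c≼y y≼x)) c≼y)) y∉F)
                               (sym (trans (cong (h t ∧_) (¬⇒below t⋠y)) (𝔹.∧-zeroʳ (h t))))
          target-avoids : ∀ e → intact e ≡ true → target w e ∉ F
          target-avoids e ie with targetView w e
          ... | shelter _ s = safe-avoids s
          ... | back _ _ eq = subst (_∉ F) (sym eq) w∉F
          ... | stuck _ _ eq = subst (_∉ F) (sym eq) (intact-avoids ie ≼-refl)
          terms : ∀ e → intact e ≡ true → e ≼ x → h e ≡ h t ∧ below t e × h (target w e) ≡ h t ∧ below t (target w e)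
          terms e ie e≼x = inside (least e ie e≼x) , either (≼-trans (target-≼ w e) e≼x) (target-avoids e ie)

        -- Every move and every usable pair stays on one side of κ, so κ has total zero. The
        -- difference of g and κ vanishes on live core vertices and is constant on intact subtrees,
        -- which hold no mass in the end.
        total-sound : total g ≡ false
        total-sound = begin
          total g  ≡⟨ balance-cong (suc n) (λ y → sym (xor-cancelʳ (g y) (κ y))) ⟩
          total (λ y → h y xor κ y)  ≡⟨ balance-xor (suc n) h κ ⟩
          total h xor total κ  ≡⟨ cong₂ _xor_ total-h total-κ ⟩
          false  ∎
          where
          open ≡-Reasoning

    module Complete (g : Fin n → Bool) where

      -- Around a visible vertex no target depends on the edge, so the pulled-back set has the same
      -- value there for all edges. This turns the totals of different edges into differences of one
      -- function.
      Visible : Fin n → Set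
      Visible y = ∀ c → intact c ≡ true → c ≼ y → Sheltered c

      visible-up : ∀ {t y} → t ≼ y → Visible y → Visible t
      visible-up le v c ic c≼t = v c ic (≼-trans c≼t le)

      core-visible : ∀ {y} → Core y → Visible y
      core-visible core c ic le = ⊥-elim (core c ic le)

      Hidden : Fin n → Set
      Hidden c = intact c ≡ true × ¬ Sheltered c

      visible? : ∀ y → Visible y ⊎ ∃ λ c → Hidden c × c ≼ y × (∀ e → Hidden e → e ≼ y → c ≼ e)
      visible? y with Fₚ.any? (λ c → ((intact c 𝔹.≟ true) ×-dec ¬? (sheltered? c)) ×-dec (c ≼? y))
      ... | yes (c , hc , le) = inj₂ (topmost (λ c → (intact c 𝔹.≟ true) ×-dec ¬? (sheltered? c)) hc le)
      ... | no none = inj₁ vis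
        where
        vis : Visible y
        vis c ic le with sheltered? c
        ... | yes s = s
        ... | no ¬s = ⊥-elim (none (c , (ic , ¬s) , le))

      Separated : Set
      Separated = ∃ λ w → ∃ λ x → w ≼ x × w ≢ x × w ∉ F × x ∉ F × (adj G w x ≡ true ⊎ ∃ λ c → intact c ≡ true × Clique c w x)
                  × Balance.total intact (target w) w x g ≡ true

      -- The vertex r takes the place of the upper endpoint in `target`; visible vertices do not
      -- notice the choice.
      module _ (r : Fin n) where
        open Balance intact (target r) r r using (pullback; pullback-fixed)

        ĝ : Fin n → Bool
        ĝ = pullback (suc n) g

        ĝ-core : ∀ {y} → Core y → ĝ y ≡ g y
        ĝ-core core = pullback-fixed core (suc n) g

        total-ĝ : ∀ {w x} → w ≼ x → Visible x → Balance.total intact (target w) w x g ≡ ĝ x xor ĝ w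
        total-ĝ {w} {x} le vx = trans (Balance.balance-pullback intact (target w) w x (suc n) g)
                                      (cong₂ _xor_ (agreed vx) (agreed (visible-up le vx)))
          where
          agreed : ∀ {y} → Visible y → Balance.pullback intact (target w) w x (suc n) g y ≡ ĝ y
          agreed = Agreement.pullback-agree intact (target w) (target r) Visible
            (λ vy c ic c≼y → visible-up c≼y vy , visible-up (≼-trans (target-≼ w c) c≼y) vy , target-sheltered w r (vy c ic c≼y)) w x (suc n) {g} {g} (λ _ → refl)

        cross : ∀ {a b} → a ≼ b → Visible b → a ∉ F → b ∉ F → ĝ a ≢ ĝ b →
                (adj G a b ≡ true ⊎ ∃ λ c → intact c ≡ true × Clique c a b) → Separated
        cross {a} {b} le vb a∉F b∉F ne rel = a , b , le , (λ { refl → ne refl }) , a∉F , b∉F , rel , trans (total-ĝ le vb) (differ (ĝ b) (ĝ a) (ne ∘ sym))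
          where
          differ : ∀ p q → p ≢ q → p xor q ≡ true
          differ true  true  ne = ⊥-elim (ne refl)
          differ true  false ne = refl
          differ false true  ne = refl
          differ false false ne = ⊥-elim (ne refl)

        cross-adj : ∀ {a b} → Visible a → Visible b → a ∉ F → b ∉ F → ĝ a ≢ ĝ b → adj G a b ≡ true → Separated
        cross-adj {a} {b} va vb a∉F b∉F ne e with normal e
        ... | inj₁ le = cross le vb a∉F b∉F ne (inj₁ e)
        ... | inj₂ le = cross le va b∉F a∉F (ne ∘ sym) (inj₁ (trans (Graph.sym G b a) e))

        cross-hidden : ∀ {c a b} → Hidden c → Boundary c a → Boundary c b → Visible a → Visible b → a ∉ F → b ∉ F → ĝ a ≢ ĝ b → Separated
        cross-hidden {c} (ic , ¬s) ba bb va vb a∉F b∉F ne with ≼-linear (boundary-≼ ba) (boundary-≼ bb)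
        ... | inj₁ le = cross le vb a∉F b∉F ne (inj₂ (c , ic , proj₁ (intact⇒ ic) , ¬s , ba , bb))
        ... | inj₂ le = cross le va b∉F a∉F (ne ∘ sym) (inj₂ (c , ic , proj₁ (intact⇒ ic) , ¬s , bb , ba))

        -- The state of a walk at y: a is the last visible vertex met, and `via` describes a stay in
        -- a topmost hidden subtree that was entered from a.
        data Anchor (y a : Fin n) : Set where
          at  : y ≡ a → Anchor y a
          via : ∀ {c} → Hidden c → (∀ e → Hidden e → e ≼ c → e ≡ c) → c ≼ y → Boundary c a → Anchor y a

        outer-visible : ∀ {c y} → (∀ e → Hidden e → e ≼ c → e ≡ c) → Boundary c y → Visible y
        outer-visible {c} {y} top b e ie e≼y with sheltered? e
        ... | yes s = s
        ... | no ¬s = ⊥-elim (proj₁ b (subst (_≼ y) (top e (ie , ¬s) (≼-trans e≼y (boundary-≼ b))) e≼y))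

        -- Shortcuts the walk to its visible vertices, a passage through a hidden subtree becoming a
        -- clique pair on its boundary. As `ĝ` differs at the two ends, it changes across one of
        -- these pairs.
        separate : ∀ {y t a} → WalkAvoiding G F y t → Visible t → Visible a → a ∉ F → Anchor y a → ĝ a ≢ ĝ t → Separated
        separate (WalkAvoiding.here t∉F) vt va a∉F (at refl) ne = ⊥-elim (ne refl)
        separate (WalkAvoiding.here t∉F) vt va a∉F (via hc top le b) ne = ⊥-elim (proj₂ hc (vt _ (proj₁ hc) le))
        separate {y} {t} {a} (WalkAvoiding.step {v = z} y∉F e walk) vt va a∉F anchor ne with visible? z
        separate {y} {t} {a} (WalkAvoiding.step {v = z} y∉F e walk) vt va a∉F (at refl) ne | inj₁ vz with ĝ y 𝔹.≟ ĝ z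
        ... | yes eq = separate walk vt vz (walk-start walk) (at refl) (ne ∘ trans eq)
        ... | no neq = cross-adj va vz y∉F (walk-start walk) neq e
        separate {y} {t} {a} (WalkAvoiding.step {v = z} y∉F e walk) vt va a∉F (at refl) ne | inj₂ (c , hc , c≼z , least) =
          separate walk vt va a∉F (via hc (λ e he le → ≼-antisym le (least e he (≼-trans le c≼z))) c≼z (c⋠y , z , c≼z , trans (Graph.sym G z y) e)) ne
          where
          c⋠y : ¬ c ≼ y
          c⋠y le = proj₂ hc (va c (proj₁ hc) le)
        separate {y} {t} {a} (WalkAvoiding.step {v = z} y∉F e walk) vt va a∉F (via {c} hc top c≼y b) ne | _ with c ≼? z
        ... | yes c≼z = separate walk vt va a∉F (via hc top c≼z b) ne
        ... | no c⋠z with ĝ a 𝔹.≟ ĝ z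
        ...   | yes eq = separate walk vt (outer-visible top (c⋠z , y , c≼y , e)) (walk-start walk) (at refl) (ne ∘ trans eq)
        ...   | no neq = cross-hidden hc b (c⋠z , y , c≼y , e) va (outer-visible top (c⋠z , y , c≼y , e)) a∉F (walk-start walk) neq

      separated : ∀ {s t} → WalkAvoiding G F s t → s ∈ marks → t ∈ marks → g s ≢ g t → Separated
      separated {s} {t} walk ms mt ne = separate s walk (core-visible (core-marks mt)) (core-visible (core-marks ms)) (walk-start walk) (at refl)
        (λ eq → ne (trans (sym (ĝ-core s (core-marks ms))) (trans eq (ĝ-core s (core-marks mt)))))

    affected-up : ∀ {c e} → c ≼ e → isLight e ∧ affected e ≡ true → isLight c ≡ true → affected c ≡ true
    affected-up {c} {e} le h _ with z , z∈ , le′ ← does-true (affected? e) (proj₂ (∧-true {isLight e} h)) = dec-true (affected? c) (z , z∈ , ≼-trans le le′)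

    -- What the decoder has to add to the default balance of an edge.
    coefficient-total : ∀ γ g w x → coefficient γ (not ∘ affected) w x ∧ Balance.total intact (target w) w x g
      ≡ (coefficient γ (λ _ → true) w x ∧ Balance.total isLight (target w) w x g)
        xor ⨁ (λ c → (isLight c ∧ affected c) ∧ ((coefficient γ (λ _ → true) w x ∧ Balance.moved isLight (target w) w x g c)
                                                 xor ((clique c w x ∧ γ c) ∧ (g x xor g w))))
    coefficient-total γ g w x = begin
      cQ ∧ tQ  ≡⟨ cong (_∧ tQ) split ⟩
      (c₀ xor ⨁ q) ∧ tQ  ≡⟨ 𝔹.∧-distribʳ-xor tQ c₀ (⨁ q) ⟩
      (c₀ ∧ tQ) xor (⨁ q ∧ tQ)  ≡⟨ cong₂ _xor_ (cong (c₀ ∧_) (D.total-remaining g)) (trans (sym (⨁-∧ʳ q tQ)) (⨁-cong flat)) ⟩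
      (c₀ ∧ (t₀ xor ⨁ m)) xor ⨁ r  ≡⟨ cong (_xor ⨁ r) (trans (𝔹.∧-distribˡ-xor c₀ t₀ (⨁ m)) (cong ((c₀ ∧ t₀) xor_) (sym (⨁-∧ˡ c₀ m)))) ⟩
      ((c₀ ∧ t₀) xor ⨁ (λ c → c₀ ∧ m c)) xor ⨁ r  ≡⟨ 𝔹.xor-assoc (c₀ ∧ t₀) _ _ ⟩
      (c₀ ∧ t₀) xor (⨁ (λ c → c₀ ∧ m c) xor ⨁ r)  ≡⟨ cong ((c₀ ∧ t₀) xor_) (trans (sym (⨁-xor _ _)) (⨁-cong merge)) ⟩
      (c₀ ∧ t₀) xor ⨁ (λ c → (isLight c ∧ affected c) ∧ ((c₀ ∧ D.𝐀.moved g c) xor ((clique c w x ∧ γ c) ∧ (g x xor g w)))) ∎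
      where
      open ≡-Reasoning
      module D = Deactivate isLight affected (target w) (target-≼ w) affected-up w x
      cQ tQ c₀ t₀ : Bool
      cQ = coefficient γ (not ∘ affected) w x
      tQ = Balance.total intact (target w) w x g
      c₀ = coefficient γ (λ _ → true) w x
      t₀ = D.𝐀.total g
      q m r : Fin n → Bool
      q c = affected c ∧ (clique c w x ∧ γ c)
      m c = (isLight c ∧ affected c) ∧ D.𝐀.moved g c
      r c = (isLight c ∧ affected c) ∧ ((clique c w x ∧ γ c) ∧ (g x xor g w))
      split : cQ ≡ c₀ xor ⨁ q
      split = trans (cong (edge w x xor_) (trans (⨁-cong part) (⨁-xor _ q))) (sym (𝔹.xor-assoc (edge w x) _ _))
        where
        part : ∀ c → not (affected c) ∧ (clique c w x ∧ γ c) ≡ (clique c w x ∧ γ c) xor q c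
        part c with affected c
        ... | true  = sym (𝔹.xor-same (clique c w x ∧ γ c))
        ... | false = sym (𝔹.xor-identityʳ _)
      flat : ∀ c → q c ∧ tQ ≡ r c
      flat c with affected? c | clique c w x in eq
      ... | no _ | _ = sym (cong (_∧ _) (𝔹.∧-zeroʳ (isLight c)))
      ... | yes _ | false = sym (𝔹.∧-zeroʳ _)
      -- A clique pair of an affected c lies above c, hence in the core; no intact subtree contains
      -- x, and the total is the plain difference of g.
      ... | yes a | true with l , _ , bw , bx ← clique⇒ {c} {w} {x} eq | st , _ ← ∧-true {strictly w x} eq rewrite dec-true (light? c) l =
        cong (γ c ∧_) (Balance.Properties.total-outside intact (target w) w x (target-≼ w) (proj₁ (strictly⇒ st)) (core-affected a (boundary-≼ bx)) g)
      merge : ∀ c → (c₀ ∧ m c) xor r c ≡ (isLight c ∧ affected c) ∧ ((c₀ ∧ D.𝐀.moved g c) xor ((clique c w x ∧ γ c) ∧ (g x xor g w)))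
      merge c with isLight c ∧ affected c
      ... | true  = refl
      ... | false = cong (_xor false) (𝔹.∧-zeroʳ c₀)

-- Components of G - F and their cuts

opaque

  _∈ᵇ_ : ∀ {n} → Fin n → List (Fin n) → Bool
  v ∈ᵇ F = does (mem? Fₚ._≟_ v F)

  ∈ᵇ⇒ : ∀ {n} {v : Fin n} {F} → v ∈ᵇ F ≡ true → v ∈ F
  ∈ᵇ⇒ {v = v} {F} = does-true (mem? Fₚ._≟_ v F)

  ⇒∈ᵇ : ∀ {n} {v : Fin n} {F} → v ∈ F → v ∈ᵇ F ≡ true
  ⇒∈ᵇ {v = v} {F} = dec-true (mem? Fₚ._≟_ v F)

  ¬⇒∈ᵇ : ∀ {n} {v : Fin n} {F} → v ∉ F → v ∈ᵇ F ≡ false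
  ¬⇒∈ᵇ {v = v} {F} = dec-false (mem? Fₚ._≟_ v F)

∈ᵇ⇒∉ : ∀ {n} {v : Fin n} {F} → v ∈ᵇ F ≡ false → v ∉ F
∈ᵇ⇒∉ h m = true≢false (⇒∈ᵇ m) h

module _ {n : ℕ} (G : Graph n) (F : List (Fin n)) where

  walk-snoc : ∀ {s y z} → WalkAvoiding G F s y → adj G y z ≡ true → z ∉ F → WalkAvoiding G F s z
  walk-snoc (WalkAvoiding.here s∉F)     e z∉F = WalkAvoiding.step s∉F e (WalkAvoiding.here z∉F)
  walk-snoc (WalkAvoiding.step u∉F a p) e z∉F = WalkAvoiding.step u∉F a (walk-snoc p e z∉F)

  walk-end : ∀ {s y} → WalkAvoiding G F s y → y ∉ F
  walk-end (WalkAvoiding.here y∉F)   = y∉F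
  walk-end (WalkAvoiding.step _ _ p) = walk-end p

  record Component (s : Fin n) : Set where
    field
      κ      : Fin n → Bool
      κ-self : κ s ≡ true
      κ-walk : ∀ {y} → κ y ≡ true → WalkAvoiding G F s y
      κ-adj  : ∀ {y z} → adj G y z ≡ true → y ∉ F → z ∉ F → κ y ≡ κ z

  component : ∀ {s} → s ∉ F → Component s
  component {s} s∉F = grow n (λ y → s == y) (==-refl s) (λ {y} h → subst (WalkAvoiding G F s) (does-true (s Fₚ.≟ y) h) (WalkAvoiding.here s∉F))
                           (ℕₚ.m<m+n n (ℕₚ.≤-trans (s≤s z≤n) (∑-mono-< {f = λ _ → 0} s (λ _ → z≤n) (subst (λ b → 0 < ⟦ b ⟧) (sym (==-refl s)) (s≤s z≤n)))))
    where
    grow : ∀ fuel (κ : Fin n → Bool) → κ s ≡ true → (∀ {y} → κ y ≡ true → WalkAvoiding G F s y) → n < fuel + ∑ℕ (λ y → ⟦ κ y ⟧) → Component s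
    grow zero κ _ _ lt = ⊥-elim (ℕₚ.<⇒≱ lt (ℕₚ.≤-trans (∑-mono {g = λ _ → 1} (λ y → bound (κ y))) (ℕₚ.≤-reflexive (trans (∑-const n 1) (ℕₚ.*-identityʳ n)))))
      where
      bound : ∀ b → ⟦ b ⟧ ≤ 1
      bound true = s≤s z≤n
      bound false = z≤n
    grow (suc fuel) κ κs walk lt
      with Fₚ.any? (λ y → Fₚ.any? (λ z → ((κ y 𝔹.≟ true) ×-dec (κ z 𝔹.≟ false)) ×-dec ((adj G y z 𝔹.≟ true) ×-dec (z ∈ᵇ F 𝔹.≟ false))))
    ... | no closed = record { κ = κ ; κ-self = κs ; κ-walk = walk ; κ-adj = same }
      where
      same : ∀ {y z} → adj G y z ≡ true → y ∉ F → z ∉ F → κ y ≡ κ z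
      same {y} {z} e y∉F z∉F with κ y in ky | κ z in kz
      ... | true  | true  = refl
      ... | false | false = refl
      ... | true  | false = ⊥-elim (closed (y , z , (ky , kz) , e , ¬⇒∈ᵇ z∉F))
      ... | false | true  = ⊥-elim (closed (z , y , (kz , ky) , trans (Graph.sym G z y) e , ¬⇒∈ᵇ y∉F))
    ... | yes (y , z , (ky , kz) , e , z∉) = grow fuel κ′ (cong (_∨ (s == z)) κs) walk′ (ℕₚ.<-≤-trans lt (ℕₚ.≤-trans (ℕₚ.≤-reflexive (sym (ℕₚ.+-suc fuel _))) (ℕₚ.+-monoʳ-≤ fuel bigger)))
      where
      κ′ : Fin n → Bool
      κ′ u = κ u ∨ (u == z)
      walk′ : ∀ {u} → κ′ u ≡ true → WalkAvoiding G F s u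
      walk′ {u} h with κ u in ku
      ... | true = walk ku
      ... | false = subst (WalkAvoiding G F s) (sym (does-true (u Fₚ.≟ z) h)) (walk-snoc (walk ky) e (∈ᵇ⇒∉ z∉))
      bigger : ∑ℕ (λ u → ⟦ κ u ⟧) < ∑ℕ (λ u → ⟦ κ′ u ⟧)
      bigger = ∑-mono-< z mono strict
        where
        mono : ∀ u → ⟦ κ u ⟧ ≤ ⟦ κ′ u ⟧
        mono u with κ u
        ... | true  = ℕₚ.≤-refl
        ... | false = z≤n
        strict : ⟦ κ z ⟧ < ⟦ κ′ z ⟧
        strict rewrite kz | ==-refl z = s≤s z≤n

module Separator {n : ℕ} {G : Graph n} (T : Forest G) (normal : Forest.Normal T) (safe : Fin n → Bool)
                 (F marks : List (Fin n)) (F⊆marks : ∀ {v} → v ∈ F → v ∈ marks) (F-unsafe : ∀ {v} → v ∈ F → safe v ≡ false)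
                 {κ : Fin n → Bool} (κ-adj : ∀ {y z} → adj G y z ≡ true → y ∉ F → z ∉ F → κ y ≡ κ z) where
  open Forest T
  open HeavyLight T
  open Scheme T normal safe
  open Query F marks F⊆marks F-unsafe

  HeavyChild : Fin n → Fin n → Set
  HeavyChild y z = par z ≡ just y × ¬ Light z × κ z ≡ true

  opaque
    heavyChild? : ∀ y → Dec (∃ (HeavyChild y))
    heavyChild? y = Fₚ.any? (λ z → ≡-dec Fₚ._≟_ (par z) (just y) ×-dec (¬? (light? z) ×-dec (κ z 𝔹.≟ true)))

  -- A failed vertex takes over the side of its heavy child, the only unmarked piece that may start right below it.
  side : Fin n → Bool
  side y = if y ∈ᵇ F then does (heavyChild? y) else κ y

  side-alive : ∀ {y} → y ∉ F → side y ≡ κ y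
  side-alive y∉F rewrite ¬⇒∈ᵇ y∉F = refl

  side-heavy : ∀ {y p} → par y ≡ just p → ¬ Light y → y ∉ F → side p ≡ κ y
  side-heavy {y} {p} eq ¬l y∉F with p ∈ᵇ F in pF
  ... | false = κ-adj (par-adj eq) (∈ᵇ⇒∉ pF) y∉F
  ... | true with κ y in ky
  ...   | true = dec-true (heavyChild? p) (y , eq , ¬l , ky)
  ...   | false = dec-false (heavyChild? p) (λ { (z , ez , ¬lz , kz) → true≢false kz (trans (cong κ (heavy-unique ez eq ¬lz ¬l)) ky) })

  sideAbove : Fin n → Bool
  sideAbove y with par y
  ... | nothing = false
  ... | just p  = side p

  -- Exactly the vertices whose nodes the decoder finds in the labels of `marks` and F; a candidate
  -- set may change its side only at these.
  probe : Fin n → Bool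
  probe t = (isLight t ∧ affected t) ∨ (t ∈ᵇ F)

  jump : Fin n → Bool
  jump t = probe t ∧ (side t xor sideAbove t)

  cut : Fin n → Bool
  cut y = ⨁ (λ t → jump t ∧ below t y)

  below-root : ∀ {y} t → par y ≡ nothing → below t y ≡ (t == y)
  below-root {y} t eq with t Fₚ.≟ y
  ... | yes refl = ⇒below ≼-refl
  ... | no ne    = ¬⇒below (ne ∘ ≼-root eq)

  below-par : ∀ {y p} t → par y ≡ just p → below t y ≡ (t == y) xor below t p
  below-par {y} {p} t eq with t Fₚ.≟ y
  ... | yes refl = trans (⇒below ≼-refl) (cong not (sym (¬⇒below {y} {p} (λ le → ℕₚ.<⇒≱ (ℕₚ.≤-reflexive (sym (par-depth eq))) (≼-depth le)))))
  ... | no ne with t ≼? p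
  ...   | yes le = trans (⇒below (≼-up eq le)) (sym (⇒below le))
  ...   | no ¬le = trans (¬⇒below (λ le → ¬le (≼-par eq le ne))) (sym (¬⇒below ¬le))

  cut-own : ∀ y → ⨁ (λ t → jump t ∧ (t == y)) ≡ jump y
  cut-own y = trans (⨁-cong (λ t → 𝔹.∧-comm (jump t) (t == y))) (⨁-δ y jump)

  cut-root : ∀ {y} → par y ≡ nothing → cut y ≡ jump y
  cut-root {y} eq = trans (⨁-cong (λ t → cong (jump t ∧_) (below-root t eq))) (cut-own y)

  cut-par : ∀ {y p} → par y ≡ just p → cut y ≡ jump y xor cut p
  cut-par {y} {p} eq = trans (⨁-cong (λ t → trans (cong (jump t ∧_) (below-par t eq)) (𝔹.∧-distribˡ-xor (jump t) (t == y) (below t p))))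
                             (trans (⨁-xor _ _) (cong (_xor cut p) (cut-own y)))

  sideAbove-par : ∀ {y p} → par y ≡ just p → sideAbove y ≡ side p
  sideAbove-par eq rewrite eq = refl

  sideAbove-root : ∀ {y} → par y ≡ nothing → sideAbove y ≡ false
  sideAbove-root eq rewrite eq = refl

  probe-light : ∀ {y} → Core y → Light y → probe y ≡ true
  probe-light {y} core l with affected? y
  ... | yes a rewrite dec-true (light? y) l = refl
  ... | no ¬a = ⊥-elim (core y (⇒intact l ¬a) ≼-refl)

  -- The jumps telescope along the root path. A core vertex that is no probe is heavy and alive, and
  -- there `side-heavy` shows that the side does not change.
  cut-core : ∀ y → Core y → cut y ≡ side y
  cut-core = ascend _ go
    where
    go : ∀ y → (∀ {p} → par y ≡ just p → Core p → cut p ≡ side p) → Core y → cut y ≡ side y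
    go y rec core with par y in eq
    ... | nothing = trans (cut-root eq) (trans (cong₂ (λ a b → a ∧ (side y xor b)) (probe-light core (root-light eq)) (sideAbove-root eq)) (𝔹.xor-identityʳ (side y)))
    ... | just p with probe y in pr
    ...   | true = trans (cut-par eq) (trans (cong₂ _xor_ (cong₂ (λ a b → a ∧ (side y xor b)) pr (sideAbove-par eq)) (rec refl (core-up (≼-up eq ≼-refl) core))) (xor-cancelʳ (side y) (side p)))
    ...   | false = trans (cut-par eq) (trans (cong₂ _xor_ (cong (_∧ (side y xor sideAbove y)) pr) (rec refl (core-up (≼-up eq ≼-refl) core)))
                      (trans (side-heavy eq ¬l y∉F) (sym (side-alive y∉F))))
      where
      ¬l : ¬ Light y
      ¬l l = true≢false (probe-light core l) pr
      y∉F : y ∉ F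
      y∉F m = true≢false (trans (cong ((isLight y ∧ affected y) ∨_) (⇒∈ᵇ m)) (𝔹.∨-zeroʳ _)) pr

  cut-alive : ∀ {y} → Core y → y ∉ F → cut y ≡ κ y
  cut-alive core y∉F = trans (cut-core _ core) (side-alive y∉F)

  probe-core : ∀ {t} → probe t ≡ true → Core t
  probe-core {t} h with isLight t ∧ affected t in e
  ... | true  = core-affected (does-true (affected? t) (proj₂ (∧-true {isLight t} e))) ≼-refl
  ... | false = core-marks (F⊆marks (∈ᵇ⇒ h))

  -- Every probe is a core vertex, so none lies in an intact subtree, and c and y have the same
  -- probes above them.
  cut-intact : ∀ {c y} → intact c ≡ true → c ≼ y → cut y ≡ cut c
  cut-intact {c} {y} ic c≼y = ⨁-cong term
    where
    term : ∀ t → jump t ∧ below t y ≡ jump t ∧ below t c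
    term t with probe t in pr
    ... | false = refl
    ... | true = cong ((side t xor sideAbove t) ∧_) same
      where
      same : below t y ≡ below t c
      same with t ≼? c
      ... | yes le = trans (⇒below (≼-trans le c≼y)) (sym (⇒below le))
      ... | no ¬le = trans (¬⇒below not-y) (sym (¬⇒below ¬le))
        where
        not-y : ¬ t ≼ y
        not-y le with ≼-linear le c≼y
        ... | inj₁ p = ¬le p
        ... | inj₂ p = probe-core pr c ic p

  cut-total : ∀ {γ w x} → w ∉ F → x ∉ F → coefficient γ (not ∘ affected) w x ∧ Transfers.Balance.total T intact (target w) w x cut ≡ false
  cut-total {γ} {w} {x} w∉F x∉F with coefficient γ (not ∘ affected) w x in v
  ... | false = refl
  ... | true  = Sound.total-sound κ-adj {g = cut} cut-alive cut-intact {γ} w∉F x∉F v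

-- Counting probability

-- Only fair bits are used as a base, so that each space can be sampled exactly from a bit string.
data Space : Set where
  bit : Space
  _⊗_ : Space → Space → Space
  pow : Space → ℕ → Space

infixr 5 _⊗_

El : Space → Set
El bit       = Bool
El (a ⊗ b)   = El a × El b
El (pow a k) = Vec (El a) k

card : Space → ℕ
card bit       = 2
card (a ⊗ b)   = card a * card b
card (pow a k) = card a ^ k

Vectors : ℕ → ℕ → Space
Vectors m n = pow (pow bit m) n

-- The unnormalised counting measure; probabilities appear as ratios to `card`.
∫ : (a : Space) → (El a → ℕ) → ℕ
∫ bit             f = f true + f false
∫ (a ⊗ b)         f = ∫ a (λ x → ∫ b (λ y → f (x , y)))
∫ (pow a zero)    f = f []
∫ (pow a (suc k)) f = ∫ a (λ x → ∫ (pow a k) (λ v → f (x ∷ v)))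

∫-mono : ∀ a {f g} → (∀ ω → f ω ≤ g ω) → ∫ a f ≤ ∫ a g
∫-mono bit             h = ℕₚ.+-mono-≤ (h true) (h false)
∫-mono (a ⊗ b)         h = ∫-mono a (λ x → ∫-mono b (λ y → h (x , y)))
∫-mono (pow a zero)    h = h []
∫-mono (pow a (suc k)) h = ∫-mono a (λ x → ∫-mono (pow a k) (λ v → h (x ∷ v)))

∫-cong : ∀ a {f g} → (∀ ω → f ω ≡ g ω) → ∫ a f ≡ ∫ a g
∫-cong a h = ℕₚ.≤-antisym (∫-mono a (ℕₚ.≤-reflexive ∘ h)) (∫-mono a (ℕₚ.≤-reflexive ∘ sym ∘ h))

∫-+ : ∀ a f g → ∫ a (λ ω → f ω + g ω) ≡ ∫ a f + ∫ a g
∫-+ bit             f g = +-middle (f true) (g true) (f false) (g false)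
∫-+ (a ⊗ b)         f g = trans (∫-cong a (λ x → ∫-+ b _ _)) (∫-+ a _ _)
∫-+ (pow a zero)    f g = refl
∫-+ (pow a (suc k)) f g = trans (∫-cong a (λ x → ∫-+ (pow a k) _ _)) (∫-+ a _ _)

∫-*ʳ : ∀ a f c → ∫ a (λ ω → f ω * c) ≡ ∫ a f * c
∫-*ʳ bit             f c = sym (ℕₚ.*-distribʳ-+ c (f true) (f false))
∫-*ʳ (a ⊗ b)         f c = trans (∫-cong a (λ x → ∫-*ʳ b _ c)) (∫-*ʳ a _ c)
∫-*ʳ (pow a zero)    f c = refl
∫-*ʳ (pow a (suc k)) f c = trans (∫-cong a (λ x → ∫-*ʳ (pow a k) _ c)) (∫-*ʳ a _ c)

∫-*ˡ : ∀ a c f → ∫ a (λ ω → c * f ω) ≡ c * ∫ a f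
∫-*ˡ a c f = trans (∫-cong a (λ ω → ℕₚ.*-comm c (f ω))) (trans (∫-*ʳ a f c) (ℕₚ.*-comm _ c))

∫-const : ∀ a c → ∫ a (λ _ → c) ≡ card a * c
∫-const bit             c = cong (c +_) (sym (ℕₚ.+-identityʳ c))
∫-const (a ⊗ b)         c = trans (∫-cong a (λ _ → ∫-const b c)) (trans (∫-const a _) (sym (ℕₚ.*-assoc (card a) (card b) c)))
∫-const (pow a zero)    c = sym (ℕₚ.+-identityʳ c)
∫-const (pow a (suc k)) c = trans (∫-cong a (λ _ → ∫-const (pow a k) c)) (trans (∫-const a _) (sym (ℕₚ.*-assoc (card a) _ c)))

∫-swap : ∀ a b (f : El a → El b → ℕ) → ∫ a (λ x → ∫ b (f x)) ≡ ∫ b (λ y → ∫ a (λ x → f x y))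
∫-swap bit             b f = sym (∫-+ b (f true) (f false))
∫-swap (a ⊗ a′)        b f = trans (∫-cong a (λ x → ∫-swap a′ b (λ y → f (x , y)))) (∫-swap a b _)
∫-swap (pow a zero)    b f = refl
∫-swap (pow a (suc k)) b f = trans (∫-cong a (λ x → ∫-swap (pow a k) b (λ v → f (x ∷ v)))) (∫-swap a b _)

-- Fubini with coordinate i integrated innermost, the other coordinates held fixed.
∫-at : ∀ a {k} (i : Fin (suc k)) (f : El a → Vec (El a) k → ℕ) →
       ∫ (pow a (suc k)) (λ v → f (lookup v i) (removeAt v i)) ≡ ∫ (pow a k) (λ r → ∫ a (λ x → f x r))
∫-at a {k}     zero    f = ∫-swap a (pow a k) f
∫-at a {suc k} (suc i) f = ∫-cong a (λ y → ∫-at a i (λ x r → f x (y ∷ r)))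

⟦∨⟧ : ∀ p q → ⟦ p ∨ q ⟧ ≤ ⟦ p ⟧ + ⟦ q ⟧
⟦∨⟧ true  q = s≤s z≤n
⟦∨⟧ false q = ℕₚ.≤-refl

⟦∧⟧ : ∀ p q → ⟦ p ∧ q ⟧ ≡ ⟦ p ⟧ * ⟦ q ⟧
⟦∧⟧ true  q = sym (ℕₚ.+-identityʳ ⟦ q ⟧)
⟦∧⟧ false q = refl

-- P has probability at most N / D.
record Rare (a : Space) (N D : ℕ) (P : El a → Set) : Set where
  constructor rare
  field
    event  : El a → Bool
    covers : ∀ {ω} → P ω → event ω ≡ true
    bound  : ∫ a (λ ω → ⟦ event ω ⟧) * D ≤ N * card a

open Rare public

rare-⊆ : ∀ {a N D P Q} → (∀ {ω} → Q ω → P ω) → Rare a N D P → Rare a N D Q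
rare-⊆ sub r = rare (event r) (covers r ∘ sub) (bound r)

rare-scale : ∀ {a N D N′ D′ P} → .{{_ : ℕ.NonZero D}} → N * D′ ≤ N′ * D → Rare a N D P → Rare a N′ D′ P
rare-scale {a} {N} {D} {N′} {D′} le r = rare (event r) (covers r) (ℕₚ.*-cancelʳ-≤ _ _ D (begin
  μ * D′ * D  ≡⟨ ℕₚ.*-assoc μ D′ D ⟩
  μ * (D′ * D)  ≡⟨ cong (μ *_) (ℕₚ.*-comm D′ D) ⟩
  μ * (D * D′)  ≡⟨ ℕₚ.*-assoc μ D D′ ⟨
  μ * D * D′  ≤⟨ ℕₚ.*-monoˡ-≤ D′ (bound r) ⟩
  N * card a * D′  ≡⟨ ℕₚ.*-assoc N (card a) D′ ⟩
  N * (card a * D′) ≡⟨ cong (N *_) (ℕₚ.*-comm (card a) D′) ⟩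
  N * (D′ * card a) ≡⟨ ℕₚ.*-assoc N D′ (card a) ⟨
  N * D′ * card a  ≤⟨ ℕₚ.*-monoˡ-≤ (card a) le ⟩
  N′ * D * card a  ≡⟨ ℕₚ.*-assoc N′ D (card a) ⟩
  N′ * (D * card a) ≡⟨ cong (N′ *_) (ℕₚ.*-comm D (card a)) ⟩
  N′ * (card a * D) ≡⟨ ℕₚ.*-assoc N′ (card a) D ⟨
  N′ * card a * D  ∎))
  where
  open ℕₚ.≤-Reasoning
  μ : ℕ
  μ = ∫ a (λ ω → ⟦ event r ω ⟧)

never : ∀ {a N D P} → (∀ {ω} → ¬ P ω) → Rare a N D P
never {a} {N} {D} ¬p = rare (λ _ → false) (λ p → ⊥-elim (¬p p)) (ℕₚ.≤-trans (ℕₚ.≤-reflexive (trans (cong (_* D) (∫-const a 0)) (cong (_* D) (ℕₚ.*-zeroʳ (card a))))) z≤n)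

rare-∪ : ∀ {a N M D P Q} → Rare a N D P → Rare a M D Q → Rare a (N + M) D (λ ω → P ω ⊎ Q ω)
rare-∪ {a} {N} {M} {D} {P} {Q} r q = rare (λ ω → event r ω ∨ event q ω) both (begin
  ∫ a (λ ω → ⟦ event r ω ∨ event q ω ⟧) * D  ≤⟨ ℕₚ.*-monoˡ-≤ D (∫-mono a (λ ω → ⟦∨⟧ (event r ω) (event q ω))) ⟩
  ∫ a (λ ω → ⟦ event r ω ⟧ + ⟦ event q ω ⟧) * D  ≡⟨ cong (_* D) (∫-+ a _ _) ⟩
  (∫ a (λ ω → ⟦ event r ω ⟧) + ∫ a (λ ω → ⟦ event q ω ⟧)) * D  ≡⟨ ℕₚ.*-distribʳ-+ D (∫ a (λ ω → ⟦ event r ω ⟧)) _ ⟩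
  ∫ a (λ ω → ⟦ event r ω ⟧) * D + ∫ a (λ ω → ⟦ event q ω ⟧) * D  ≤⟨ ℕₚ.+-mono-≤ (bound r) (bound q) ⟩
  N * card a + M * card a  ≡⟨ ℕₚ.*-distribʳ-+ (card a) N M ⟨
  (N + M) * card a  ∎)
  where
  open ℕₚ.≤-Reasoning
  both : ∀ {ω} → P ω ⊎ Q ω → event r ω ∨ event q ω ≡ true
  both (inj₁ p) rewrite covers r p = refl
  both {ω} (inj₂ p) rewrite covers q p = 𝔹.∨-zeroʳ (event r ω)

rare-⋃ : ∀ {a N D k} {P : Fin k → El a → Set} → (∀ i → Rare a N D (P i)) → Rare a (k * N) D (λ ω → ∃ λ i → P i ω)
rare-⋃ {k = zero}  r = never (λ { (() , _) })
rare-⋃ {k = suc k} r = rare-⊆ (λ { (zero , p) → inj₁ p ; (suc i , p) → inj₂ (i , p) }) (rare-∪ (r zero) (rare-⋃ (r ∘ suc)))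

rare-⋃-vec : ∀ {a N D} k {P : Vec Bool k → El a → Set} → (∀ v → Rare a N D (P v)) → Rare a (2 ^ k * N) D (λ ω → ∃ λ v → P v ω)
rare-⋃-vec {a} {N} {D} zero    {P} r = subst (λ M → Rare a M D (λ ω → ∃ λ v → P v ω)) (sym (ℕₚ.+-identityʳ N)) (rare-⊆ (λ { ([] , p) → p }) (r []))
rare-⋃-vec {a} {N} {D} (suc k) {P} r = subst (λ M → Rare a M D (λ ω → ∃ λ v → P v ω)) eq
  (rare-⊆ (λ { (true ∷ v , p) → inj₁ (v , p) ; (false ∷ v , p) → inj₂ (v , p) }) (rare-∪ (rare-⋃-vec k (r ∘ (true ∷_))) (rare-⋃-vec k (r ∘ (false ∷_)))))
  where
  eq : 2 ^ k * N + 2 ^ k * N ≡ 2 ^ suc k * N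
  eq = trans (sym (ℕₚ.*-distribʳ-+ N (2 ^ k) (2 ^ k))) (cong (λ e → (2 ^ k + e) * N) (sym (ℕₚ.+-identityʳ (2 ^ k))))

rare-⋃-list : ∀ {a N D} {A : Set} (xs : List A) {P : A → El a → Set} → (∀ x → Rare a N D (P x)) → Rare a (length xs * N) D (λ ω → ∃ λ x → x ∈ xs × P x ω)
rare-⋃-list []       r = never (λ { (_ , () , _) })
rare-⋃-list (x ∷ xs) r = rare-⊆ (λ { (_ , here refl , p) → inj₁ p ; (y , there m , p) → inj₂ (y , m , p) }) (rare-∪ (r x) (rare-⋃-list xs r))

-- Conditioning: the covering event may be chosen anew for each x, as long as the bound is uniform.
rare-given : ∀ {a b N D P} → (∀ x → Rare b N D (λ y → P (x , y))) → Rare (a ⊗ b) N D P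
rare-given {a} {b} {N} {D} r = rare (λ { (x , y) → event (r x) y }) (λ { {x , y} → covers (r x) }) (begin
  ∫ a (λ x → μ x) * D  ≡⟨ ∫-*ʳ a μ D ⟨
  ∫ a (λ x → μ x * D)  ≤⟨ ∫-mono a (λ x → bound (r x)) ⟩
  ∫ a (λ _ → N * card b)  ≡⟨ ∫-const a _ ⟩
  card a * (N * card b)  ≡⟨ ℕₚ.*-assoc (card a) N (card b) ⟨
  card a * N * card b  ≡⟨ cong (_* card b) (ℕₚ.*-comm (card a) N) ⟩
  N * card a * card b  ≡⟨ ℕₚ.*-assoc N (card a) (card b) ⟩
  N * (card a * card b)  ∎)
  where
  open ℕₚ.≤-Reasoning
  μ : El a → ℕ
  μ x = ∫ b (λ y → ⟦ event (r x) y ⟧)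

rare-fst : ∀ {a b N D} {P : El a → Set} → Rare a N D P → Rare (a ⊗ b) N D (P ∘ proj₁)
rare-fst {a} {b} {N} {D} r = rare (event r ∘ proj₁) (covers r) (begin
  ∫ a (λ x → ∫ b (λ _ → ⟦ event r x ⟧)) * D  ≡⟨ cong (_* D) (trans (∫-cong a (λ x → ∫-const b _)) (∫-*ˡ a (card b) _)) ⟩
  card b * μ * D  ≡⟨ ℕₚ.*-assoc (card b) μ D ⟩
  card b * (μ * D)  ≤⟨ ℕₚ.*-monoʳ-≤ (card b) (bound r) ⟩
  card b * (N * card a)  ≡⟨ ℕₚ.*-comm (card b) _ ⟩
  N * card a * card b  ≡⟨ ℕₚ.*-assoc N (card a) (card b) ⟩
  N * (card a * card b)  ∎)
  where
  open ℕₚ.≤-Reasoning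
  μ : ℕ
  μ = ∫ a (λ x → ⟦ event r x ⟧)

_≡ᵛ_ : ∀ {m} → Vec Bool m → Vec Bool m → Bool
[]      ≡ᵛ []      = true
(x ∷ v) ≡ᵛ (y ∷ w) = not (x xor y) ∧ (v ≡ᵛ w)

≡ᵛ-refl : ∀ {m} (v : Vec Bool m) → v ≡ᵛ v ≡ true
≡ᵛ-refl []      = refl
≡ᵛ-refl (x ∷ v) = cong₂ _∧_ (cong not (𝔹.xor-same x)) (≡ᵛ-refl v)

∫-point : ∀ {m} (v : Vec Bool m) → ∫ (pow bit m) (λ u → ⟦ u ≡ᵛ v ⟧) ≡ 1
∫-point []              = refl
∫-point {suc m} (true ∷ v)  = cong₂ _+_ (∫-point v) (trans (∫-const (pow bit m) 0) (ℕₚ.*-zeroʳ (2 ^ m)))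
∫-point {suc m} (false ∷ v) = cong₂ _+_ (trans (∫-const (pow bit m) 0) (ℕₚ.*-zeroʳ (2 ^ m))) (∫-point v)

-- Once the other coordinates are drawn, a single one of the 2^m values remains for coordinate i.
rare-forced : ∀ {m k} {P : Vec (Vec Bool m) (suc k) → Set} (i : Fin (suc k)) (φ : Vec (Vec Bool m) k → Vec Bool m) →
              (∀ {v} → P v → lookup v i ≡ φ (removeAt v i)) → Rare (pow (pow bit m) (suc k)) 1 (2 ^ m) P
rare-forced {m} {k} i φ h = rare (λ v → lookup v i ≡ᵛ φ (removeAt v i)) (λ {v} p → trans (cong (_≡ᵛ φ (removeAt v i)) (h p)) (≡ᵛ-refl (φ (removeAt v i)))) (ℕₚ.≤-reflexive (begin
  ∫ (pow (pow bit m) (suc k)) (λ v → ⟦ lookup v i ≡ᵛ φ (removeAt v i) ⟧) * 2 ^ m  ≡⟨ cong (_* 2 ^ m) (∫-at (pow bit m) i (λ x r → ⟦ x ≡ᵛ φ r ⟧)) ⟩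
  ∫ (pow (pow bit m) k) (λ r → ∫ (pow bit m) (λ x → ⟦ x ≡ᵛ φ r ⟧)) * 2 ^ m  ≡⟨ cong (_* 2 ^ m) (∫-cong (pow (pow bit m) k) (λ r → ∫-point (φ r))) ⟩
  ∫ (pow (pow bit m) k) (λ _ → 1) * 2 ^ m  ≡⟨ cong (_* 2 ^ m) (∫-const (pow (pow bit m) k) 1) ⟩
  (2 ^ m) ^ k * 1 * 2 ^ m  ≡⟨ cong (_* 2 ^ m) (ℕₚ.*-identityʳ ((2 ^ m) ^ k)) ⟩
  (2 ^ m) ^ k * 2 ^ m  ≡⟨ ℕₚ.*-comm ((2 ^ m) ^ k) (2 ^ m) ⟩
  (2 ^ m) ^ suc k  ≡⟨ ℕₚ.+-identityʳ _ ⟨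
  1 * (2 ^ m) ^ suc k  ∎))
  where open ≡-Reasoning

-- Independence of the coordinates: the measures of the covering events multiply.
rare-all : ∀ {a N D} k {P : El a → Set} → Rare a N D P → Rare (pow a k) (N ^ k) (D ^ k) (λ v → ∀ i → P (lookup v i))
rare-all {a} {N} {D} k {P} r = rare (every k) (λ {v} h → holds v h) (bounded k)
  where
  every : ∀ k → Vec (El a) k → Bool
  every zero    []      = true
  every (suc k) (x ∷ v) = event r x ∧ every k v
  holds : ∀ {k} (v : Vec (El a) k) → (∀ i → P (lookup v i)) → every k v ≡ true
  holds []      h = refl
  holds (x ∷ v) h = cong₂ _∧_ (covers r (h zero)) (holds v (h ∘ suc))
  μ : ℕ
  μ = ∫ a (λ x → ⟦ event r x ⟧)
  product : ∀ k → ∫ (pow a k) (λ v → ⟦ every k v ⟧) ≡ μ ^ k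
  product zero    = refl
  product (suc k) = trans (∫-cong a (λ x → trans (∫-cong (pow a k) (λ v → ⟦∧⟧ (event r x) (every k v))) (trans (∫-*ˡ (pow a k) ⟦ event r x ⟧ _) (cong (⟦ event r x ⟧ *_) (product k)))))
                          (∫-*ʳ a _ (μ ^ k))
  *-^ : ∀ x y k → x ^ k * y ^ k ≡ (x * y) ^ k
  *-^ x y zero    = refl
  *-^ x y (suc k) = trans (*-middle x (x ^ k) y (y ^ k)) (cong (x * y *_) (*-^ x y k))
  bounded : ∀ k → ∫ (pow a k) (λ v → ⟦ every k v ⟧) * D ^ k ≤ N ^ k * card a ^ k
  bounded k = begin
    ∫ (pow a k) (λ v → ⟦ every k v ⟧) * D ^ k  ≡⟨ cong (_* D ^ k) (product k) ⟩
    μ ^ k * D ^ k  ≡⟨ *-^ μ D k ⟩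
    (μ * D) ^ k  ≤⟨ ℕₚ.^-monoˡ-≤ k (bound r) ⟩
    (N * card a) ^ k  ≡⟨ *-^ N (card a) k ⟨
    N ^ k * card a ^ k  ∎
    where open ℕₚ.≤-Reasoning

module Missing {a : Space} (p : El a → Bool) (Q : ℕ) (miss : ∫ a (λ x → ⟦ not (p x) ⟧) ≡ Q) (size : card a ≡ suc Q) where

  misses : ∀ {n} → (Fin n → Bool) → Vec (El a) n → Bool
  misses N []      = true
  misses N (x ∷ v) = (if N zero then not (p x) else true) ∧ misses (N ∘ suc) v

  misses-intro : ∀ {n} (N : Fin n → Bool) v → (∀ i → N i ≡ true → p (lookup v i) ≡ false) → misses N v ≡ true
  misses-intro N []      h = refl
  misses-intro N (x ∷ v) h = cong₂ _∧_ first (misses-intro (N ∘ suc) v (h ∘ suc))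
    where
    first : (if N zero then not (p x) else true) ≡ true
    first with N zero in e
    ... | true  = cong not (h zero e)
    ... | false = refl

  -- Each coordinate in N independently contributes the factor Q / (Q + 1); the equation is this
  -- product cleared of denominators.
  ∫-misses : ∀ {n} (N : Fin n → Bool) → ∫ (pow a n) (λ v → ⟦ misses N v ⟧) * suc Q ^ count N ≡ Q ^ count N * suc Q ^ n
  ∫-misses {zero}  N = refl
  ∫-misses {suc n} N = trans (cong (_* suc Q ^ count N) (trans (∫-cong a (λ x → trans (∫-cong (pow a n) (λ v → ⟦∧⟧ (if N zero then not (p x) else true) (misses (N ∘ suc) v))) (∫-*ˡ (pow a n) ⟦ if N zero then not (p x) else true ⟧ (λ v → ⟦ misses (N ∘ suc) v ⟧)))) (∫-*ʳ a _ rest)))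
                             (head (N zero))
    where
    rest : ℕ
    rest = ∫ (pow a n) (λ v → ⟦ misses (N ∘ suc) v ⟧)
    head : ∀ b → ∫ a (λ x → ⟦ if b then not (p x) else true ⟧) * rest * suc Q ^ (⟦ b ⟧ + count (N ∘ suc)) ≡ Q ^ (⟦ b ⟧ + count (N ∘ suc)) * suc Q ^ suc n
    head true = begin
      ∫ a (λ x → ⟦ not (p x) ⟧) * rest * (suc Q * suc Q ^ count (N ∘ suc))  ≡⟨ cong (λ m → m * rest * (suc Q * suc Q ^ count (N ∘ suc))) miss ⟩
      Q * rest * (suc Q * suc Q ^ count (N ∘ suc))  ≡⟨ *-middle Q rest (suc Q) _ ⟩
      Q * suc Q * (rest * suc Q ^ count (N ∘ suc))  ≡⟨ cong (Q * suc Q *_) (∫-misses (N ∘ suc)) ⟩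
      Q * suc Q * (Q ^ count (N ∘ suc) * suc Q ^ n)  ≡⟨ *-middle Q (suc Q) _ _ ⟩
      Q * Q ^ count (N ∘ suc) * (suc Q * suc Q ^ n)  ∎
      where open ≡-Reasoning
    head false = begin
      ∫ a (λ x → 1) * rest * suc Q ^ count (N ∘ suc)  ≡⟨ cong (λ m → m * rest * suc Q ^ count (N ∘ suc)) (trans (∫-const a 1) (trans (ℕₚ.*-identityʳ _) size)) ⟩
      suc Q * rest * suc Q ^ count (N ∘ suc)  ≡⟨ ℕₚ.*-assoc (suc Q) rest _ ⟩
      suc Q * (rest * suc Q ^ count (N ∘ suc))  ≡⟨ cong (suc Q *_) (∫-misses (N ∘ suc)) ⟩
      suc Q * (Q ^ count (N ∘ suc) * suc Q ^ n)  ≡⟨ ℕₚ.*-assoc (suc Q) (Q ^ count (N ∘ suc)) _ ⟨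
      suc Q * Q ^ count (N ∘ suc) * suc Q ^ n  ≡⟨ cong (_* suc Q ^ n) (ℕₚ.*-comm (suc Q) (Q ^ count (N ∘ suc))) ⟩
      Q ^ count (N ∘ suc) * suc Q * suc Q ^ n  ≡⟨ ℕₚ.*-assoc (Q ^ count (N ∘ suc)) (suc Q) _ ⟩
      Q ^ count (N ∘ suc) * (suc Q * suc Q ^ n)  ∎
      where open ≡-Reasoning

-- Sampling from random bits and counting good bit strings

bits : Space → ℕ
bits bit       = 1
bits (a ⊗ b)   = bits a + bits b
bits (pow a k) = k * bits a

cutAt : ∀ {A : Set} m {k} → Vec A (m + k) → Vec A m × Vec A k
cutAt zero    v       = [] , v
cutAt (suc m) (x ∷ v) = x ∷ proj₁ (cutAt m v) , proj₂ (cutAt m v)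

sample : (a : Space) → Vec Bool (bits a) → El a
sample bit             (b ∷ []) = b
sample (a ⊗ b)         v = sample a (proj₁ (cutAt (bits a) v)) , sample b (proj₂ (cutAt (bits a) v))
sample (pow a zero)    v = []
sample (pow a (suc k)) v = sample a (proj₁ (cutAt (bits a) v)) ∷ sample (pow a k) (proj₂ (cutAt (bits a) v))

∫-cutAt : ∀ m {k} (f : Vec Bool m × Vec Bool k → ℕ) → ∫ (pow bit (m + k)) (f ∘ cutAt m) ≡ ∫ (pow bit m) (λ u → ∫ (pow bit k) (λ v → f (u , v)))
∫-cutAt zero    f = refl
∫-cutAt (suc m) f = cong₂ _+_ (∫-cutAt m (λ { (u , v) → f (true ∷ u , v) })) (∫-cutAt m (λ { (u , v) → f (false ∷ u , v) }))

∫-sample : ∀ a (f : El a → ℕ) → ∫ (pow bit (bits a)) (f ∘ sample a) ≡ ∫ a f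
∫-sample bit             f = refl
∫-sample (a ⊗ b)         f = trans (∫-cutAt (bits a) (λ { (u , v) → f (sample a u , sample b v) }))
                                   (trans (∫-cong (pow bit (bits a)) (λ u → ∫-sample b (λ y → f (sample a u , y)))) (∫-sample a _))
∫-sample (pow a zero)    f = refl
∫-sample (pow a (suc k)) f = trans (∫-cutAt (bits a) (λ { (u , v) → f (sample a u ∷ sample (pow a k) v) }))
                                   (trans (∫-cong (pow bit (bits a)) (λ u → ∫-sample (pow a k) (λ y → f (sample a u ∷ y)))) (∫-sample a _))

card-bits : ∀ a → card a ≡ 2 ^ bits a
card-bits a = trans (sym (trans (∫-const a 1) (ℕₚ.*-identityʳ (card a)))) (trans (sym (∫-sample a (λ _ → 1))) (trans (∫-const (pow bit (bits a)) 1) (ℕₚ.*-identityʳ _)))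

strings : ∀ r → List (Vec Bool r)
strings zero    = [] ∷ []
strings (suc r) = List.map (true ∷_) (strings r) ++ List.map (false ∷_) (strings r)

strings-unique : ∀ r → Unique (strings r)
strings-unique zero    = [] ∷ []
strings-unique (suc r) = Uniqueₚ.++⁺ (Uniqueₚ.map⁺ (λ { refl → refl }) (strings-unique r)) (Uniqueₚ.map⁺ (λ { refl → refl }) (strings-unique r))
  (λ { (m , m′) → clash (∈-map⁻ (true ∷_) m) (∈-map⁻ (false ∷_) m′) })
  where
  clash : ∀ {v} → (∃ λ u → u ∈ strings r × v ≡ true ∷ u) → (∃ λ u → u ∈ strings r × v ≡ false ∷ u) → ⊥
  clash (_ , _ , refl) (_ , _ , ())

keep : ∀ {r} → (Vec Bool r → Bool) → List (Vec Bool r)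
keep {r} b = filterᵇ (not ∘ b) (strings r)

length-keep : ∀ r (b : Vec Bool r → Bool) → length (keep b) + ∫ (pow bit r) (λ v → ⟦ b v ⟧) ≡ 2 ^ r
length-keep zero    b with b []
... | true  = refl
... | false = refl
length-keep (suc r) b = begin
  length (filterᵇ (not ∘ b) (List.map (true ∷_) (strings r) ++ List.map (false ∷_) (strings r))) + (μ true + μ false)  ≡⟨ cong (λ l → length l + (μ true + μ false)) (Listₚ.filter-++ _ (List.map (true ∷_) (strings r)) _) ⟩
  length (filterᵇ (not ∘ b) (List.map (true ∷_) (strings r)) ++ filterᵇ (not ∘ b) (List.map (false ∷_) (strings r))) + (μ true + μ false) ≡⟨ cong (_+ (μ true + μ false)) (Listₚ.length-++ (filterᵇ (not ∘ b) (List.map (true ∷_) (strings r)))) ⟩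
  (length (filterᵇ (not ∘ b) (List.map (true ∷_) (strings r))) + length (filterᵇ (not ∘ b) (List.map (false ∷_) (strings r)))) + (μ true + μ false) ≡⟨ cong₂ (λ i j → (i + j) + (μ true + μ false)) (half true (strings r)) (half false (strings r)) ⟩
  (length (keep (b ∘ (true ∷_))) + length (keep (b ∘ (false ∷_)))) + (μ true + μ false) ≡⟨ +-middle (length (keep (b ∘ (true ∷_)))) (length (keep (b ∘ (false ∷_)))) (μ true) (μ false) ⟩
  (length (keep (b ∘ (true ∷_))) + μ true) + (length (keep (b ∘ (false ∷_))) + μ false) ≡⟨ cong₂ _+_ (length-keep r (b ∘ (true ∷_))) (length-keep r (b ∘ (false ∷_))) ⟩
  2 ^ r + 2 ^ r ≡⟨ cong (2 ^ r +_) (ℕₚ.+-identityʳ (2 ^ r)) ⟨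
  2 ^ suc r ∎
  where
  open ≡-Reasoning
  μ : Bool → ℕ
  μ c = ∫ (pow bit r) (λ v → ⟦ b (c ∷ v) ⟧)
  half : ∀ c (l : List (Vec Bool r)) → length (filterᵇ (not ∘ b) (List.map (c ∷_) l)) ≡ length (filterᵇ (not ∘ b ∘ (c ∷_)) l)
  half c []      = refl
  half c (v ∷ l) with b (c ∷ v)
  ... | true  = half c l
  ... | false = cong suc (half c l)

-- Linear algebra over the two-element field

dot : ∀ {m} → (Fin m → Bool) → (Fin m → Bool) → Bool
dot μ b = ⨁ (λ i → μ i ∧ b i)

dot-congˡ : ∀ {m} {μ ν : Fin m → Bool} (b : Fin m → Bool) → (∀ i → μ i ≡ ν i) → dot μ b ≡ dot ν b
dot-congˡ b e = ⨁-cong (λ i → cong (_∧ b i) (e i))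

dot-xorˡ : ∀ {m} (μ ν b : Fin m → Bool) → dot (λ i → μ i xor ν i) b ≡ dot μ b xor dot ν b
dot-xorˡ μ ν b = trans (⨁-cong (λ i → 𝔹.∧-distribʳ-xor (b i) (μ i) (ν i))) (⨁-xor _ _)

dot-xorʳ : ∀ {m} (μ a b : Fin m → Bool) → dot μ (λ i → a i xor b i) ≡ dot μ a xor dot μ b
dot-xorʳ μ a b = trans (⨁-cong (λ i → 𝔹.∧-distribˡ-xor (μ i) (a i) (b i))) (⨁-xor _ _)

dot-⨁ʳ : ∀ {m n} (μ : Fin m → Bool) (e : Fin n → Bool) (a : Fin n → Fin m → Bool) →
         dot μ (λ i → ⨁ (λ x → e x ∧ a x i)) ≡ ⨁ (λ x → e x ∧ dot μ (a x))
dot-⨁ʳ μ e a = begin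
  ⨁ (λ i → μ i ∧ ⨁ (λ x → e x ∧ a x i))  ≡⟨ ⨁-cong (λ i → ⨁-∧ˡ (μ i) _) ⟨
  ⨁ (λ i → ⨁ (λ x → μ i ∧ (e x ∧ a x i)))  ≡⟨ ⨁-swap _ ⟩
  ⨁ (λ x → ⨁ (λ i → μ i ∧ (e x ∧ a x i)))  ≡⟨ ⨁-cong (λ x → trans (⨁-cong (λ i → ∧-left (μ i) (e x) (a x i))) (⨁-∧ˡ (e x) _)) ⟩
  ⨁ (λ x → e x ∧ dot μ (a x))  ∎
  where
  open ≡-Reasoning

combine : ∀ {m} {A : Set} (α : A → Fin m → Bool) (F : List A) → Vec Bool (length F) → Fin m → Bool
combine α []      []      i = false
combine α (v ∷ F) (p ∷ φ) i = (p ∧ α v i) xor combine α F φ i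

Spanned : ∀ {m} {A : Set} → (A → Fin m → Bool) → List A → (Fin m → Bool) → Set
Spanned α F b = ∃ λ φ → ∀ i → b i ≡ combine α F φ i

Detector : ∀ {m} {A : Set} → (A → Fin m → Bool) → List A → (Fin m → Bool) → Set
Detector {m} α F b = ∃ λ (μ : Fin m → Bool) → (∀ {v} → v ∈ F → dot μ (α v) ≡ false) × dot μ b ≡ true

-- Duality by induction on F. If a detector μ of b for F does not kill v, the vector v + b is tested
-- too; should its detector ν also fail to kill v, then ν b vanishes, and μ + ν kills v and still
-- detects b.
spanned-or-detected : ∀ {m} {A : Set} (α : A → Fin m → Bool) F b → Spanned α F b ⊎ Detector α F b
spanned-or-detected {m} α [] b with Fₚ.any? (λ i → b i 𝔹.≟ true)
... | yes (i , bi) = inj₂ ((λ j → j == i) , (λ ()) , trans (⨁-δ i b) bi)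
... | no none = inj₁ ([] , λ i → 𝔹.¬-not (λ bi → none (i , bi)))
spanned-or-detected {m} α (v ∷ F) b with spanned-or-detected α F b
... | inj₁ (φ , h) = inj₁ (false ∷ φ , h)
... | inj₂ (μ , ⊥F , μb) with dot μ (α v) in μv
...   | false = inj₂ (μ , (λ { (here refl) → μv ; (there m) → ⊥F m }) , μb)
...   | true with spanned-or-detected α F (λ i → α v i xor b i)
...     | inj₁ (φ , h) = inj₁ (true ∷ φ , λ i → trans (solve (α v i) (b i)) (cong (α v i xor_) (h i)))
  where
  solve : ∀ a b → b ≡ a xor (a xor b)
  solve true  b = sym (𝔹.not-involutive b)
  solve false b = refl
...     | inj₂ (ν , ⊥F′ , νb) with dot ν (α v) in νv
...       | false = inj₂ (ν , (λ { (here refl) → νv ; (there m) → ⊥F′ m }) , trans (sym (trans (dot-xorʳ ν (α v) b) (cong (_xor dot ν b) νv))) νb)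
...       | true = inj₂ ((λ i → μ i xor ν i) , perp , trans (dot-xorˡ μ ν b) (cong₂ _xor_ μb ν-b))
  where
  perp : ∀ {u} → u ∈ v ∷ F → dot (λ i → μ i xor ν i) (α u) ≡ false
  perp (here refl) = trans (dot-xorˡ μ ν (α v)) (cong₂ _xor_ μv νv)
  perp (there m)   = trans (dot-xorˡ μ ν _) (cong₂ _xor_ (⊥F m) (⊥F′ m))
  ν-b : dot ν b ≡ false
  ν-b = trans (sym (𝔹.not-involutive (dot ν b))) (cong not (trans (sym (trans (dot-xorʳ ν (α v) b) (cong (_xor dot ν b) νv))) νb))

entry : ∀ {m n} → Vec (Vec Bool m) n → Fin n → Fin m → Bool
entry α x = lookup (lookup α x)

lookup-removeAt : ∀ {A : Set} {k} (v : Vec A (suc k)) i j → lookup (removeAt v i) j ≡ lookup v (punchIn i j)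
lookup-removeAt (x ∷ v)     zero    j       = refl
lookup-removeAt (x ∷ y ∷ v) (suc i) zero    = refl
lookup-removeAt (x ∷ y ∷ v) (suc i) (suc j) = lookup-removeAt (y ∷ v) i j

-- The vector at x₀ has coefficient one, so the equations express it by the other vectors and
-- `rare-forced` applies.
rare-affine : ∀ {m n} (e : Fin n → Bool) (b : Bool) x₀ → e x₀ ≡ true →
              Rare (Vectors m n) 1 (2 ^ m) (λ α → ∀ i → b xor ⨁ (λ x → e x ∧ entry α x i) ≡ false)
rare-affine {m} {suc k} e b x₀ ex₀ = rare-forced x₀ (λ r → tabulate (others r)) (λ {α} → forced {α})
  where
  others : Vec (Vec Bool m) k → Fin m → Bool
  others r i = b xor ⨁ (λ j → e (punchIn x₀ j) ∧ entry r j i)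
  forced : ∀ {α} → (∀ i → b xor ⨁ (λ x → e x ∧ entry α x i) ≡ false) → lookup α x₀ ≡ tabulate (others (removeAt α x₀))
  forced {α} h = trans (sym (Vecₚ.tabulate∘lookup (lookup α x₀))) (Vecₚ.tabulate-cong (λ i → trans (xor-false⇒≡ _ _ (own i)) (cong (b xor_) (⨁-cong (λ j → cong (λ u → e (punchIn x₀ j) ∧ lookup u i) (sym (lookup-removeAt α x₀ j)))))))
    where
    rest : Fin m → Bool
    rest i = ⨁ (λ j → e (punchIn x₀ j) ∧ entry α (punchIn x₀ j) i)
    rotate : ∀ a r → a xor (b xor r) ≡ b xor (a xor r)
    rotate a r = trans (sym (𝔹.xor-assoc a b r)) (trans (cong (_xor r) (𝔹.xor-comm a b)) (𝔹.xor-assoc b a r))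
    own : ∀ i → entry α x₀ i xor (b xor rest i) ≡ false
    own i = begin
      entry α x₀ i xor (b xor rest i)  ≡⟨ rotate (entry α x₀ i) (rest i) ⟩
      b xor (entry α x₀ i xor rest i)  ≡⟨ cong (λ c → b xor ((c ∧ entry α x₀ i) xor rest i)) ex₀ ⟨
      b xor ((e x₀ ∧ entry α x₀ i) xor rest i)  ≡⟨ cong (b xor_) (⨁-punchIn x₀ _) ⟨
      b xor ⨁ (λ x → e x ∧ entry α x i)  ≡⟨ h i ⟩
      false  ∎
      where open ≡-Reasoning

chosen : ∀ {n} (F : List (Fin n)) → Vec Bool (length F) → Fin n → Bool
chosen []      []      x = false
chosen (v ∷ F) (p ∷ φ) x = ((x == v) ∧ p) xor chosen F φ x

chosen-∉ : ∀ {n} (F : List (Fin n)) φ {x} → x ∉ F → chosen F φ x ≡ false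
chosen-∉ []      []      x∉F = refl
chosen-∉ (v ∷ F) (p ∷ φ) x∉F = cong₂ _xor_ (cong (_∧ p) (==-≢ (x∉F ∘ here))) (chosen-∉ F φ (x∉F ∘ there))

combine-chosen : ∀ {n m} (α : Fin n → Fin m → Bool) F φ i → combine α F φ i ≡ ⨁ (λ x → chosen F φ x ∧ α x i)
combine-chosen α []      []      i = sym (⨁-zero (λ _ → refl))
combine-chosen α (v ∷ F) (p ∷ φ) i = sym (begin
  ⨁ (λ x → (((x == v) ∧ p) xor chosen F φ x) ∧ α x i)  ≡⟨ ⨁-cong (λ x → trans (𝔹.∧-distribʳ-xor (α x i) ((x == v) ∧ p) _) (cong (_xor (chosen F φ x ∧ α x i)) (𝔹.∧-assoc (x == v) p (α x i)))) ⟩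
  ⨁ (λ x → ((x == v) ∧ (p ∧ α x i)) xor (chosen F φ x ∧ α x i))  ≡⟨ ⨁-xor _ _ ⟩
  ⨁ (λ x → (x == v) ∧ (p ∧ α x i)) xor ⨁ (λ x → chosen F φ x ∧ α x i)  ≡⟨ cong₂ _xor_ (⨁-δ v (λ x → p ∧ α x i)) (sym (combine-chosen α F φ i)) ⟩
  (p ∧ α v i) xor combine α F φ i  ∎)
  where open ≡-Reasoning

-- For each of the 2^|F| combinations over F, subtracting it cannot touch the coefficient at x₀, so
-- the remaining equation is still solvable for the vector at x₀.
rare-spanned : ∀ {m n} (F : List (Fin n)) (e : Fin n → Bool) {x₀} → x₀ ∉ F → e x₀ ≡ true →
               Rare (Vectors m n) (2 ^ length F) (2 ^ m) (λ α → Spanned (entry α) F (λ i → ⨁ (λ x → e x ∧ entry α x i)))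
rare-spanned {m} {n} F e {x₀} x₀∉F ex₀ = subst (λ N → Rare (Vectors m n) N (2 ^ m) (λ α → Spanned (entry α) F (λ i → ⨁ (λ x → e x ∧ entry α x i)))) (ℕₚ.*-identityʳ _) (rare-⋃-vec (length F) each)
  where
  each : ∀ φ → Rare (Vectors m n) 1 (2 ^ m) (λ α → ∀ i → ⨁ (λ x → e x ∧ entry α x i) ≡ combine (entry α) F φ i)
  each φ = rare-⊆ (λ {α} → vanish {α}) (rare-affine (λ x → e x xor chosen F φ x) false x₀ (trans (cong₂ _xor_ ex₀ (chosen-∉ F φ x₀∉F)) refl))
    where
    vanish : ∀ {α} → (∀ i → ⨁ (λ x → e x ∧ entry α x i) ≡ combine (entry α) F φ i) → ∀ i → ⨁ (λ x → (e x xor chosen F φ x) ∧ entry α x i) ≡ false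
    vanish {α} h i = trans (⨁-cong (λ x → 𝔹.∧-distribʳ-xor (entry α x i) (e x) (chosen F φ x))) (trans (⨁-xor _ _) (xor-self-false (trans (h i) (combine-chosen (entry α) F φ i))))

-- All that can be observed of C without knowing which pairs meet F: its values under functionals
-- that erase the vectors of F on both sides.
Vanishing : ∀ {m n} → List (Fin n) → (Fin n → Fin n → Bool) → Vec (Vec Bool m) n → Vec (Vec Bool m) n → Set
Vanishing {m} F C β α = ∀ (l u : Vec Bool m) → (∀ {v} → v ∈ F → dot (lookup l) (entry α v) ≡ false) → (∀ {v} → v ∈ F → dot (lookup u) (entry β v) ≡ false) →
  ⨁ (λ w → ⨁ (λ x → C w x ∧ (dot (lookup l) (entry α w) ∧ dot (lookup u) (entry β x)))) ≡ false

-- Two stages. Row w₀ of C, applied to β, rarely lies in the span of β on F; otherwise a detector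
-- contracts C to a combination of the vectors of α with coefficient one at w₀, which rarely lies in
-- the span of α on F.
rare-vanishing : ∀ {m n} (F : List (Fin n)) (C : Fin n → Fin n → Bool) {w₀ x₀} → w₀ ∉ F → x₀ ∉ F → C w₀ x₀ ≡ true →
                 Rare (Vectors m n ⊗ Vectors m n) (2 ^ length F + 2 ^ length F) (2 ^ m) (λ { (β , α) → Vanishing F C β α })
rare-vanishing {m} {n} F C {w₀} {x₀} w₀∉F x₀∉F Cwx =
  rare-⊆ (λ { {β , α} → cases β α }) (rare-∪ (rare-fst (rare-spanned F (C w₀) x₀∉F Cwx)) (rare-given (λ β → second β (split β))))
  where
  b : Vec (Vec Bool m) n → Fin m → Bool
  b β i = ⨁ (λ x → C w₀ x ∧ entry β x i)
  split : ∀ β → Spanned (entry β) F (b β) ⊎ Detector (entry β) F (b β)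
  split β = spanned-or-detected (entry β) F (b β)
  e : Vec (Vec Bool m) n → (Fin m → Bool) → Fin n → Bool
  e β μ w = ⨁ (λ x → C w x ∧ dot μ (entry β x))
  Second : ∀ β → Spanned (entry β) F (b β) ⊎ Detector (entry β) F (b β) → Vec (Vec Bool m) n → Set
  Second β (inj₁ _)       α = ⊥
  Second β (inj₂ (μ , _)) α = Spanned (entry α) F (λ i → ⨁ (λ w → e β μ w ∧ entry α w i))
  second : ∀ β d → Rare (Vectors m n) (2 ^ length F) (2 ^ m) (Second β d)
  second β (inj₁ _) = never (λ ())
  second β (inj₂ (μ , _ , μb)) = rare-spanned F (e β μ) w₀∉F (trans (sym (dot-⨁ʳ μ (C w₀) (entry β))) μb)
  cases : ∀ β α → Vanishing F C β α → Spanned (entry β) F (b β) ⊎ Second β (split β) α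
  cases β α van with split β
  ... | inj₁ sp = inj₁ sp
  ... | inj₂ (μ , μ⊥ , μb) with spanned-or-detected (entry α) F (λ i → ⨁ (λ w → e β μ w ∧ entry α w i))
  ...   | inj₁ sp = inj₂ sp
  ...   | inj₂ (l , l⊥ , la) = ⊥-elim (true≢false (trans (sym form) la) (van (tabulate l) (tabulate μ) (λ m → trans (dot-congˡ _ (Vecₚ.lookup∘tabulate l)) (l⊥ m)) (λ m → trans (dot-congˡ _ (Vecₚ.lookup∘tabulate μ)) (μ⊥ m))))
    where
    open ≡-Reasoning
    form : dot l (λ i → ⨁ (λ w → e β μ w ∧ entry α w i)) ≡ ⨁ (λ w → ⨁ (λ x → C w x ∧ (dot (lookup (tabulate l)) (entry α w) ∧ dot (lookup (tabulate μ)) (entry β x))))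
    form = trans (dot-⨁ʳ l (e β μ) (entry α)) (⨁-cong (λ w → begin
      e β μ w ∧ dot l (entry α w)  ≡⟨ ⨁-∧ʳ _ (dot l (entry α w)) ⟨
      ⨁ (λ x → (C w x ∧ dot μ (entry β x)) ∧ dot l (entry α w))  ≡⟨ ⨁-cong (λ x → trans (𝔹.∧-assoc (C w x) _ _) (cong (C w x ∧_) (trans (𝔹.∧-comm (dot μ (entry β x)) _)
                                                                                (sym (cong₂ _∧_ (dot-congˡ (entry α w) (Vecₚ.lookup∘tabulate l)) (dot-congˡ (entry β x) (Vecₚ.lookup∘tabulate μ))))))) ⟩
      ⨁ (λ x → C w x ∧ (dot (lookup (tabulate l)) (entry α w) ∧ dot (lookup (tabulate μ)) (entry β x))) ∎))

-- Bit encodings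

record Codec (A : Set) : Set where
  field
    width         : ℕ
    encode        : A → Vec Bool width
    decode        : Vec Bool width → A
    decode-encode : ∀ a → decode (encode a) ≡ a

open Codec public

cutAt-++ : ∀ {A : Set} {m k} (u : Vec A m) (v : Vec A k) → cutAt m (u ++ᵛ v) ≡ (u , v)
cutAt-++ []      v = refl
cutAt-++ (x ∷ u) v rewrite cutAt-++ u v = refl

boolᶜ : Codec Bool
boolᶜ = record { width = 1 ; encode = λ b → b ∷ [] ; decode = λ { (b ∷ []) → b } ; decode-encode = λ _ → refl }

infixr 5 _×ᶜ_

_×ᶜ_ : ∀ {A B} → Codec A → Codec B → Codec (A × B)
p ×ᶜ q = record
  { width = width p + width q
  ; encode = λ { (a , b) → encode p a ++ᵛ encode q b }
  ; decode = λ v → decode p (proj₁ (cutAt (width p) v)) , decode q (proj₂ (cutAt (width p) v))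
  ; decode-encode = λ { (a , b) → trans (cong (λ { (u , v) → decode p u , decode q v }) (cutAt-++ (encode p a) (encode q b))) (cong₂ _,_ (decode-encode p a) (decode-encode q b)) }
  }

vecᶜ : ∀ {A} → Codec A → ∀ k → Codec (Vec A k)
vecᶜ p zero    = record { width = 0 ; encode = λ _ → [] ; decode = λ _ → [] ; decode-encode = λ { [] → refl } }
vecᶜ p (suc k) = record
  { width = width p + width (vecᶜ p k)
  ; encode = λ { (a ∷ v) → encode p a ++ᵛ encode (vecᶜ p k) v }
  ; decode = λ v → decode p (proj₁ (cutAt (width p) v)) ∷ decode (vecᶜ p k) (proj₂ (cutAt (width p) v))
  ; decode-encode = λ { (a ∷ v) → trans (cong (λ { (u , v) → decode p u ∷ decode (vecᶜ p k) v }) (cutAt-++ (encode p a) (encode (vecᶜ p k) v))) (cong₂ _∷_ (decode-encode p a) (decode-encode (vecᶜ p k) v)) }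
  }

width-vecᶜ : ∀ {A} (p : Codec A) k → width (vecᶜ p k) ≡ k * width p
width-vecᶜ p zero    = refl
width-vecᶜ p (suc k) = cong (width p +_) (width-vecᶜ p k)

maybeᶜ : ∀ {A} → Codec A → Codec (Maybe A)
maybeᶜ {A} p = record { width = suc (width p) ; encode = enc ; decode = dec ; decode-encode = ok }
  where
  enc : Maybe A → Vec Bool (suc (width p))
  enc nothing  = false ∷ replicate (width p) false
  enc (just a) = true ∷ encode p a
  dec : Vec Bool (suc (width p)) → Maybe A
  dec (false ∷ _) = nothing
  dec (true ∷ v)  = just (decode p v)
  ok : ∀ a → dec (enc a) ≡ a
  ok nothing  = refl
  ok (just a) = cong just (decode-encode p a)

value : ∀ {k} → Vec Bool k → ℕ
value []      = 0
value (b ∷ v) = ⟦ b ⟧ + value v * 2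

digits : ∀ k → ℕ → Vec Bool k
digits zero    x = []
digits (suc k) x = does (x % 2 ℕₚ.≟ 1) ∷ digits k (x / 2)

value-digits : ∀ k x → x < 2 ^ k → value (digits k x) ≡ x
value-digits zero    zero    _ = refl
value-digits zero    (suc x) (s≤s ())
value-digits (suc k) x lt = trans (cong₂ (λ a b → a + b * 2) (parity (x % 2) (m%n<n x 2)) (value-digits k (x / 2) (m<n*o⇒m/o<n (subst (x <_) (ℕₚ.*-comm 2 (2 ^ k)) lt)))) (sym (m≡m%n+[m/n]*n x 2))
  where
  parity : ∀ r → r < 2 → ⟦ does (r ℕₚ.≟ 1) ⟧ ≡ r
  parity 0 _ = refl
  parity 1 _ = refl
  parity (suc (suc r)) (s≤s (s≤s ()))

finᶜ : ∀ {n k} → suc n ≤ 2 ^ k → Codec (Fin (suc n))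
finᶜ {n} {k} le = record { width = k ; encode = λ i → digits k (toℕ i) ; decode = λ v → clip (value v) ; decode-encode = ok }
  where
  clip : ℕ → Fin (suc n)
  clip x with x ℕₚ.<? suc n
  ... | yes lt = fromℕ< lt
  -- Code words of vertices never get here; the value only makes `decode` total.
  ... | no _   = zero
  clip-toℕ : ∀ i → clip (toℕ i) ≡ i
  clip-toℕ i with toℕ i ℕₚ.<? suc n
  ... | yes lt = Fₚ.fromℕ<-toℕ i lt
  ... | no ≮   = ⊥-elim (≮ (Fₚ.toℕ<n i))
  ok : ∀ i → clip (value (digits k (toℕ i))) ≡ i
  ok i = trans (cong clip (value-digits k (toℕ i) (ℕₚ.<-≤-trans (Fₚ.toℕ<n i) le))) (clip-toℕ i)

fill : ∀ {A : Set} k → List A → Vec (Maybe A) k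
fill zero    _        = []
fill (suc k) []       = nothing ∷ fill k []
fill (suc k) (x ∷ xs) = just x ∷ fill k xs

drain : ∀ {A : Set} {k} → Vec (Maybe A) k → List A
drain []            = []
drain (nothing ∷ v) = drain v
drain (just x ∷ v)  = x ∷ drain v

drain-fill : ∀ {A : Set} k (xs : List A) → length xs ≤ k → drain (fill k xs) ≡ xs
drain-fill zero    []       _        = refl
drain-fill (suc k) []       _        = drain-fill k [] z≤n
drain-fill (suc k) (x ∷ xs) (s≤s le) = cong (x ∷_) (drain-fill k xs le)

all-vec? : ∀ {k} {P : Vec Bool k → Set} → (∀ v → Dec (P v)) → Dec (∀ v → P v)
all-vec? {zero}  P? = map′ (λ { p [] → p }) (λ h → h []) (P? [])
all-vec? {suc k} P? = map′ (λ { (p , q) (true ∷ v) → p v ; (p , q) (false ∷ v) → q v }) (λ h → (λ v → h (true ∷ v)) , (λ v → h (false ∷ v)))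
                           (all-vec? (P? ∘ (true ∷_)) ×-dec all-vec? (P? ∘ (false ∷_)))

-- Labels and the decoder

pair : ∀ {A : Set} {K} → (A → Bool) → List A → Vec Bool K → Bool
pair f []       _       = false
pair f (_ ∷ _)  []      = false
pair f (z ∷ zs) (b ∷ δ) = (b ∧ f z) xor pair f zs δ

pair-map : ∀ {A B : Set} {K} (f : B → Bool) (h : A → B) zs (δ : Vec Bool K) → pair f (map h zs) δ ≡ pair (f ∘ h) zs δ
pair-map f h []       δ       = refl
pair-map f h (z ∷ zs) []      = refl
pair-map f h (z ∷ zs) (b ∷ δ) = cong ((b ∧ f (h z)) xor_) (pair-map f h zs δ)

pair-cong : ∀ {A : Set} {K} {f g : A → Bool} → (∀ z → f z ≡ g z) → ∀ zs (δ : Vec Bool K) → pair f zs δ ≡ pair g zs δ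
pair-cong h []       δ       = refl
pair-cong h (z ∷ zs) []      = refl
pair-cong h (z ∷ zs) (b ∷ δ) = cong₂ (λ x y → (b ∧ x) xor y) (h z) (pair-cong h zs δ)

-- Labels for n vertices: addresses of length ℓ, L safe sets, w copies, m-dimensional vectors, boundaries up to d.
module Labels (n ℓ L w m d : ℕ) where

  Place Vector Matrix Node Neighbour Detour LightNode Label : Set
  Place     = Vec (Maybe (Fin n × Fin n)) ℓ
  Vector    = Vec Bool m
  Matrix    = Vec Vector m
  Node      = Place × Vec (Vec Matrix w) L
  Neighbour = Place × Vector × Vector × Vec Vector w
  Detour    = Bool × Place × Vec Matrix w × Vec (Maybe Neighbour) d × Vec Bool w
  LightNode = Fin n × Node × Vec Detour L
  Label     = Fin n × Node × Vec (Bool × Bool) L × (Vector × Vector) × Vec (Maybe LightNode) ℓ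

  ancestor : Place → Place → Bool
  ancestor a b = isAncestor (drain a) (drain b)

  labelId : Label → Fin n
  labelId = proj₁

  labelNode : Label → Node
  labelNode = proj₁ ∘ proj₂

  labelSafe labelFit : Label → Fin L → Bool
  labelSafe x i = proj₁ (lookup (proj₁ (proj₂ (proj₂ x))) i)
  labelFit  x i = proj₂ (lookup (proj₁ (proj₂ (proj₂ x))) i)

  labelVectors : Label → Vector × Vector
  labelVectors = proj₁ ∘ proj₂ ∘ proj₂ ∘ proj₂

  labelLights : Label → List LightNode
  labelLights = drain ∘ proj₂ ∘ proj₂ ∘ proj₂ ∘ proj₂

  sketch : Fin L → Fin w → Node → Fin m → Fin m → Bool
  sketch i j (_ , sk) p q = lookup (lookup (lookup (lookup sk i) j) p) q

  shelteredDetour : Fin w → Place → Vec Matrix w → Place → Place → Fin m → Fin m → Bool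
  shelteredDetour j u τ c z p q = (ancestor z c xor ancestor z u) ∧ lookup (lookup (lookup τ j) p) q

  -- Mass of an unsheltered subtree went back to the upper endpoint of its edge. So for each
  -- boundary vertex the transferred matrix is α ⊗ X of rank one, and m bits per copy suffice. The
  -- second sum removes the clique of c.
  openDetour : Fin w → List Neighbour → Vec Bool w → Place → Place → Fin m → Fin m → Bool
  openDetour j ns γ c z p q =
    ⨁ᴸ (λ { (a , α , β , X) → (ancestor z c xor ancestor z a) ∧ (lookup α p ∧ lookup (lookup X j) q) }) ns
    xor ⨁ᴸ (λ { (a , α , _) → ⨁ᴸ (λ { (b , _ , β , _) →
          ((ancestor a b ∧ not (ancestor b a)) ∧ lookup γ j) ∧ ((ancestor z b xor ancestor z a) ∧ (lookup α p ∧ lookup β q)) }) ns }) ns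

  detour : Fin w → Detour → Place → Place → Fin m → Fin m → Bool
  detour j (sheltered , u , τ , ns , γ) c z p q = if sheltered then shelteredDetour j u τ c z p q else openDetour j (drain ns) γ c z p q

  fetch : Fin n → List LightNode → Maybe LightNode
  fetch c []       = nothing
  fetch c (x ∷ xs) = if proj₁ x == c then just x else fetch c xs

  detourOf : Fin L → Fin w → Maybe LightNode → Place → Fin m → Fin m → Bool
  detourOf i j nothing                    z p q = false
  detourOf i j (just (_ , (c , _) , det)) z p q = detour j (lookup det i) c z p q

  -- Summing over vertices instead of list entries undoes the repair of a light ancestor once, even
  -- when several labels contain it.
  reading : List LightNode → Fin L → Fin w → Node → Fin m → Fin m → Bool
  reading db i j z p q = sketch i j z p q xor ⨁ (λ c → detourOf i j (fetch c db) (proj₁ z) p q)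

  bilinear : (Fin m → Fin m → Bool) → Vector → Vector → Bool
  bilinear M l u = ⨁ (λ p → ⨁ (λ q → (lookup l p ∧ lookup u q) ∧ M p q))

  database : List Label → List LightNode
  database = concatMap labelLights

  probes : List LightNode → List Label → List Node
  probes db F = map (proj₁ ∘ proj₂) db ++ map labelNode F

  -- The bits δ select probes and thereby a union of regions; in no copy does the decoder see an
  -- outgoing edge of it that avoids F.
  Null : ∀ {K} → List LightNode → List Label → Fin L → Vec Bool K → Set
  Null db F i δ = ∀ (j : Fin w) (l u : Vector) → All (λ v → dot (lookup l) (lookup (proj₁ (labelVectors v))) ≡ false) F →
    All (λ v → dot (lookup u) (lookup (proj₂ (labelVectors v))) ≡ false) F → pair (λ z → bilinear (reading db i j z) l u) (probes db F) δ ≡ false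

  Good : Label → List Label → Fin L → Set
  Good s F i = labelFit s i ≡ true × All (λ v → labelSafe v i ≡ false) F

  -- Acceptance is sound for every class that is `Good`, so finding one is enough: no set without
  -- visible outgoing edges may separate s from t.
  Accept : ℕ → Label → Label → List Label → Set
  Accept K s t F = labelId s ∉ map labelId F × labelId t ∉ map labelId F ×
    ∃ λ i → Good s F i × ∀ (δ : Vec Bool K) → Null (database (s ∷ t ∷ F)) F i δ →
      pair (λ z → ancestor (proj₁ z) (proj₁ (labelNode s))) (probes (database (s ∷ t ∷ F)) F) δ
      ≡ pair (λ z → ancestor (proj₁ z) (proj₁ (labelNode t))) (probes (database (s ∷ t ∷ F)) F) δ

  opaque

    accept? : ∀ K s t F → Dec (Accept K s t F)
    accept? K s t F = ¬? (mem? Fₚ._≟_ (labelId s) (map labelId F)) ×-dec ¬? (mem? Fₚ._≟_ (labelId t) (map labelId F)) ×-dec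
      Fₚ.any? λ i → ((labelFit s i 𝔹.≟ true) ×-dec All.all? (λ v → labelSafe v i 𝔹.≟ false) F) ×-dec
        all-vec? λ δ → Fₚ.all? (λ j → all-vec? λ l → all-vec? λ u → All.all? (λ v → dot (lookup l) (lookup (proj₁ (labelVectors v))) 𝔹.≟ false) F →-dec
          (All.all? (λ v → dot (lookup u) (lookup (proj₂ (labelVectors v))) 𝔹.≟ false) F →-dec (_ 𝔹.≟ _))) →-dec (_ 𝔹.≟ _)

    decide : ℕ → Label → Label → List Label → Bool
    decide K s t F = does (accept? K s t F)

    decide⇒ : ∀ {K s t F} → decide K s t F ≡ true → Accept K s t F
    decide⇒ {K} {s} {t} {F} = does-true (accept? K s t F)

    -- The failure event of the probability bound is non-acceptance; its complement is a double
    -- negation, which decidability of the test removes.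
    ⇒decide : ∀ {K s t F} → ¬ ¬ Accept K s t F → decide K s t F ≡ true
    ⇒decide {K} {s} {t} {F} ¬¬a = dec-true (accept? K s t F) (decidable-stable (accept? K s t F) ¬¬a)

-- What the labels of a graph contain

opaque

  -- Linear in C. The kernel k is either one coordinate of the tensors α w ⊗ β x or the product of
  -- two functionals applied to them.
  sum₂ : ∀ {n} → (Fin n → Fin n → Bool) → (Fin n → Fin n → Bool) → Bool
  sum₂ k C = ⨁ (λ w → ⨁ (λ x → C w x ∧ k w x))

  sum₂-unfold : ∀ {n} (k C : Fin n → Fin n → Bool) → sum₂ k C ≡ ⨁ (λ w → ⨁ (λ x → C w x ∧ k w x))
  sum₂-unfold k C = refl

  sum₂-cong : ∀ {n} (k : Fin n → Fin n → Bool) {C D : Fin n → Fin n → Bool} → (∀ w x → C w x ≡ D w x) → sum₂ k C ≡ sum₂ k D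
  sum₂-cong k h = ⨁-cong (λ w → ⨁-cong (λ x → cong (_∧ k w x) (h w x)))

  sum₂-xor : ∀ {n} (k C D : Fin n → Fin n → Bool) → sum₂ k (λ w x → C w x xor D w x) ≡ sum₂ k C xor sum₂ k D
  sum₂-xor k C D = trans (⨁-cong (λ w → trans (⨁-cong (λ x → 𝔹.∧-distribʳ-xor (k w x) (C w x) (D w x))) (⨁-xor _ _))) (⨁-xor _ _)

  sum₂-∧ : ∀ {n} (k : Fin n → Fin n → Bool) b (C : Fin n → Fin n → Bool) → sum₂ k (λ w x → b ∧ C w x) ≡ b ∧ sum₂ k C
  sum₂-∧ k b C = trans (⨁-cong (λ w → trans (⨁-cong (λ x → 𝔹.∧-assoc b (C w x) (k w x))) (⨁-∧ˡ b _))) (⨁-∧ˡ b _)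

  sum₂-⨁ : ∀ {n l} (k : Fin n → Fin n → Bool) (C : Fin l → Fin n → Fin n → Bool) → sum₂ k (λ w x → ⨁ (λ c → C c w x)) ≡ ⨁ (λ c → sum₂ k (C c))
  sum₂-⨁ k C = begin
    ⨁ (λ w → ⨁ (λ x → ⨁ (λ c → C c w x) ∧ k w x))  ≡⟨ ⨁-cong (λ w → ⨁-cong (λ x → ⨁-∧ʳ _ (k w x))) ⟨
    ⨁ (λ w → ⨁ (λ x → ⨁ (λ c → C c w x ∧ k w x)))  ≡⟨ ⨁-cong (λ w → ⨁-swap _) ⟩
    ⨁ (λ w → ⨁ (λ c → ⨁ (λ x → C c w x ∧ k w x)))  ≡⟨ ⨁-swap _ ⟩
    ⨁ (λ c → sum₂ k (C c))  ∎
    where open ≡-Reasoning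

concatMap-map-map : ∀ {A B : Set} (h : A → B) (f : A → List A) xs → concatMap (map h ∘ f) xs ≡ map h (concatMap f xs)
concatMap-map-map h f []       = refl
concatMap-map-map h f (x ∷ xs) = trans (cong (map h (f x) ++_) (concatMap-map-map h f xs)) (sym (Listₚ.map-++ h (f x) (concatMap f xs)))

module TrueLabels {n : ℕ} {G : Graph n} (T : Forest G) (normal : Forest.Normal T) (ℓ L w m d : ℕ)
                  (short : ∀ y → length (HeavyLight.address T y) ≤ ℓ)
                  (safe : Fin L → Fin n → Bool) (γ : Fin w → Fin n → Bool) (α β : Vec (Vec Bool m) n) where
  open Forest T
  open HeavyLight T
  open Transfers T
  open Labels n ℓ L w m d
  module 𝐒 (i : Fin L) = Scheme T normal (safe i)

  place : Fin n → Place
  place y = fill ℓ (address y)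

  opaque
    ancestor-place : ∀ t y → ancestor (place t) (place y) ≡ below t y
    ancestor-place t y = trans (cong₂ isAncestor (drain-fill ℓ _ (short t)) (drain-fill ℓ _ (short y))) (isAncestor-below t y)

  outer : Fin m → Fin m → Fin n → Fin n → Bool
  outer p q w x = entry α w p ∧ entry β x q

  matrix : (Fin m → Fin m → Bool) → Matrix
  matrix f = tabulate (λ p → tabulate (f p))

  lookup-matrix : ∀ f p q → lookup (lookup (matrix f) p) q ≡ f p q
  lookup-matrix f p q = trans (cong (λ r → lookup r q) (Vecₚ.lookup∘tabulate (λ p → tabulate (f p)) p)) (Vecₚ.lookup∘tabulate (f p) q)

  module _ (i : Fin L) where
    open 𝐒 i

    coef : Fin w → Fin n → Fin n → Bool
    coef j = coefficient (γ j) (λ _ → true)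

    module 𝐁 (w x : Fin n) = Balance isLight (target w) w x

    sketchOf : Fin w → Fin n → Fin m → Fin m → Bool
    sketchOf j t p q = sum₂ (outer p q) (λ w x → coef j w x ∧ 𝐁.total w x (below t))

    transferOf : Fin w → Fin n → Fin m → Fin m → Bool
    transferOf j c p q = sum₂ (outer p q) (λ w x → coef j w x ∧ 𝐁.amount w x c)

    rowOf : Fin w → Fin n → Fin n → Fin m → Bool
    rowOf j c w q = ⨁ (λ x → (coef j w x ∧ 𝐁.amount w x c) ∧ entry β x q)

    neighbourOf : Fin n → Fin n → Neighbour
    neighbourOf c v = place v , lookup α v , lookup β v , tabulate (λ j → tabulate (rowOf j c v))

    inBoundary : Fin n → Fin n → Bool
    inBoundary c v = does (boundary? c v)

    detourAt : Fin n → Detour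
    -- For a sheltered c the target is the same for every upper endpoint, so c can fill that
    -- argument; otherwise the decoder skips this entry.
    detourAt c = does (sheltered? c) , place (target c c) , tabulate (λ j → matrix (transferOf j c)) ,
                 fill d (map (neighbourOf c) (select (inBoundary c))) , tabulate (λ j → γ j c)

    -- A condition on the whole graph and the class i: all neighbours of unsheltered light subtrees
    -- fit into the d slots, so no detour is truncated. Its truth value is one bit, repeated in
    -- every label.
    Fit : Set
    Fit = ∀ c → Light c → ¬ Sheltered c → count (inBoundary c) ≤ d

    fit? : Dec Fit
    fit? = Fₚ.all? (λ c → light? c →-dec (¬? (sheltered? c) →-dec (_ ℕₚ.≤? _)))

    -- The summand of `coefficient-total`: what an affected c adds to the reading of the probe z to
    -- withdraw its move and its clique.
    correction : Fin w → Fin n → Fin n → Fin n → Fin n → Bool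
    correction j z c w x = (coef j w x ∧ 𝐁.moved w x (below z) c) xor ((clique c w x ∧ γ j c) ∧ (below z x xor below z w))

    strictly-places : ∀ v x → ancestor (place v) (place x) ∧ not (ancestor (place x) (place v)) ≡ strictly v x
    strictly-places v x rewrite ancestor-place v x | ancestor-place x v with v ≼? x | v Fₚ.≟ x
    ... | no ¬le | _ rewrite ¬⇒below ¬le = refl
    ... | yes le | yes refl rewrite ⇒below le = refl
    ... | yes le | no ne rewrite ⇒below le | ¬⇒below {x} {v} (λ ge → ne (≼-antisym le ge)) = refl

    -- The target of c is common to all edges, so the factor telling whether the move enters or
    -- leaves the set comes out of the sum and one matrix per copy remains.
    detour-sheltered : ∀ j c z p q → Sheltered c → detour j (detourAt c) (place c) (place z) p q ≡ sum₂ (outer p q) (correction j z c)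
    detour-sheltered j c z p q s = begin
      detour j (detourAt c) (place c) (place z) p q  ≡⟨ cong (λ b → if b then here-sheltered else here-open) (dec-true (sheltered? c) s) ⟩
      here-sheltered  ≡⟨ cong₂ _∧_ (cong₂ _xor_ (ancestor-place z c) (ancestor-place z (target c c))) (trans (cong (λ M → lookup (lookup M p) q) (Vecₚ.lookup∘tabulate _ j)) (lookup-matrix (transferOf j c) p q)) ⟩
      far ∧ transferOf j c p q  ≡⟨ sum₂-∧ (outer p q) far _ ⟨
      sum₂ (outer p q) (λ w x → far ∧ (coef j w x ∧ 𝐁.amount w x c))  ≡⟨ sum₂-cong (outer p q) term ⟩
      sum₂ (outer p q) (correction j z c)  ∎
      where
      open ≡-Reasoning
      here-sheltered here-open : Bool
      here-sheltered = shelteredDetour j (place (target c c)) (tabulate (λ j → matrix (transferOf j c))) (place c) (place z) p q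
      here-open = openDetour j (drain (fill d (map (neighbourOf c) (select (inBoundary c))))) (tabulate (λ j → γ j c)) (place c) (place z) p q
      far : Bool
      far = below z c xor below z (target c c)
      term : ∀ w x → far ∧ (coef j w x ∧ 𝐁.amount w x c) ≡ correction j z c w x
      term w x = trans (trans (solve 3 (λ a b c → a :* (b :* c) := b :* (c :* a)) refl far (coef j w x) (𝐁.amount w x c))
                              (cong (λ u → coef j w x ∧ (𝐁.amount w x c ∧ (below z c xor below z u))) (target-sheltered c w s)))
                       (sym (trans (cong ((coef j w x ∧ 𝐁.moved w x (below z) c) xor_) (cong (λ b → (b ∧ γ j c) ∧ (below z x xor below z w)) no-clique)) (𝔹.xor-identityʳ _)))
        where
        open xor-∧-Solver
        no-clique : clique c w x ≡ false
        no-clique with clique c w x in e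
        ... | false = refl
        ... | true  = ⊥-elim (proj₁ (proj₂ (clique⇒ {c} {w} {x} e)) s)

    detour-open : ∀ j c z p q → Fit → Light c → ¬ Sheltered c → detour j (detourAt c) (place c) (place z) p q ≡ sum₂ (outer p q) (correction j z c)
    detour-open j c z p q fit lc ¬s = begin
      detour j (detourAt c) (place c) (place z) p q  ≡⟨ cong (λ b → if b then here-sheltered else here-open (drain (fill d (map (neighbourOf c) (select (inBoundary c)))))) (dec-false (sheltered? c) ¬s) ⟩
      here-open (drain (fill d (map (neighbourOf c) (select (inBoundary c)))))  ≡⟨ cong here-open (drain-fill d _ (ℕₚ.≤-trans (ℕₚ.≤-reflexive (trans (Listₚ.length-map (neighbourOf c) (select (inBoundary c))) (length-select (inBoundary c)))) (fit c lc ¬s))) ⟩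
      here-open (map (neighbourOf c) (select (inBoundary c)))  ≡⟨ cong₂ _xor_ moves cliques ⟩
      sum₂ (outer p q) (λ w x → coef j w x ∧ 𝐁.moved w x (below z) c) xor sum₂ (outer p q) (λ w x → (clique c w x ∧ γ j c) ∧ (below z x xor below z w))  ≡⟨ sum₂-xor (outer p q) _ _ ⟨
      sum₂ (outer p q) (correction j z c)  ∎
      where
      open ≡-Reasoning
      open xor-∧-Solver using (solve; _:*_; _:=_)
      here-sheltered : Bool
      here-sheltered = shelteredDetour j (place (target c c)) (tabulate (λ j → matrix (transferOf j c))) (place c) (place z) p q
      here-open : List Neighbour → Bool
      here-open ns = openDetour j ns (tabulate (λ j → γ j c)) (place c) (place z) p q
      overBoundary : ∀ f → ⨁ᴸ f (map (neighbourOf c) (select (inBoundary c))) ≡ ⨁ (λ v → inBoundary c v ∧ f (neighbourOf c v))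
      overBoundary f = trans (⨁ᴸ-map f (neighbourOf c) (select (inBoundary c))) (⨁ᴸ-select (f ∘ neighbourOf c) (inBoundary c))
      moves : ⨁ᴸ (λ { (a , α , β , X) → (ancestor (place z) (place c) xor ancestor (place z) a) ∧ (lookup α p ∧ lookup (lookup X j) q) }) (map (neighbourOf c) (select (inBoundary c)))
              ≡ sum₂ (outer p q) (λ w x → coef j w x ∧ 𝐁.moved w x (below z) c)
      moves = trans (overBoundary _) (trans (⨁-cong row) (sym (sum₂-unfold (outer p q) _)))
        where
        row : ∀ v → inBoundary c v ∧ ((ancestor (place z) (place c) xor ancestor (place z) (place v)) ∧ (entry α v p ∧ lookup (lookup (tabulate (λ j → tabulate (rowOf j c v))) j) q))
                    ≡ ⨁ (λ x → (coef j v x ∧ 𝐁.moved v x (below z) c) ∧ outer p q v x)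
        row v rewrite ancestor-place z c | ancestor-place z v | Vecₚ.lookup∘tabulate (λ j → tabulate (rowOf j c v)) j | Vecₚ.lookup∘tabulate (rowOf j c v) q = begin
          inBoundary c v ∧ ((below z c xor below z v) ∧ (entry α v p ∧ rowOf j c v q))  ≡⟨ solve 4 (λ a b c d → a :* (b :* (c :* d)) := ((a :* b) :* c) :* d) refl (inBoundary c v) (below z c xor below z v) (entry α v p) (rowOf j c v q) ⟩
          (pre ∧ entry α v p) ∧ rowOf j c v q  ≡⟨ ⨁-∧ˡ (pre ∧ entry α v p) _ ⟨
          ⨁ (λ x → (pre ∧ entry α v p) ∧ ((coef j v x ∧ 𝐁.amount v x c) ∧ entry β x q))  ≡⟨ ⨁-cong (λ x → solve 5 (λ a b c d e → (a :* b) :* ((c :* d) :* e) := (c :* (d :* a)) :* (b :* e)) refl pre (entry α v p) (coef j v x) (𝐁.amount v x c) (entry β x q)) ⟩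
          ⨁ (λ x → (coef j v x ∧ (𝐁.amount v x c ∧ pre)) ∧ outer p q v x)  ≡⟨ ⨁-cong (λ x → cong (λ b → (coef j v x ∧ (𝐁.amount v x c ∧ b)) ∧ outer p q v x) pre≡) ⟩
          ⨁ (λ x → (coef j v x ∧ 𝐁.moved v x (below z) c) ∧ outer p q v x)  ∎
          where
          pre : Bool
          pre = inBoundary c v ∧ (below z c xor below z v)
          pre≡ : pre ≡ below z c xor below z (target v c)
          pre≡ with targetView v c
          ... | shelter b s = ⊥-elim (¬s (_ , b , s))
          ... | back _ b e rewrite dec-true (boundary? c v) b | e = refl
          ... | stuck _ ¬b e rewrite dec-false (boundary? c v) ¬b | e = sym (𝔹.xor-same (below z c))
      cliques : ⨁ᴸ (λ { (a , α , _) → ⨁ᴸ (λ { (b , _ , β , _) →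
                  ((ancestor a b ∧ not (ancestor b a)) ∧ lookup (tabulate (λ j → γ j c)) j) ∧ ((ancestor (place z) b xor ancestor (place z) a) ∧ (lookup α p ∧ lookup β q)) })
                    (map (neighbourOf c) (select (inBoundary c))) }) (map (neighbourOf c) (select (inBoundary c)))
                ≡ sum₂ (outer p q) (λ w x → (clique c w x ∧ γ j c) ∧ (below z x xor below z w))
      cliques = trans (overBoundary _) (trans (⨁-cong (λ v → trans (cong (inBoundary c v ∧_) (overBoundary _)) (trans (sym (⨁-∧ˡ (inBoundary c v) _)) (⨁-cong (term v))))) (sym (sum₂-unfold (outer p q) _)))
        where
        term : ∀ v x → inBoundary c v ∧ (inBoundary c x ∧ (((ancestor (place v) (place x) ∧ not (ancestor (place x) (place v))) ∧ lookup (tabulate (λ j → γ j c)) j)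
                        ∧ ((ancestor (place z) (place x) xor ancestor (place z) (place v)) ∧ (entry α v p ∧ entry β x q))))
                       ≡ ((clique c v x ∧ γ j c) ∧ (below z x xor below z v)) ∧ outer p q v x
        term v x rewrite strictly-places v x | ancestor-place z x | ancestor-place z v | Vecₚ.lookup∘tabulate (λ j → γ j c) j
                       | dec-true (light? c) lc | dec-false (sheltered? c) ¬s =
          solve 6 (λ a b s g d o → a :* (b :* ((s :* g) :* (d :* o))) := (((s :* (a :* b)) :* g) :* d) :* o) refl
            (inBoundary c v) (inBoundary c x) (strictly v x) (γ j c) (below z x xor below z v) (outer p q v x)

    detour-correct : ∀ j c z p q → Fit → Light c → detour j (detourAt c) (place c) (place z) p q ≡ sum₂ (outer p q) (correction j z c)
    detour-correct j c z p q fit lc = cases (sheltered? c)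
      where
      cases : Dec (Sheltered c) → detour j (detourAt c) (place c) (place z) p q ≡ sum₂ (outer p q) (correction j z c)
      cases (yes s) = detour-sheltered j c z p q s
      cases (no ¬s) = detour-open j c z p q fit lc ¬s

  nodeOf : Fin n → Node
  nodeOf t = place t , tabulate (λ i → tabulate (λ j → matrix (sketchOf i j t)))

  lightOf : Fin n → LightNode
  lightOf c = c , nodeOf c , tabulate (λ i → detourAt i c)

  labelOf : Fin n → Label
  labelOf z = z , nodeOf z , tabulate (λ i → safe i z , does (fit? i)) , (lookup α z , lookup β z) , fill ℓ (map lightOf (lights z))

  sketch-nodeOf : ∀ i j t p q → sketch i j (nodeOf t) p q ≡ sketchOf i j t p q
  sketch-nodeOf i j t p q rewrite Vecₚ.lookup∘tabulate (λ i → tabulate (λ j → matrix (sketchOf i j t))) i | Vecₚ.lookup∘tabulate (λ j → matrix (sketchOf i j t)) j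
    = lookup-matrix (sketchOf i j t) p q

  labelLights-labelOf : ∀ z → labelLights (labelOf z) ≡ map lightOf (lights z)
  labelLights-labelOf z = drain-fill ℓ _ (ℕₚ.≤-trans (ℕₚ.≤-reflexive (trans (Listₚ.length-map lightOf (lights z)) (Listₚ.length-map proj₁ (address z)))) (short z))

  database-labels : ∀ M → database (map labelOf M) ≡ map lightOf (concatMap lights M)
  database-labels M = trans (trans (Listₚ.concatMap-map labelLights labelOf M) (Listₚ.concatMap-cong labelLights-labelOf M)) (concatMap-map-map lightOf lights M)

  detourOf-database : ∀ i j c cs z p q → detourOf i j (fetch c (map lightOf cs)) z p q ≡ (c ∈ᵇ cs) ∧ detour j (detourAt i c) (place c) z p q
  detourOf-database i j c [] z p q rewrite ¬⇒∈ᵇ {v = c} {F = []} (λ ()) = refl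
  detourOf-database i j c (e ∷ cs) z p q with e Fₚ.≟ c
  ... | yes refl rewrite ⇒∈ᵇ {v = e} {F = e ∷ cs} (here refl) = cong (λ r → detour j r (place e) z p q) (Vecₚ.lookup∘tabulate (λ i → detourAt i e) i)
  ... | no e≢c = trans (detourOf-database i j c cs z p q) (cong (_∧ detour j (detourAt i c) (place c) z p q) same)
    where
    same : (c ∈ᵇ cs) ≡ (c ∈ᵇ (e ∷ cs))
    same with c ∈ᵇ cs in eq
    ... | true  = sym (⇒∈ᵇ (there (∈ᵇ⇒ eq)))
    ... | false = sym (¬⇒∈ᵇ (λ { (here c≡e) → e≢c (sym c≡e) ; (there m) → ∈ᵇ⇒∉ eq m }))

  module Decode (i : Fin L) (fit : Fit i) (F M : List (Fin n)) (F⊆M : ∀ {v} → v ∈ F → v ∈ M) (F-unsafe : ∀ {v} → v ∈ F → safe i v ≡ false) where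
    open 𝐒 i
    open Query F M F⊆M F-unsafe

    probed : List (Fin n)
    probed = concatMap lights M

    -- The light ancestors listed in the labels of the query are exactly the affected ones, so every
    -- repair that has to be undone is available.
    ∈-probed : ∀ c → (c ∈ᵇ probed) ≡ isLight c ∧ affected c
    ∈-probed c with light? c | affected? c
    ... | yes l | yes (z , z∈M , le) = ⇒∈ᵇ (∈-concatMap⁺ lights (lose z∈M (⇒lights z l le)))
    ... | yes l | no ¬a = ¬⇒∈ᵇ (λ h → let z , z∈M , c∈ = find (∈-concatMap⁻ lights {xs = M} h) in ¬a (z , z∈M , proj₂ (lights⇒ z c∈)))
    ... | no ¬l | _ = ¬⇒∈ᵇ (λ h → let z , z∈M , c∈ = find (∈-concatMap⁻ lights {xs = M} h) in ¬l (proj₁ (lights⇒ z c∈)))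

    active : Fin w → (Fin n → Bool) → Fin n → Fin n → Bool
    active j g w x = coefficient (γ j) (not ∘ affected) w x ∧ Balance.total intact (target w) w x g

    db : List LightNode
    db = database (map labelOf M)

    reading-correct : ∀ j t p q → reading db i j (nodeOf t) p q ≡ sum₂ (outer p q) (active j (below t))
    reading-correct j t p q = begin
      sketch i j (nodeOf t) p q xor ⨁ (λ c → detourOf i j (fetch c db) (place t) p q)
        ≡⟨ cong₂ _xor_ (sketch-nodeOf i j t p q) (⨁-cong each) ⟩
      sketchOf i j t p q xor ⨁ (λ c → sum₂ (outer p q) (λ w x → (isLight c ∧ affected c) ∧ correction i j t c w x))
        ≡⟨ cong (sketchOf i j t p q xor_) (sum₂-⨁ (outer p q) _) ⟨
      sketchOf i j t p q xor sum₂ (outer p q) (λ w x → ⨁ (λ c → (isLight c ∧ affected c) ∧ correction i j t c w x))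
        ≡⟨ sum₂-xor (outer p q) _ _ ⟨
      sum₂ (outer p q) (λ w x → (coef i j w x ∧ 𝐁.total i w x (below t)) xor ⨁ (λ c → (isLight c ∧ affected c) ∧ correction i j t c w x))
        ≡⟨ sum₂-cong (outer p q) (λ w x → coefficient-total (γ j) (below t) w x) ⟨
      sum₂ (outer p q) (active j (below t)) ∎
      where
      open ≡-Reasoning
      each : ∀ c → detourOf i j (fetch c db) (place t) p q ≡ sum₂ (outer p q) (λ w x → (isLight c ∧ affected c) ∧ correction i j t c w x)
      each c rewrite database-labels M = trans (detourOf-database i j c probed (place t) p q) (trans (cong (_∧ detour j (detourAt i c) (place c) (place t) p q) (∈-probed c)) step)
        where
        step : (isLight c ∧ affected c) ∧ detour j (detourAt i c) (place c) (place t) p q ≡ sum₂ (outer p q) (λ w x → (isLight c ∧ affected c) ∧ correction i j t c w x)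
        step = cases (light? c)
          where
          cases : Dec (Light c) → (isLight c ∧ affected c) ∧ detour j (detourAt i c) (place c) (place t) p q ≡ sum₂ (outer p q) (λ w x → (isLight c ∧ affected c) ∧ correction i j t c w x)
          cases (yes l) = trans (cong ((isLight c ∧ affected c) ∧_) (detour-correct i j c t p q fit l)) (sym (sum₂-∧ (outer p q) (isLight c ∧ affected c) (correction i j t c)))
          cases (no ¬l) = trans (cong (_∧ detour j (detourAt i c) (place c) (place t) p q) idle) (sym (trans (sum₂-∧ (outer p q) (isLight c ∧ affected c) (correction i j t c)) (cong (_∧ sum₂ (outer p q) (correction i j t c)) idle)))
            where
            idle : isLight c ∧ affected c ≡ false
            idle = cong (_∧ affected c) (dec-false (light? c) ¬l)

    span : ∀ {K} → List (Fin n) → Vec Bool K → Fin n → Bool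
    span Z δ y = pair (λ t → below t y) Z δ

    functional : Vec Bool m → Vec Bool m → Fin n → Fin n → Bool
    functional l u w x = dot (lookup l) (entry α w) ∧ dot (lookup u) (entry β x)

    bilinear-sum₂ : ∀ C l u → ⨁ (λ p → ⨁ (λ q → (lookup l p ∧ lookup u q) ∧ sum₂ (outer p q) C)) ≡ sum₂ (functional l u) C
    bilinear-sum₂ C l u = begin
      ⨁ (λ p → ⨁ (λ q → (lookup l p ∧ lookup u q) ∧ sum₂ (outer p q) C))
        ≡⟨ ⨁-cong (λ p → ⨁-cong (λ q → trans (cong ((lookup l p ∧ lookup u q) ∧_) (sum₂-unfold (outer p q) C)) (trans (sym (⨁-∧ˡ (lookup l p ∧ lookup u q) _)) (⨁-cong (λ w → sym (⨁-∧ˡ (lookup l p ∧ lookup u q) _)))))) ⟩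
      ⨁ (λ p → ⨁ (λ q → ⨁ (λ w → ⨁ (λ x → (lookup l p ∧ lookup u q) ∧ (C w x ∧ outer p q w x)))))
        ≡⟨ ⨁-cong (λ p → trans (⨁-swap _) (⨁-cong (λ w → ⨁-swap _))) ⟩
      ⨁ (λ p → ⨁ (λ w → ⨁ (λ x → ⨁ (λ q → (lookup l p ∧ lookup u q) ∧ (C w x ∧ outer p q w x)))))
        ≡⟨ trans (⨁-swap _) (⨁-cong (λ w → ⨁-swap _)) ⟩
      ⨁ (λ w → ⨁ (λ x → ⨁ (λ p → ⨁ (λ q → (lookup l p ∧ lookup u q) ∧ (C w x ∧ outer p q w x)))))
        ≡⟨ trans (⨁-cong (λ w → ⨁-cong (λ x → inner w x))) (sym (sum₂-unfold (functional l u) C)) ⟩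
      sum₂ (functional l u) C ∎
      where
      open ≡-Reasoning
      open xor-∧-Solver using (solve; _:*_; _:=_)
      inner : ∀ w x → ⨁ (λ p → ⨁ (λ q → (lookup l p ∧ lookup u q) ∧ (C w x ∧ (entry α w p ∧ entry β x q)))) ≡ C w x ∧ functional l u w x
      inner w x = begin
        ⨁ (λ p → ⨁ (λ q → (lookup l p ∧ lookup u q) ∧ (C w x ∧ (entry α w p ∧ entry β x q))))
          ≡⟨ ⨁-cong (λ p → ⨁-cong (λ q → solve 5 (λ a b c d e → (a :* b) :* (c :* (d :* e)) := (c :* (a :* d)) :* (b :* e)) refl (lookup l p) (lookup u q) (C w x) (entry α w p) (entry β x q))) ⟩
        ⨁ (λ p → ⨁ (λ q → (C w x ∧ (lookup l p ∧ entry α w p)) ∧ (lookup u q ∧ entry β x q)))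
          ≡⟨ ⨁-cong (λ p → trans (⨁-∧ˡ (C w x ∧ (lookup l p ∧ entry α w p)) _) (𝔹.∧-assoc (C w x) _ _)) ⟩
        ⨁ (λ p → C w x ∧ ((lookup l p ∧ entry α w p) ∧ dot (lookup u) (entry β x)))
          ≡⟨ trans (⨁-∧ˡ (C w x) _) (cong (C w x ∧_) (⨁-∧ʳ _ (dot (lookup u) (entry β x)))) ⟩
        C w x ∧ functional l u w x ∎

    total-span : ∀ {K} Z (δ : Vec Bool K) w x → Balance.total intact (target w) w x (span Z δ) ≡ pair (λ t → Balance.total intact (target w) w x (below t)) Z δ
    total-span Z δ w x = go Z δ
      where
      open Balance intact (target w) w x
      zeroed : total (λ _ → false) ≡ false
      zeroed = balance-∧ (suc n) false (λ _ → false)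
      go : ∀ {K} Z (δ : Vec Bool K) → total (span Z δ) ≡ pair (λ t → total (below t)) Z δ
      go []      δ       = zeroed
      go (t ∷ Z) []      = zeroed
      go (t ∷ Z) (b ∷ δ) = trans (balance-xor (suc n) (λ y → b ∧ below t y) (span Z δ)) (cong₂ _xor_ (balance-∧ (suc n) b (below t)) (go Z δ))

    active-span : ∀ {K} j Z (δ : Vec Bool K) l u → pair (λ t → sum₂ (functional l u) (active j (below t))) Z δ ≡ sum₂ (functional l u) (active j (span Z δ))
    active-span j Z δ l u = trans (go Z δ) (sum₂-cong (functional l u) (λ w x → trans (sym (pull Z δ w x)) (cong (coefficient (γ j) (not ∘ affected) w x ∧_) (sym (total-span Z δ w x)))))
      where
      go : ∀ {K} Z (δ : Vec Bool K) → pair (λ t → sum₂ (functional l u) (active j (below t))) Z δ ≡ sum₂ (functional l u) (λ w x → pair (λ t → active j (below t) w x) Z δ)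
      go []      δ       = sym (sum₂-∧ (functional l u) false (λ _ _ → false))
      go (t ∷ Z) []      = sym (sum₂-∧ (functional l u) false (λ _ _ → false))
      go (t ∷ Z) (b ∷ δ) = trans (cong₂ _xor_ (sym (sum₂-∧ (functional l u) b (active j (below t)))) (go Z δ)) (sym (sum₂-xor (functional l u) _ _))
      pull : ∀ {K} Z (δ : Vec Bool K) w x → coefficient (γ j) (not ∘ affected) w x ∧ pair (λ t → Balance.total intact (target w) w x (below t)) Z δ ≡ pair (λ t → active j (below t) w x) Z δ
      pull []      δ       w x = 𝔹.∧-zeroʳ _
      pull (t ∷ Z) []      w x = 𝔹.∧-zeroʳ _
      pull (t ∷ Z) (b ∷ δ) w x = trans (𝔹.∧-distribˡ-xor (coefficient (γ j) (not ∘ affected) w x) (b ∧ Balance.total intact (target w) w x (below t)) _) (cong₂ _xor_ (∧-left (coefficient (γ j) (not ∘ affected) w x) b _) (pull Z δ w x))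

    Z : List (Fin n)
    Z = probed ++ F

    probes-labels : probes db (map labelOf F) ≡ map nodeOf Z
    probes-labels = trans (cong₂ _++_ (trans (cong (map (proj₁ ∘ proj₂)) (database-labels M)) (sym (Listₚ.map-∘ probed))) (sym (Listₚ.map-∘ F))) (sym (Listₚ.map-++ nodeOf probed F))

    pair-reading : ∀ {K} (δ : Vec Bool K) j l u → pair (λ z → bilinear (reading db i j z) l u) (probes db (map labelOf F)) δ ≡ sum₂ (functional l u) (active j (span Z δ))
    pair-reading δ j l u = begin
      pair (λ z → bilinear (reading db i j z) l u) (probes db (map labelOf F)) δ  ≡⟨ cong (λ zs → pair (λ z → bilinear (reading db i j z) l u) zs δ) probes-labels ⟩
      pair (λ z → bilinear (reading db i j z) l u) (map nodeOf Z) δ  ≡⟨ pair-map _ nodeOf Z δ ⟩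
      pair (λ t → bilinear (reading db i j (nodeOf t)) l u) Z δ  ≡⟨ pair-cong (λ t → trans (⨁-cong (λ p → ⨁-cong (λ q → cong ((lookup l p ∧ lookup u q) ∧_) (reading-correct j t p q)))) (bilinear-sum₂ (active j (below t)) l u)) Z δ ⟩
      pair (λ t → sum₂ (functional l u) (active j (below t))) Z δ  ≡⟨ active-span j Z δ l u ⟩
      sum₂ (functional l u) (active j (span Z δ))  ∎
      where open ≡-Reasoning

    pair-ancestor : ∀ {K} (δ : Vec Bool K) y → pair (λ z → ancestor (proj₁ z) (place y)) (probes db (map labelOf F)) δ ≡ span Z δ y
    pair-ancestor δ y = trans (cong (λ zs → pair (λ z → ancestor (proj₁ z) (place y)) zs δ) probes-labels) (trans (pair-map _ nodeOf Z δ) (pair-cong (λ t → ancestor-place t y) Z δ))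

-- Correctness of a query

-- Z may list a probe repeatedly; only its last occurrence receives the coefficient, all others get
-- zero.
represent : ∀ {n} (Z : List (Fin n)) (e : Fin n → Bool) {K} → length Z ≤ K → ∃ λ (δ : Vec Bool K) → ∀ h → pair h Z δ ≡ ⨁ (λ t → ((t ∈ᵇ Z) ∧ e t) ∧ h t)
represent []      e {K}     le       = replicate K false , λ h → sym (⨁-zero (λ t → cong (λ b → (b ∧ e t) ∧ h t) (¬⇒∈ᵇ {v = t} {F = []} (λ ()))))
represent (z ∷ Z) e {suc K} (s≤s le) with δ , rep ← represent Z e le = new ∷ δ , λ h → trans (cong₂ _xor_ (sym (⨁-δ z (λ t → new ∧ h t))) (rep h)) (trans (sym (⨁-xor _ _)) (⨁-cong (term h)))
  where
  new : Bool
  new = not (z ∈ᵇ Z) ∧ e z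
  term : ∀ h t → ((t == z) ∧ (new ∧ h t)) xor (((t ∈ᵇ Z) ∧ e t) ∧ h t) ≡ ((t ∈ᵇ (z ∷ Z)) ∧ e t) ∧ h t
  term h t with t Fₚ.≟ z
  ... | yes refl rewrite ⇒∈ᵇ {v = t} {F = t ∷ Z} (here refl) with t ∈ᵇ Z
  ...   | true  = refl
  ...   | false = 𝔹.xor-identityʳ _
  term h t | no t≢z = cong (λ b → (b ∧ e t) ∧ h t) same
    where
    same : (t ∈ᵇ Z) ≡ (t ∈ᵇ (z ∷ Z))
    same with t ∈ᵇ Z in eq
    ... | true  = sym (⇒∈ᵇ (there (∈ᵇ⇒ eq)))
    ... | false = sym (¬⇒∈ᵇ (λ { (here t≡z) → t≢z t≡z ; (there m) → ∈ᵇ⇒∉ eq m }))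

𝔹-stable : ∀ {a b : Bool} → ¬ (a ≢ b) → a ≡ b
𝔹-stable {a} {b} h with a 𝔹.≟ b
... | yes eq = eq
... | no ne  = ⊥-elim (h ne)

length-concatMap : ∀ {A B : Set} (f : A → List B) k → (∀ x → length (f x) ≤ k) → ∀ xs → length (concatMap f xs) ≤ length xs * k
length-concatMap f k h []       = z≤n
length-concatMap f k h (x ∷ xs) = ℕₚ.≤-trans (ℕₚ.≤-reflexive (Listₚ.length-++ (f x))) (ℕₚ.+-mono-≤ (h x) (length-concatMap f k h xs))

module Answer {n : ℕ} {G : Graph n} (T : Forest G) (normal : Forest.Normal T) (ℓ L w m d K : ℕ)
              (short : ∀ y → length (HeavyLight.address T y) ≤ ℓ)
              (s t : Fin n) (F : List (Fin n)) (room : (2 + length F) * ℓ + length F ≤ K) where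
  open Forest T
  open HeavyLight T
  open Transfers T

  M : List (Fin n)
  M = s ∷ t ∷ F

  F⊆M : ∀ {v} → v ∈ F → v ∈ M
  F⊆M = there ∘ there

  Z : List (Fin n)
  Z = concatMap lights M ++ F

  length-Z : length Z ≤ K
  length-Z = ℕₚ.≤-trans (ℕₚ.≤-reflexive (Listₚ.length-++ (concatMap lights M)))
    (ℕₚ.≤-trans (ℕₚ.+-monoˡ-≤ (length F) (length-concatMap lights ℓ (λ y → ℕₚ.≤-trans (ℕₚ.≤-reflexive (Listₚ.length-map proj₁ (address y))) (short y)) M)) room)

  span : Vec Bool K → Fin n → Bool
  span δ y = pair (λ t → below t y) Z δ

  module _ (safe : Fin L → Fin n → Bool) (γ : Fin w → Fin n → Bool) where

    module Trial (α β : Vec (Vec Bool m) n) where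
      open TrueLabels T normal ℓ L w m d short safe γ α β public
      open Labels n ℓ L w m d public

      record Accepts : Set where
        constructor accepting
        field acceptance : Accept K (labelOf s) (labelOf t) (map labelOf F)

      ids : map labelId (map labelOf F) ≡ F
      ids = trans (sym (Listₚ.map-∘ F)) (Listₚ.map-id F)

      fit-label : ∀ v i → labelFit (labelOf v) i ≡ does (fit? i)
      fit-label v i = cong proj₂ (Vecₚ.lookup∘tabulate (λ i → safe i v , does (fit? i)) i)

      safe-label : ∀ v i → labelSafe (labelOf v) i ≡ safe i v
      safe-label v i = cong proj₁ (Vecₚ.lookup∘tabulate (λ i → safe i v , does (fit? i)) i)

      killed : ∀ {l : Vec Bool m} {pick : Label → Vec Bool m} {vec : Vec (Vec Bool m) n} → (∀ v → pick (labelOf v) ≡ lookup vec v) →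
               All (λ v → dot (lookup l) (lookup (pick v)) ≡ false) (map labelOf F) → ∀ {v} → v ∈ F → dot (lookup l) (entry vec v) ≡ false
      killed {l} eq all {v} m = trans (cong (λ u → dot (lookup l) (lookup u)) (sym (eq v))) (All.lookup (Allₚ.map⁻ all) m)

      kill : ∀ {l : Vec Bool m} {pick : Label → Vec Bool m} {vec : Vec (Vec Bool m) n} → (∀ v → pick (labelOf v) ≡ lookup vec v) →
             (∀ {v} → v ∈ F → dot (lookup l) (entry vec v) ≡ false) → All (λ v → dot (lookup l) (lookup (pick v)) ≡ false) (map labelOf F)
      kill {l} eq h = Allₚ.map⁺ (All.tabulate (λ {v} m → trans (cong (λ u → dot (lookup l) (lookup u)) (eq v)) (h m)))

      good⇒ : ∀ {i} → Good (labelOf s) (map labelOf F) i → Fit i × (∀ {v} → v ∈ F → safe i v ≡ false)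
      good⇒ {i} (f , u) = does-true (fit? i) (trans (sym (fit-label s i)) f) , λ {v} m → trans (sym (safe-label v i)) (All.lookup (Allₚ.map⁻ u) m)

      ⇒good : ∀ {i} → Fit i → (∀ {v} → v ∈ F → safe i v ≡ false) → Good (labelOf s) (map labelOf F) i
      ⇒good {i} f u = trans (fit-label s i) (dec-true (fit? i) f) , Allₚ.map⁺ (All.tabulate (λ {v} m → trans (safe-label v i) (u m)))

      module Soundness (i : Fin L) (fit : Fit i) (unsafe : ∀ {v} → v ∈ F → safe i v ≡ false) (s∉F : s ∉ F) (t∉F : t ∉ F) where
        open Component (component G F s∉F)
        open Separator T normal (safe i) F M F⊆M unsafe κ-adj
        open Scheme T normal (safe i)
        open Query F M F⊆M unsafe
        open Decode i fit F M F⊆M unsafe hiding (Z; span)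
        rep : ∃ λ (δ : Vec Bool K) → ∀ h → pair h Z δ ≡ ⨁ (λ t → ((t ∈ᵇ Z) ∧ jump t) ∧ h t)
        rep = represent Z jump length-Z
        δ : Vec Bool K
        δ = proj₁ rep
        supported : ∀ t → (t ∈ᵇ Z) ∧ jump t ≡ jump t
        supported t with probe t in pr
        ... | false = 𝔹.∧-zeroʳ _
        ... | true = cong (_∧ (side t xor sideAbove t)) (⇒∈ᵇ (member pr))
          where
          member : probe t ≡ true → t ∈ Z
          member h with isLight t ∧ affected t in e
          ... | true  = ∈-++⁺ˡ (∈ᵇ⇒ (trans (∈-probed t) e))
          ... | false = ∈-++⁺ʳ (concatMap lights M) (∈ᵇ⇒ h)
        span-cut : ∀ y → span δ y ≡ cut y
        span-cut y = trans (proj₂ rep (λ t → below t y)) (⨁-cong (λ t → cong (_∧ below t y) (supported t)))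
        null : Null (database (map labelOf M)) (map labelOf F) i δ
        null j l u kl ku = trans (pair-reading δ j l u) (trans (sum₂-unfold (functional l u) (active j (span δ))) (⨁-zero (λ w → ⨁-zero (λ x → vanish w x))))
          where
          vanish : ∀ w x → active j (span δ) w x ∧ functional l u w x ≡ false
          vanish w x = cases (w ∈ᵇ F) (x ∈ᵇ F) refl refl
            where
            cases : ∀ a b → w ∈ᵇ F ≡ a → x ∈ᵇ F ≡ b → active j (span δ) w x ∧ functional l u w x ≡ false
            -- Pairs with an endpoint in F are erased by the functionals; the remaining pairs have
            -- coefficient zero by `cut-total`.
            cases true _ wF xF = trans (cong (λ b → active j (span δ) w x ∧ (b ∧ dot (lookup u) (entry β x))) (killed {l = l} {pick = proj₁ ∘ labelVectors} {vec = α} (λ _ → refl) kl (∈ᵇ⇒ wF))) (𝔹.∧-zeroʳ _)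
            cases false true wF xF = trans (cong (λ b → active j (span δ) w x ∧ (dot (lookup l) (entry α w) ∧ b)) (killed {l = u} {pick = proj₂ ∘ labelVectors} {vec = β} (λ _ → refl) ku (∈ᵇ⇒ xF))) (trans (cong (active j (span δ) w x ∧_) (𝔹.∧-zeroʳ _)) (𝔹.∧-zeroʳ _))
            cases false false wF xF = cong (_∧ functional l u w x) (trans (cong (coefficient (γ j) (not ∘ affected) w x ∧_) (Balance.balance-cong intact (target w) w x (suc n) span-cut)) (cut-total {γ = γ j} (∈ᵇ⇒∉ wF) (∈ᵇ⇒∉ xF)))
        same-side : span δ s ≡ span δ t → κ s ≡ κ t
        same-side eq = begin
          κ s  ≡⟨ cut-alive (core-marks (here refl)) s∉F ⟨
          cut s  ≡⟨ span-cut s ⟨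
          span δ s  ≡⟨ eq ⟩
          span δ t  ≡⟨ span-cut t ⟩
          cut t  ≡⟨ cut-alive (core-marks (there (here refl))) t∉F ⟩
          κ t  ∎
          where open ≡-Reasoning
        connected : (∀ (δ : Vec Bool K) → Null (database (map labelOf M)) (map labelOf F) i δ →
                      pair (λ z → ancestor (proj₁ z) (place s)) (probes (database (map labelOf M)) (map labelOf F)) δ ≡ pair (λ z → ancestor (proj₁ z) (place t)) (probes (database (map labelOf M)) (map labelOf F)) δ)
                    → WalkAvoiding G F s t
        connected test = κ-walk (trans (sym (same-side (trans (sym (pair-ancestor δ s)) (trans (test δ null) (pair-ancestor δ t))))) κ-self)

      -- No randomness enters: the component of s yields a null selection of probes, and the test
      -- then forces t to its side.
      sound : Accepts → WalkAvoiding G F s t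
      sound (accepting (s∉ , t∉ , i , good , test)) = Soundness.connected i (proj₁ (good⇒ good)) (proj₂ (good⇒ good)) (subst (s ∉_) ids s∉) (subst (t ∉_) ids t∉) test

    module Chance (i : Fin L) (unsafe : ∀ {v} → v ∈ F → safe i v ≡ false) where
      open Scheme T normal (safe i)
      open Query F M F⊆M unsafe

      Related : Fin n → Fin n → Set
      Related w x = w ≼ x × w ≢ x × (adj G w x ≡ true ⊎ ∃ λ c → intact c ≡ true × Clique c w x)

      coefᑫ : Fin w → Fin n → Fin n → Bool
      coefᑫ j = coefficient (γ j) (not ∘ affected)

      record ConfusedBy (δ : Vec Bool K) (βα : Vec (Vec Bool m) n × Vec (Vec Bool m) n) : Set where
        constructor confusion
        field
          fit      : Trial.Fit (proj₂ βα) (proj₁ βα) i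
          separate : span δ s ≢ span δ t
          null     : Trial.Null (proj₂ βα) (proj₁ βα) (Trial.database (proj₂ βα) (proj₁ βα) (map (Trial.labelOf (proj₂ βα) (proj₁ βα)) M)) (map (Trial.labelOf (proj₂ βα) (proj₁ βα)) F) i δ

      Confused : Vec (Vec Bool m) n × Vec (Vec Bool m) n → Set
      Confused βα = ∃ λ δ → ConfusedBy δ βα

      complete : ∀ α β → s ∉ F → t ∉ F → Trial.Fit α β i → ¬ Confused (β , α) → Trial.Accepts α β
      complete α β s∉F t∉F fit ok = accepting (subst (s ∉_) (sym ids) s∉F , subst (t ∉_) (sym ids) t∉F , i , ⇒good fit unsafe , test)
        where
        open Trial α β
        open Decode i fit F M F⊆M unsafe using (pair-ancestor)
        test : ∀ (δ : Vec Bool K) → Null (database (map labelOf M)) (map labelOf F) i δ →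
               pair (λ z → ancestor (proj₁ z) (place s)) (probes (database (map labelOf M)) (map labelOf F)) δ ≡ pair (λ z → ancestor (proj₁ z) (place t)) (probes (database (map labelOf M)) (map labelOf F)) δ
        test δ null = trans (pair-ancestor δ s) (trans (𝔹-stable (λ ne → ok (δ , confusion fit ne null))) (sym (pair-ancestor δ t)))

      -- For each δ that separates s from t, `Complete.separated` finds a pair with total one, and
      -- some copy has coefficient one there. The matrix C so obtained does not depend on α and β,
      -- as `rare-vanishing` requires; the 2^K choices of δ are summed up.
      rare-confused : WalkAvoiding G F s t → (∀ {w x} → Related w x → ∃ λ j → coefᑫ j w x ≡ true) →
                      Rare (Vectors m n ⊗ Vectors m n) (2 ^ K * (2 ^ length F + 2 ^ length F)) (2 ^ m) Confused
      rare-confused walk copies = rare-⋃-vec K each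
        where
        each : ∀ δ → Rare (Vectors m n ⊗ Vectors m n) (2 ^ length F + 2 ^ length F) (2 ^ m) (ConfusedBy δ)
        each δ = cases (span δ s 𝔹.≟ span δ t)
          where
          C : Fin w → Fin n → Fin n → Bool
          C j w x = coefᑫ j w x ∧ Balance.total intact (target w) w x (span δ)
          vanishing : ∀ j α β → Trial.Fit α β i → Trial.Null α β (Trial.database α β (map (Trial.labelOf α β) M)) (map (Trial.labelOf α β) F) i δ → Vanishing F (C j) β α
          vanishing j α β fit null l u kl ku = trans (sym (trans (pair-reading δ j l u) (sum₂-unfold (functional l u) (C j))))
            (null j l u (kill {l = l} {pick = proj₁ ∘ labelVectors} {vec = α} (λ _ → refl) kl) (kill {l = u} {pick = proj₂ ∘ labelVectors} {vec = β} (λ _ → refl) ku))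
            where
            open Trial α β
            open Decode i fit F M F⊆M unsafe using (pair-reading; functional)
          cases : Dec (span δ s ≡ span δ t) → Rare (Vectors m n ⊗ Vectors m n) (2 ^ length F + 2 ^ length F) (2 ^ m) (ConfusedBy δ)
          cases (yes eq) = never (λ c → ConfusedBy.separate c eq)
          cases (no ne) with w₀ , x₀ , le , w≢x , w∉F , x∉F , rel , tot ← Complete.separated (span δ) walk (here refl) (there (here refl)) ne
                    with j , cj ← copies (le , w≢x , rel)
            = rare-⊆ (λ { {β , α} (confusion fit _ null) → vanishing j α β fit null }) (rare-vanishing F (C j) w∉F x∉F (cong₂ _∧_ cj tot))

-- Failure probability of a query

-- The inequality (1 + 1/Q)^j ≥ 1 + j/Q, cleared of denominators; at j = Q it gives `double`.
bernoulli : ∀ Q j → (Q + j) * Q ^ j ≤ Q * suc Q ^ j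
bernoulli Q zero    = ℕₚ.≤-reflexive (cong (_* 1) (ℕₚ.+-identityʳ Q))
bernoulli Q (suc j) = begin
  (Q + suc j) * (Q * Q ^ j)  ≡⟨ ℕₚ.*-assoc (Q + suc j) Q (Q ^ j) ⟨
  (Q + suc j) * Q * Q ^ j  ≤⟨ ℕₚ.*-monoˡ-≤ (Q ^ j) grow ⟩
  suc Q * (Q + j) * Q ^ j  ≡⟨ ℕₚ.*-assoc (suc Q) (Q + j) (Q ^ j) ⟩
  suc Q * ((Q + j) * Q ^ j)  ≤⟨ ℕₚ.*-monoʳ-≤ (suc Q) (bernoulli Q j) ⟩
  suc Q * (Q * suc Q ^ j)  ≡⟨ ℕₚ.*-assoc (suc Q) Q _ ⟨
  suc Q * Q * suc Q ^ j  ≡⟨ cong (_* suc Q ^ j) (ℕₚ.*-comm (suc Q) Q) ⟩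
  Q * suc Q * suc Q ^ j  ≡⟨ ℕₚ.*-assoc Q (suc Q) _ ⟩
  Q * (suc Q * suc Q ^ j)  ∎
  where
  open ℕₚ.≤-Reasoning
  grow : (Q + suc j) * Q ≤ suc Q * (Q + j)
  grow = begin
    (Q + suc j) * Q  ≡⟨ cong (_* Q) (ℕₚ.+-suc Q j) ⟩
    Q + (Q + j) * Q  ≤⟨ ℕₚ.+-mono-≤ (ℕₚ.m≤m+n Q j) (ℕₚ.≤-reflexive (ℕₚ.*-comm (Q + j) Q)) ⟩
    (Q + j) + Q * (Q + j)  ∎

double : ∀ Q .{{_ : NonZero Q}} → 2 * Q ^ Q ≤ suc Q ^ Q
double Q = ℕₚ.*-cancelˡ-≤ Q (begin
  Q * (2 * Q ^ Q)  ≡⟨ ℕₚ.*-assoc Q 2 (Q ^ Q) ⟨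
  Q * 2 * Q ^ Q  ≡⟨ cong (_* Q ^ Q) (trans (ℕₚ.*-comm Q 2) (cong (Q +_) (ℕₚ.+-identityʳ Q))) ⟩
  (Q + Q) * Q ^ Q  ≤⟨ bernoulli Q Q ⟩
  Q * suc Q ^ Q  ∎)
  where open ℕₚ.≤-Reasoning

^-*-distrib : ∀ x y k → (x * y) ^ k ≡ x ^ k * y ^ k
^-*-distrib x y zero    = refl
^-*-distrib x y (suc k) = trans (cong (x * y *_) (^-*-distrib x y k)) (*-middle x y (x ^ k) (y ^ k))

-- (1 + 1/Q)^e ≥ 2^k for e ≥ Q k, cleared of denominators.
exponential : ∀ Q .{{_ : NonZero Q}} k e → Q * k ≤ e → 2 ^ k * Q ^ e ≤ suc Q ^ e
exponential Q k e le with r , refl ← ℕₚ.m≤n⇒∃[o]m+o≡n le = begin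
  2 ^ k * Q ^ (Q * k + r)  ≡⟨ cong (2 ^ k *_) (ℕₚ.^-distribˡ-+-* Q (Q * k) r) ⟩
  2 ^ k * (Q ^ (Q * k) * Q ^ r)  ≡⟨ ℕₚ.*-assoc (2 ^ k) (Q ^ (Q * k)) (Q ^ r) ⟨
  2 ^ k * Q ^ (Q * k) * Q ^ r  ≡⟨ cong (λ z → 2 ^ k * z * Q ^ r) (sym (ℕₚ.^-*-assoc Q Q k)) ⟩
  2 ^ k * (Q ^ Q) ^ k * Q ^ r  ≡⟨ cong (_* Q ^ r) (^-*-distrib 2 (Q ^ Q) k) ⟨
  (2 * Q ^ Q) ^ k * Q ^ r  ≤⟨ ℕₚ.*-mono-≤ (ℕₚ.^-monoˡ-≤ k (double Q)) (ℕₚ.^-monoˡ-≤ r (ℕₚ.n≤1+n Q)) ⟩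
  (suc Q ^ Q) ^ k * suc Q ^ r  ≡⟨ cong (_* suc Q ^ r) (ℕₚ.^-*-assoc (suc Q) Q k) ⟩
  suc Q ^ (Q * k) * suc Q ^ r  ≡⟨ ℕₚ.^-distribˡ-+-* (suc Q) (Q * k) r ⟨
  suc Q ^ (Q * k + r)  ∎
  where open ℕₚ.≤-Reasoning

rare-missing : ∀ {a n} (p : El a → Bool) Q .{{_ : NonZero Q}} → ∫ a (λ x → ⟦ not (p x) ⟧) ≡ Q → card a ≡ suc Q →
               ∀ (N : Fin n → Bool) k → Q * k ≤ count N → Rare (pow a n) 1 (2 ^ k) (λ v → ∀ i → N i ≡ true → p (lookup v i) ≡ false)
rare-missing {a} {n} p Q miss size N k le = rare (misses N) (λ {v} → misses-intro N v) (ℕₚ.*-cancelʳ-≤ _ _ (Q ^ count N) {{ℕₚ.m^n≢0 Q (count N)}} (begin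
  μ * 2 ^ k * Q ^ count N  ≡⟨ ℕₚ.*-assoc μ (2 ^ k) _ ⟩
  μ * (2 ^ k * Q ^ count N)  ≤⟨ ℕₚ.*-monoʳ-≤ μ (exponential Q k (count N) le) ⟩
  μ * suc Q ^ count N  ≡⟨ ∫-misses N ⟩
  Q ^ count N * suc Q ^ n  ≡⟨ ℕₚ.*-comm (Q ^ count N) (suc Q ^ n) ⟩
  suc Q ^ n * Q ^ count N  ≡⟨ cong (λ z → z ^ n * Q ^ count N) size ⟨
  card a ^ n * Q ^ count N  ≡⟨ cong (_* Q ^ count N) (ℕₚ.+-identityʳ (card a ^ n)) ⟨
  1 * card (pow a n) * Q ^ count N  ∎))
  where
  open ℕₚ.≤-Reasoning
  open Missing {a} p Q miss size
  μ : ℕ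
  μ = ∫ (pow a n) (λ v → ⟦ misses N v ⟧)

ones : ∀ q → Vec Bool q
ones q = replicate q true

∫-not-point : ∀ {q} (v : Vec Bool q) → suc (∫ (pow bit q) (λ u → ⟦ not (u ≡ᵛ v) ⟧)) ≡ 2 ^ q
∫-not-point {q} v = trans (cong (_+ ∫ (pow bit q) (λ u → ⟦ not (u ≡ᵛ v) ⟧)) (sym (∫-point v)))
  (trans (sym (∫-+ (pow bit q) _ _)) (trans (∫-cong (pow bit q) (λ u → one (u ≡ᵛ v))) (trans (∫-const (pow bit q) 1) (ℕₚ.*-identityʳ (2 ^ q)))))
  where
  one : ∀ b → ⟦ b ⟧ + ⟦ not b ⟧ ≡ 1
  one true  = refl
  one false = refl

≡ᵛ⇒≡ : ∀ {q} (u v : Vec Bool q) → u ≡ᵛ v ≡ true → u ≡ v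
≡ᵛ⇒≡ []      []      _ = refl
≡ᵛ⇒≡ (x ∷ u) (y ∷ v) h with a , b ← ∧-true h = cong₂ _∷_ (xor-false⇒≡ x y (trans (sym (𝔹.not-involutive _)) (cong not a))) (≡ᵛ⇒≡ u v b)

rare-¬ : ∀ {a N D} {P Q : El a → Set} → (∀ ω → ¬ P ω → Q ω) → Rare a N D P → Rare a N D (λ ω → ¬ Q ω)
rare-¬ {a} {P = P} {Q} h r = rare (event r) cover (bound r)
  where
  cover : ∀ {ω} → ¬ Q ω → event r ω ≡ true
  cover {ω} ¬q = 𝔹-stable (λ ne → ¬q (h ω (λ p → ne (covers r p))))

rare-event : ∀ {a N D P} (r : Rare a N D P) → Rare a N D (λ ω → event r ω ≡ true)
rare-event r = rare (event r) (λ e → e) (bound r)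

safeIn : ∀ {n q} → Vec (Vec Bool q) n → Fin n → Bool
safeIn {q = q} S v = lookup S v ≡ᵛ ones q

safeOf : ∀ {n q L} → Vec (Vec (Vec Bool q) n) L → Fin L → Fin n → Bool
safeOf S i = safeIn (lookup S i)

γOf : ∀ {n w} → Vec (Vec Bool w) n → Fin w → Fin n → Bool
γOf g j v = entry g v j

Seeds : (n q L w m : ℕ) → Space
Seeds n q L w m = pow (pow (pow bit q) n) L ⊗ (Vectors w n ⊗ (Vectors m n ⊗ Vectors m n))

module Random {n : ℕ} {G : Graph n} (T : Forest G) (normal : Forest.Normal T) (ℓ L w m d K q k : ℕ)
              (short : ∀ y → length (HeavyLight.address T y) ≤ ℓ)
              (4n≤2^k : n * 4 ≤ 2 ^ k) (d-large : 2 ^ q * k ≤ d) (w-positive : Fin w)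
              (s t : Fin n) (F : List (Fin n)) (room : (2 + length F) * ℓ + length F ≤ K) (4f≤2^q : length F * 4 ≤ 2 ^ q) (1<2^q : 1 < 2 ^ q) where
  open HeavyLight T
  open Answer T normal ℓ L w m d K short s t F room
  open Boundaries T normal using (boundary?)

  Class : Space
  Class = pow (pow bit q) n

  Bad : El Class → Set
  Bad S = (∃ λ v → v ∈ F × safeIn S v ≡ true) ⊎ (∃ λ c → d < count (λ v → does (boundary? c v)) × (∀ v → does (boundary? c v) ≡ true → safeIn S v ≡ false))

  rare-safe : ∀ {N} (v : Fin N) → Rare (pow (pow bit q) N) 1 (2 ^ q) (λ S → lookup S v ≡ᵛ ones q ≡ true)
  rare-safe {suc N} v = rare-forced v (λ _ → ones q) (λ {S} e → ≡ᵛ⇒≡ (lookup S v) (ones q) e)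

  -- Both kinds of failure have probability at most 1/4: each vertex of F is safe with probability
  -- 2^-q, and each of the n boundaries, if larger than d, is missed with probability at most 2^-k.
  rare-bad : Rare Class 1 2 Bad
  rare-bad = rare-scale {D = 4} {D′ = 2} ℕₚ.≤-refl (rare-∪ hit miss)
    where
    instance
      2^q≢0 : NonZero (2 ^ q)
      2^q≢0 = ℕₚ.m^n≢0 2 q
      2^k≢0 : NonZero (2 ^ k)
      2^k≢0 = ℕₚ.m^n≢0 2 k
    hit : Rare Class 1 4 (λ S → ∃ λ v → v ∈ F × safeIn S v ≡ true)
    hit = rare-scale (ℕₚ.≤-trans (ℕₚ.≤-reflexive (cong (_* 4) (ℕₚ.*-identityʳ (length F)))) (ℕₚ.≤-trans 4f≤2^q (ℕₚ.≤-reflexive (sym (ℕₚ.+-identityʳ (2 ^ q))))))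
            (rare-⋃-list F (λ v → rare-safe v))
    Q : ℕ
    Q = ∫ (pow bit q) (λ u → ⟦ not (u ≡ᵛ ones q) ⟧)
    Q≢0 : NonZero Q
    Q≢0 = ℕ.>-nonZero (ℕ.s≤s⁻¹ (ℕₚ.≤-trans 1<2^q (ℕₚ.≤-reflexive (sym (∫-not-point (ones q))))))
    each : ∀ c → Rare Class 1 (2 ^ k) (λ S → d < count (λ v → does (boundary? c v)) × (∀ v → does (boundary? c v) ≡ true → safeIn S v ≡ false))
    each c with d ℕₚ.<? count (λ v → does (boundary? c v))
    ... | no ≮ = never (λ { (lt , _) → ≮ lt })
    ... | yes lt = rare-⊆ proj₂ (rare-missing (_≡ᵛ ones q) Q {{Q≢0}} refl (sym (∫-not-point (ones q))) (λ v → does (boundary? c v)) k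
                     (ℕₚ.≤-trans (ℕₚ.*-monoˡ-≤ k (ℕₚ.≤-trans (ℕₚ.n≤1+n Q) (ℕₚ.≤-reflexive (∫-not-point (ones q))))) (ℕₚ.≤-trans d-large (ℕₚ.<⇒≤ lt))))
    miss : Rare Class 1 4 (λ S → ∃ λ c → d < count (λ v → does (boundary? c v)) × (∀ v → does (boundary? c v) ≡ true → safeIn S v ≡ false))
    miss = rare-scale (ℕₚ.≤-trans (ℕₚ.≤-reflexive (cong (_* 4) (ℕₚ.*-identityʳ n))) (ℕₚ.≤-trans 4n≤2^k (ℕₚ.≤-reflexive (sym (ℕₚ.+-identityʳ (2 ^ k)))))) (rare-⋃ each)

  module _ (S : Vec (El Class) L) (i : Fin L) (ok : ¬ Bad (lookup S i)) where

    unsafe : ∀ {v} → v ∈ F → safeOf S i v ≡ false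
    unsafe {v} v∈F = 𝔹.¬-not (λ e → ok (inj₁ (v , v∈F , e)))

    open Scheme T normal (safeOf S i) hiding (boundary?)
    open Query F M F⊆M unsafe

    fits : ∀ c → Light c → ¬ Sheltered c → count (λ v → does (boundary? c v)) ≤ d
    fits c _ ¬s = ℕₚ.≮⇒≥ (λ lt → ok (inj₂ (c , lt , λ v b → 𝔹.¬-not (λ e → ¬s (v , does-true (boundary? c v) b , e)))))

    Related : Fin n → Fin n → Set
    Related x y = Forest._≼_ T x y × x ≢ y × (adj G x y ≡ true ⊎ ∃ λ c → intact c ≡ true × Clique c x y)

    Silent : Vec (Vec Bool w) n → Set
    Silent g = ∃ λ x → ∃ λ y → Related x y × (∀ j → coefficient (γOf g j) (not ∘ affected) x y ≡ false)

    -- If an unaffected clique covers the pair, its coefficients in the w copies are independent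
    -- fair bits. If none does, a related pair is a graph edge and has coefficient one in every
    -- copy.
    rare-silent : Rare (Vectors w n) (n * (n * 1)) (2 ^ w) Silent
    rare-silent = rare-⋃ (λ x → rare-⋃ (λ y → each x y))
      where
      each : ∀ x y → Rare (Vectors w n) 1 (2 ^ w) (λ g → Related x y × (∀ j → coefficient (γOf g j) (not ∘ affected) x y ≡ false))
      each x y = cases (Fₚ.any? (λ c → (not (affected c) ∧ clique c x y) 𝔹.≟ true))
        where
        cases : Dec (∃ λ c → not (affected c) ∧ clique c x y ≡ true) → Rare (Vectors w n) 1 (2 ^ w) (λ g → Related x y × (∀ j → coefficient (γOf g j) (not ∘ affected) x y ≡ false))
        cases (yes (c , e)) = rare-⊆ (λ { (_ , h) j → trans (cong (edge x y xor_) (⨁-cong (λ c → 𝔹.∧-assoc (not (affected c)) (clique c x y) _))) (h j) })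
                                     (rare-affine (λ c → not (affected c) ∧ clique c x y) (edge x y) c e)
        cases (no none) = never (λ { {g} ((le , ne , rel) , h) → true≢false (loud g le ne rel) (h w-positive) })
          where
          loud : ∀ g → Forest._≼_ T x y → x ≢ y → (adj G x y ≡ true ⊎ ∃ λ c → intact c ≡ true × Clique c x y) → coefficient (γOf g w-positive) (not ∘ affected) x y ≡ true
          loud g le ne (inj₂ (c , ic , cl)) = ⊥-elim (none (c , cong₂ _∧_ (proj₂ (∧-true {isLight c} ic)) (⇒clique le ne cl)))
          loud g le ne (inj₁ a) = cong₂ _xor_ (cong₂ _∧_ (⇒strictly le ne) a) (⨁-zero (λ c → trans (sym (𝔹.∧-assoc (not (affected c)) (clique c x y) _)) (cong (_∧ γOf g w-positive c) (𝔹.¬-not (λ e → none (c , e))))))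

    loud⇒copies : ∀ {g} → ¬ Silent g → ∀ {x y} → Related x y → ∃ λ j → coefficient (γOf g j) (not ∘ affected) x y ≡ true
    loud⇒copies {g} loud {x} {y} rel = cases (Fₚ.any? (λ j → coefficient (γOf g j) (not ∘ affected) x y 𝔹.≟ true))
      where
      cases : Dec (∃ λ j → coefficient (γOf g j) (not ∘ affected) x y ≡ true) → ∃ λ j → coefficient (γOf g j) (not ∘ affected) x y ≡ true
      cases (yes j) = j
      cases (no none) = ⊥-elim (loud (x , y , rel , λ j → 𝔹.¬-not (λ e → none (j , e))))

  Ω : Space
  Ω = Seeds n q L w m

  accepted : El Ω → Set
  accepted (S , g , β , α) = Trial.Accepts (safeOf S) (γOf g) α β

  module _ (walk : WalkAvoiding G F s t) (D : ℕ) (E1 : D ≤ 2 ^ L) (E2 : n * (n * 1) * D ≤ 2 ^ w) (E3 : 2 ^ K * (2 ^ length F + 2 ^ length F) * D ≤ 2 ^ m) where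

    scaled : ∀ {a N e P} → N * D ≤ 2 ^ e → Rare a N (2 ^ e) P → Rare a 1 D P
    scaled {e = e} le = rare-scale {{ℕₚ.m^n≢0 2 e}} (ℕₚ.≤-trans le (ℕₚ.≤-reflexive (sym (ℕₚ.+-identityʳ (2 ^ e)))))

    given-good : ∀ S i → ¬ Bad (lookup S i) → Rare (Vectors w n ⊗ (Vectors m n ⊗ Vectors m n)) 2 D (λ ω → ¬ accepted (S , ω))
    given-good S i ok = rare-⊆ (λ {ω} → cover {ω}) (rare-∪ (rare-fst (rare-event silent)) (rare-given second))
      where
      silent : Rare (Vectors w n) 1 D (Silent S i ok)
      silent = scaled {e = w} E2 (rare-silent S i ok)
      Second : El (Vectors w n) → El (Vectors m n ⊗ Vectors m n) → Set
      -- The complement of the covering event is used in place of non-silence, so that the case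
      -- distinction on g is decidable before α and β are drawn.
      Second g ω = event silent g ≡ false × ¬ accepted (S , g , ω)
      second : ∀ g → Rare (Vectors m n ⊗ Vectors m n) 1 D (Second g)
      second g = cases (event silent g) refl
        where
        cases : ∀ b → event silent g ≡ b → Rare (Vectors m n ⊗ Vectors m n) 1 D (Second g)
        cases true  e = never (λ { (f , _) → true≢false e f })
        cases false e = rare-⊆ proj₂ (rare-¬ (λ { (β , α) ¬conf → Chance.complete (safeOf S) (γOf g) i (unsafe S i ok) α β (walk-start walk) (walk-end G F walk) (fits S i ok) ¬conf })
          (scaled {e = m} E3 (Chance.rare-confused (safeOf S) (γOf g) i (unsafe S i ok) walk (loud⇒copies S i ok {g} (λ sil → true≢false (covers silent {g} sil) e)))))
      cover : ∀ {ω} → ¬ accepted (S , ω) → event silent (proj₁ ω) ≡ true ⊎ Second (proj₁ ω) (proj₂ ω)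
      cover {g , ω} ¬acc = cases (event silent g) refl
        where
        cases : ∀ b → event silent g ≡ b → event silent g ≡ true ⊎ Second g ω
        cases true  e = inj₁ e
        cases false e = inj₂ (e , ¬acc)

    -- Three causes, each of probability at most 1/D: all L classes are bad, a pair is silent in all
    -- copies, or a null set separates s from t. Drawing classes, coefficients and vectors in this
    -- order makes each bound conditional on the earlier draws.
    rare-failure : Rare Ω 3 D (λ ω → ¬ accepted ω)
    rare-failure = rare-⊆ (λ {ω} → cover {ω}) (rare-∪ (rare-fst all-bad) (rare-given (λ S → second S (good? S))))
      where
      AllBad : Vec (El Class) L → Set
      AllBad S = ∀ i → event rare-bad (lookup S i) ≡ true
      1^ : ∀ e → 1 ^ e ≡ 1
      1^ zero    = refl
      1^ (suc e) = trans (ℕₚ.+-identityʳ (1 ^ e)) (1^ e)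
      all-bad : Rare (pow Class L) 1 D AllBad
      all-bad = scaled {e = L} (ℕₚ.≤-trans (ℕₚ.≤-reflexive (trans (cong (_* D) (1^ L)) (ℕₚ.+-identityʳ D))) E1) (rare-all L (rare-event rare-bad))
      good? : ∀ S → Dec (∃ λ i → event rare-bad (lookup S i) ≡ false)
      good? S = Fₚ.any? (λ i → event rare-bad (lookup S i) 𝔹.≟ false)
      Second : ∀ S → Dec (∃ λ i → event rare-bad (lookup S i) ≡ false) → El (Vectors w n ⊗ (Vectors m n ⊗ Vectors m n)) → Set
      Second S (yes _) ω = ¬ accepted (S , ω)
      Second S (no _)  ω = ⊥
      second : ∀ S d → Rare (Vectors w n ⊗ (Vectors m n ⊗ Vectors m n)) 2 D (Second S d)
      second S (yes (i , e)) = given-good S i (λ bad → true≢false (covers rare-bad bad) e)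
      second S (no _)        = never (λ ())
      cover : ∀ {ω} → ¬ accepted ω → AllBad (proj₁ ω) ⊎ Second (proj₁ ω) (good? (proj₁ ω)) (proj₂ ω)
      cover {S , ω} ¬acc = cases (good? S)
        where
        cases : ∀ d → AllBad S ⊎ Second S d ω
        cases (yes _) = inj₂ ¬acc
        cases (no none) = inj₁ (λ i → 𝔹.¬-not (λ e → none (i , e)))

-- Parameters and label length

-- Symbolic polynomials in ℓ and f: an estimate of a label component reduces to evaluating its
-- degrees and the sum of its coefficients.
data Size : Set where
  con     : ℕ → Size
  ℓᵉ fᵉ   : Size
  _⊕_ _⊛_ : Size → Size → Size

infixl 6 _⊕_
infixl 7 _⊛_

coeff degᶠ degˡ : Size → ℕ
coeff (con k)   = k
coeff ℓᵉ      = 1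
coeff fᵉ      = 1
coeff (x ⊕ y) = coeff x + coeff y
coeff (x ⊛ y) = coeff x * coeff y
degᶠ (con k)   = 0
degᶠ ℓᵉ      = 0
degᶠ fᵉ      = 1
degᶠ (x ⊕ y) = degᶠ x ⊔ degᶠ y
degᶠ (x ⊛ y) = degᶠ x + degᶠ y
degˡ (con k)   = 0
degˡ ℓᵉ      = 1
degˡ fᵉ      = 0
degˡ (x ⊕ y) = degˡ x ⊔ degˡ y
degˡ (x ⊛ y) = degˡ x + degˡ y

module Growth (f ℓ : ℕ) (1≤f : 1 ≤ f) (1≤ℓ : 1 ≤ ℓ) where

  ⟪_⟫ : Size → ℕ
  ⟪ con k ⟫   = k
  ⟪ ℓᵉ ⟫    = ℓ
  ⟪ fᵉ ⟫    = f
  ⟪ x ⊕ y ⟫ = ⟪ x ⟫ + ⟪ y ⟫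
  ⟪ x ⊛ y ⟫ = ⟪ x ⟫ * ⟪ y ⟫

  monomial : ℕ → ℕ → ℕ
  monomial i j = f ^ i * ℓ ^ j

  monomial-mono : ∀ {i i′ j j′} → i ≤ i′ → j ≤ j′ → monomial i j ≤ monomial i′ j′
  monomial-mono p r = ℕₚ.*-mono-≤ (ℕₚ.^-monoʳ-≤ f {{ℕ.>-nonZero 1≤f}} p) (ℕₚ.^-monoʳ-≤ ℓ {{ℕ.>-nonZero 1≤ℓ}} r)

  bounded : ∀ x → ⟪ x ⟫ ≤ coeff x * monomial (degᶠ x) (degˡ x)
  bounded (con k)   = ℕₚ.≤-reflexive (sym (ℕₚ.*-identityʳ k))
  bounded ℓᵉ      = ℕₚ.≤-reflexive (sym (trans (ℕₚ.+-identityʳ _) (trans (ℕₚ.+-identityʳ _) (ℕₚ.*-identityʳ ℓ))))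
  bounded fᵉ      = ℕₚ.≤-reflexive (sym (trans (ℕₚ.+-identityʳ _) (trans (ℕₚ.*-identityʳ _) (ℕₚ.*-identityʳ f))))
  bounded (x ⊕ y) = ℕₚ.≤-trans
    (ℕₚ.+-mono-≤ (ℕₚ.≤-trans (bounded x) (ℕₚ.*-monoʳ-≤ (coeff x) (monomial-mono (ℕₚ.m≤m⊔n (degᶠ x) (degᶠ y)) (ℕₚ.m≤m⊔n (degˡ x) (degˡ y)))))
                 (ℕₚ.≤-trans (bounded y) (ℕₚ.*-monoʳ-≤ (coeff y) (monomial-mono (ℕₚ.m≤n⊔m (degᶠ x) (degᶠ y)) (ℕₚ.m≤n⊔m (degˡ x) (degˡ y))))))
    (ℕₚ.≤-reflexive (sym (ℕₚ.*-distribʳ-+ _ (coeff x) (coeff y))))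
  bounded (x ⊛ y) = ℕₚ.≤-trans (ℕₚ.*-mono-≤ (bounded x) (bounded y)) (ℕₚ.≤-reflexive (trans (*-middle (coeff x) _ (coeff y) _)
    (cong (coeff x * coeff y *_) (trans (*-middle (f ^ degᶠ x) _ (f ^ degᶠ y) _) (sym (cong₂ _*_ (ℕₚ.^-distribˡ-+-* f (degᶠ x) (degᶠ y)) (ℕₚ.^-distribˡ-+-* ℓ (degˡ x) (degˡ y))))))))

  bounded-by : ∀ x {i j} → degᶠ x ≤ i → degˡ x ≤ j → ⟪ x ⟫ ≤ coeff x * f ^ i * ℓ ^ j
  bounded-by x {i} {j} p r = ℕₚ.≤-trans (bounded x) (ℕₚ.≤-trans (ℕₚ.*-monoʳ-≤ (coeff x) (monomial-mono p r)) (ℕₚ.≤-reflexive (sym (ℕₚ.*-assoc (coeff x) (f ^ i) (ℓ ^ j)))))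

powerBetween : ∀ f → 1 ≤ f → ∃ λ q → f ≤ 2 ^ q × 2 ^ q ≤ 2 * f
powerBetween 1 _ = 0 , s≤s z≤n , s≤s z≤n
powerBetween (suc f@(suc _)) _ with powerBetween f (s≤s z≤n)
... | q , lo , hi with ℕₚ.m≤n⇒m<n∨m≡n lo
...   | inj₁ lt = q , lt , ℕₚ.≤-trans hi (ℕₚ.*-monoʳ-≤ 2 (ℕₚ.n≤1+n f))
...   | inj₂ eq = suc q , ℕₚ.≤-trans (ℕₚ.+-monoˡ-≤ f {1} {f} (s≤s z≤n)) (ℕₚ.≤-reflexive (trans (cong (f +_) (sym (ℕₚ.+-identityʳ f))) (cong (2 *_) eq))) ,
                   ℕₚ.≤-trans (ℕₚ.≤-reflexive (cong (2 *_) (sym eq))) (ℕₚ.*-monoʳ-≤ 2 (ℕₚ.n≤1+n f))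

module Wire {A : Set} (code : Codec A) {len : ℕ} (fits : width code ≤ len) where

  opaque

    padding : ℕ
    padding = len ∸ width code

    total : width code + padding ≡ len
    total = ℕₚ.m+[n∸m]≡n fits

    write : A → Vec Bool len
    write a = subst (Vec Bool) total (encode code a ++ᵛ replicate padding false)

    read : Vec Bool len → A
    read v = decode code (proj₁ (cutAt (width code) (subst (Vec Bool) (sym total) v)))

    read-write : ∀ a → read (write a) ≡ a
    read-write a = trans (cong (λ v → decode code (proj₁ (cutAt (width code) v))) (undo total))
                         (trans (cong (decode code ∘ proj₁) (cutAt-++ (encode code a) (replicate padding false))) (decode-encode code a))
      where
      undo : ∀ {i j} (e : i ≡ j) {v : Vec Bool i} → subst (Vec Bool) (sym e) (subst (Vec Bool) e v) ≡ v
      undo refl = refl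

whp : ∀ {n len c a} {G : Graph n} {dec : Decoder len} {label : El a → Fin n → Vec Bool len} {s t F} (Fail : El a → Set) →
      Rare a 3 (4 * n ^ c) Fail → (∀ ω → ¬ Fail ω → (dec (label ω s) (label ω t) (map (label ω) F) ≡ true → WalkAvoiding G F s t) × (WalkAvoiding G F s t → dec (label ω s) (label ω t) (map (label ω) F) ≡ true)) →
      SucceedsWHP c G dec (label ∘ sample a) s t F
whp {n} {len} {c} {a} {G} {dec} {label} {s} {t} {F} Fail r good = keep lost , Uniqueₚ.filter⁺ _ (strings-unique (bits a)) , allGood (strings (bits a)) , enough
  where
  lost : Vec Bool (bits a) → Bool
  lost = event r ∘ sample a
  μ : ℕ
  μ = ∫ (pow bit (bits a)) (λ v → ⟦ lost v ⟧)
  correct : ∀ ρ → lost ρ ≡ false → Correct G dec (label ∘ sample a) ρ s t F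
  correct ρ h with p , q ← good (sample a ρ) (λ f → true≢false (covers r f) h) = mk⇔ p q
  allGood : ∀ l → All (λ ρ → Correct G dec (label ∘ sample a) ρ s t F) (filterᵇ (not ∘ lost) l)
  allGood [] = []
  allGood (ρ ∷ l) with lost ρ in e
  ... | true  = allGood l
  ... | false = correct ρ e ∷ allGood l
  enough : (2 ^ bits a ∸ length (keep lost)) * n ^ c ≤ 2 ^ bits a
  enough = ℕₚ.*-cancelˡ-≤ 4 (begin
    4 * ((2 ^ bits a ∸ length (keep lost)) * n ^ c)  ≡⟨ cong (λ z → 4 * (z * n ^ c)) (trans (cong (_∸ length (keep lost)) (sym (length-keep (bits a) lost))) (ℕₚ.m+n∸m≡n (length (keep lost)) μ)) ⟩
    4 * (μ * n ^ c)  ≡⟨ trans (sym (ℕₚ.*-assoc 4 μ _)) (trans (cong (_* n ^ c) (ℕₚ.*-comm 4 μ)) (ℕₚ.*-assoc μ 4 _)) ⟩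
    μ * (4 * n ^ c)  ≡⟨ cong (_* (4 * n ^ c)) (∫-sample a (λ ω → ⟦ event r ω ⟧)) ⟩
    -- With D = 4 n^c the three failure causes add up to 3/4 of the permitted 1/n^c.
    ∫ a (λ ω → ⟦ event r ω ⟧) * (4 * n ^ c)  ≤⟨ bound r ⟩
    3 * card a  ≤⟨ ℕₚ.*-monoˡ-≤ (card a) {3} {4} (ℕₚ.n≤1+n 3) ⟩
    4 * card a  ≡⟨ cong (4 *_) (card-bits a) ⟩
    4 * 2 ^ bits a  ∎)
    where open ℕₚ.≤-Reasoning

module Parameters (c n f : ℕ) (1≤f : 1 ≤ f) where

  N ℓ a L w m d K : ℕ
  N = suc n
  ℓ = suc ⌈log₂ N ⌉
  -- The summand c pays for n^c. The number 40 is a common allowance: beyond it L asks for 2, w for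
  -- 4, m for 8 and d for 16.
  a = c + 40
  L = a * ℓ
  w = a * ℓ
  m = a * f * ℓ
  d = a * f * ℓ
  K = (2 + f) * ℓ + f

  open Growth f ℓ 1≤f (s≤s z≤n)

  N≤2^ℓ : N ≤ 2 ^ ℓ
  N≤2^ℓ = ℕₚ.≤-trans (n≤2^⌈log₂n⌉ N) (ℕₚ.^-monoʳ-≤ 2 (ℕₚ.n≤1+n ⌈log₂ N ⌉))

  4N^c : 4 * N ^ c ≤ 2 ^ (2 + ℓ * c)
  4N^c = ℕₚ.≤-trans (ℕₚ.*-monoʳ-≤ 4 (ℕₚ.≤-trans (ℕₚ.^-monoˡ-≤ c N≤2^ℓ) (ℕₚ.≤-reflexive (ℕₚ.^-*-assoc 2 ℓ c)))) (ℕₚ.≤-reflexive (sym (ℕₚ.^-distribˡ-+-* 2 2 (ℓ * c))))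

  aℓ : ∀ k → k ≤ 40 → ℓ * c + k * ℓ ≤ a * ℓ
  aℓ k le = ℕₚ.≤-trans (ℕₚ.≤-reflexive (trans (cong (_+ k * ℓ) (ℕₚ.*-comm ℓ c)) (sym (ℕₚ.*-distribʳ-+ ℓ c k)))) (ℕₚ.*-monoˡ-≤ ℓ (ℕₚ.+-monoʳ-≤ c le))

  k≤kℓ : ∀ k → k ≤ k * ℓ
  k≤kℓ k = ℕₚ.m≤m*n k ℓ

  E1 : 4 * N ^ c ≤ 2 ^ L
  E1 = ℕₚ.≤-trans 4N^c (ℕₚ.^-monoʳ-≤ 2 (ℕₚ.≤-trans (ℕₚ.≤-trans (ℕₚ.≤-reflexive (ℕₚ.+-comm 2 (ℓ * c))) (ℕₚ.+-monoʳ-≤ (ℓ * c) (k≤kℓ 2))) (aℓ 2 (s≤s (s≤s z≤n)))))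

  E2 : N * (N * 1) * (4 * N ^ c) ≤ 2 ^ w
  E2 = begin
    N * (N * 1) * (4 * N ^ c)  ≤⟨ ℕₚ.*-mono-≤ (ℕₚ.*-mono-≤ N≤2^ℓ (ℕₚ.≤-trans (ℕₚ.≤-reflexive (ℕₚ.*-identityʳ N)) N≤2^ℓ)) 4N^c ⟩
    2 ^ ℓ * 2 ^ ℓ * 2 ^ (2 + ℓ * c)  ≡⟨ trans (cong (_* 2 ^ (2 + ℓ * c)) (sym (ℕₚ.^-distribˡ-+-* 2 ℓ ℓ))) (sym (ℕₚ.^-distribˡ-+-* 2 (ℓ + ℓ) (2 + ℓ * c))) ⟩
    2 ^ (ℓ + ℓ + (2 + ℓ * c))  ≤⟨ ℕₚ.^-monoʳ-≤ 2 exponent ⟩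
    2 ^ w  ∎
    where
    open ℕₚ.≤-Reasoning
    exponent : ℓ + ℓ + (2 + ℓ * c) ≤ w
    exponent = begin
      ℓ + ℓ + (2 + ℓ * c)  ≡⟨ trans (sym (ℕₚ.+-assoc (ℓ + ℓ) 2 (ℓ * c))) (ℕₚ.+-comm (ℓ + ℓ + 2) (ℓ * c)) ⟩
      ℓ * c + (ℓ + ℓ + 2)  ≤⟨ ℕₚ.+-monoʳ-≤ (ℓ * c) (ℕₚ.+-monoʳ-≤ (ℓ + ℓ) (k≤kℓ 2)) ⟩
      ℓ * c + (ℓ + ℓ + 2 * ℓ)  ≡⟨ cong (ℓ * c +_) (ℕₚ.+-assoc ℓ ℓ (2 * ℓ)) ⟩
      ℓ * c + 4 * ℓ  ≤⟨ aℓ 4 (s≤s (s≤s (s≤s (s≤s z≤n)))) ⟩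
      a * ℓ  ∎

  E3 : ∀ {k} → k ≤ f → 2 ^ K * (2 ^ k + 2 ^ k) * (4 * N ^ c) ≤ 2 ^ m
  E3 {k} k≤f = begin
    2 ^ K * (2 ^ k + 2 ^ k) * (4 * N ^ c)  ≤⟨ ℕₚ.*-mono-≤ (ℕₚ.*-monoʳ-≤ (2 ^ K) (ℕₚ.≤-trans (ℕₚ.≤-reflexive (cong (2 ^ k +_) (sym (ℕₚ.+-identityʳ (2 ^ k))))) (ℕₚ.^-monoʳ-≤ 2 (s≤s k≤f)))) 4N^c ⟩
    2 ^ K * 2 ^ suc f * 2 ^ (2 + ℓ * c)  ≡⟨ trans (cong (_* 2 ^ (2 + ℓ * c)) (sym (ℕₚ.^-distribˡ-+-* 2 K (suc f)))) (sym (ℕₚ.^-distribˡ-+-* 2 (K + suc f) (2 + ℓ * c))) ⟩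
    2 ^ (K + suc f + (2 + ℓ * c))  ≤⟨ ℕₚ.^-monoʳ-≤ 2 exponent ⟩
    2 ^ m  ∎
    where
    open ℕₚ.≤-Reasoning
    size : Size
    size = (con 2 ⊕ fᵉ) ⊛ ℓᵉ ⊕ fᵉ ⊕ (con 1 ⊕ fᵉ) ⊕ (con 2 ⊕ ℓᵉ ⊛ con c)
    exponent : K + suc f + (2 + ℓ * c) ≤ m
    exponent = begin
      ⟪ size ⟫  ≤⟨ bounded-by size {1} {1} ℕₚ.≤-refl ℕₚ.≤-refl ⟩
      coeff size * f ^ 1 * ℓ ^ 1  ≡⟨ cong₂ (λ x y → coeff size * x * y) (ℕₚ.*-identityʳ f) (ℕₚ.*-identityʳ ℓ) ⟩
      coeff size * f * ℓ  ≤⟨ ℕₚ.*-monoˡ-≤ ℓ (ℕₚ.*-monoˡ-≤ f small) ⟩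
      a * f * ℓ  ∎
      where
      small : coeff size ≤ a
      small = begin
        coeff size  ≡⟨ cong (λ z → 6 + (2 + z)) (ℕₚ.+-identityʳ c) ⟩
        8 + c  ≡⟨ ℕₚ.+-comm 8 c ⟩
        c + 8  ≤⟨ ℕₚ.+-monoʳ-≤ c (ℕₚ.m≤m+n 8 32) ⟩
        c + 40  ∎

  power : ∃ λ q → f ≤ 2 ^ q × 2 ^ q ≤ 2 * f
  power = powerBetween f 1≤f

  -- A vertex is safe when q fair bits are all one, so the density is a power of two; the choice of
  -- q puts it between 1/(8f) and 1/(4f).
  q : ℕ
  q = 2 + proj₁ power

  4f≤2^q : ∀ {k} → k ≤ f → k * 4 ≤ 2 ^ q
  4f≤2^q {k} k≤f = begin
    k * 4  ≡⟨ ℕₚ.*-comm k 4 ⟩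
    4 * k  ≤⟨ ℕₚ.*-monoʳ-≤ 4 (ℕₚ.≤-trans k≤f (proj₁ (proj₂ power))) ⟩
    4 * 2 ^ proj₁ power  ≡⟨ ℕₚ.^-distribˡ-+-* 2 2 (proj₁ power) ⟨
    2 ^ q  ∎
    where open ℕₚ.≤-Reasoning

  1<2^q : 1 < 2 ^ q
  1<2^q = ℕₚ.≤-trans (s≤s (s≤s z≤n)) (4f≤2^q 1≤f)

  -- Makes the probability of missing one large boundary at most 1/(4N), small enough to sum over
  -- all N subtrees.
  k : ℕ
  k = 2 + ⌈log₂ N ⌉

  4N≤2^k : N * 4 ≤ 2 ^ k
  4N≤2^k = ℕₚ.≤-trans (ℕₚ.≤-reflexive (ℕₚ.*-comm N 4)) (ℕₚ.≤-trans (ℕₚ.*-monoʳ-≤ 4 (n≤2^⌈log₂n⌉ N)) (ℕₚ.≤-reflexive (sym (ℕₚ.^-distribˡ-+-* 2 2 ⌈log₂ N ⌉))))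

  d-large : 2 ^ q * k ≤ d
  d-large = begin
    2 ^ q * k  ≡⟨ cong (_* k) (ℕₚ.^-distribˡ-+-* 2 2 (proj₁ power)) ⟩
    4 * 2 ^ proj₁ power * k  ≤⟨ ℕₚ.*-monoˡ-≤ k (ℕₚ.*-monoʳ-≤ 4 (proj₂ (proj₂ power))) ⟩
    ⟪ size ⟫  ≤⟨ bounded-by size {1} {1} ℕₚ.≤-refl ℕₚ.≤-refl ⟩
    16 * f ^ 1 * ℓ ^ 1  ≡⟨ cong₂ (λ x y → 16 * x * y) (ℕₚ.*-identityʳ f) (ℕₚ.*-identityʳ ℓ) ⟩
    16 * f * ℓ  ≤⟨ ℕₚ.*-monoˡ-≤ ℓ (ℕₚ.*-monoˡ-≤ f (ℕₚ.≤-trans (ℕₚ.m≤m+n 16 24) (ℕₚ.m≤n+m 40 c))) ⟩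
    a * f * ℓ  ∎
    where
    open ℕₚ.≤-Reasoning
    size : Size
    size = con 4 ⊛ (con 2 ⊛ fᵉ) ⊛ (con 1 ⊕ ℓᵉ)

  w-positive : Fin w
  w-positive = fromℕ< {0} (ℕₚ.≤-trans (ℕₚ.≤-trans (s≤s z≤n) (ℕₚ.m≤n+m 40 c)) (ℕₚ.m≤m*n a ℓ))

  room : ∀ {i} → i ≤ f → (2 + i) * ℓ + i ≤ K
  room le = ℕₚ.+-mono-≤ (ℕₚ.*-monoˡ-≤ ℓ (ℕₚ.+-monoʳ-≤ 2 le)) le

  open Labels N ℓ L w m d

  vertexᶜ : Codec (Fin N)
  vertexᶜ = finᶜ {n} {ℓ} N≤2^ℓ
  placeᶜ : Codec Place
  placeᶜ = vecᶜ (maybeᶜ (vertexᶜ ×ᶜ vertexᶜ)) ℓ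
  vectorᶜ : Codec Vector
  vectorᶜ = vecᶜ boolᶜ m
  matrixᶜ : Codec Matrix
  matrixᶜ = vecᶜ vectorᶜ m
  nodeᶜ : Codec Node
  nodeᶜ = placeᶜ ×ᶜ vecᶜ (vecᶜ matrixᶜ w) L
  neighbourᶜ : Codec Neighbour
  neighbourᶜ = placeᶜ ×ᶜ vectorᶜ ×ᶜ vectorᶜ ×ᶜ vecᶜ vectorᶜ w
  detourᶜ : Codec Detour
  detourᶜ = boolᶜ ×ᶜ placeᶜ ×ᶜ vecᶜ matrixᶜ w ×ᶜ vecᶜ (maybeᶜ neighbourᶜ) d ×ᶜ vecᶜ boolᶜ w
  lightNodeᶜ : Codec LightNode
  lightNodeᶜ = vertexᶜ ×ᶜ nodeᶜ ×ᶜ vecᶜ detourᶜ L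
  labelᶜ : Codec Label
  labelᶜ = vertexᶜ ×ᶜ nodeᶜ ×ᶜ vecᶜ (boolᶜ ×ᶜ boolᶜ) L ×ᶜ (vectorᶜ ×ᶜ vectorᶜ) ×ᶜ vecᶜ (maybeᶜ lightNodeᶜ) ℓ

module LabelSize (c : ℕ) where

  L′ m′ place vector matrix node neighbour det lightNode label : Size
  L′ = con (c + 40) ⊛ ℓᵉ
  m′ = con (c + 40) ⊛ fᵉ ⊛ ℓᵉ
  place = ℓᵉ ⊛ (con 1 ⊕ (ℓᵉ ⊕ ℓᵉ))
  vector = m′ ⊛ con 1
  matrix = m′ ⊛ vector
  node = place ⊕ L′ ⊛ (L′ ⊛ matrix)
  neighbour = place ⊕ (vector ⊕ (vector ⊕ L′ ⊛ vector))
  det = con 1 ⊕ (place ⊕ (L′ ⊛ matrix ⊕ (m′ ⊛ (con 1 ⊕ neighbour) ⊕ L′ ⊛ con 1)))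
  lightNode = ℓᵉ ⊕ (node ⊕ L′ ⊛ det)
  label = ℓᵉ ⊕ (node ⊕ (L′ ⊛ con 2 ⊕ ((vector ⊕ vector) ⊕ ℓᵉ ⊛ (con 1 ⊕ lightNode))))

  constant : ℕ
  constant = coeff label

  module _ (n f : ℕ) (1≤f : 1 ≤ f) where
    open Parameters c n f 1≤f
    open Growth f ℓ 1≤f (s≤s z≤n)

    width-vec : ∀ {A} (p : Codec A) j x → width p ≡ x → width (vecᶜ p j) ≡ j * x
    width-vec p j x refl = width-vecᶜ p j

    width-place : width placeᶜ ≡ ⟪ place ⟫
    width-place = width-vec _ ℓ _ refl
    width-vector : width vectorᶜ ≡ ⟪ vector ⟫
    width-vector = width-vec boolᶜ m 1 refl
    width-matrix : width matrixᶜ ≡ ⟪ matrix ⟫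
    width-matrix = width-vec vectorᶜ m _ width-vector
    width-node : width nodeᶜ ≡ ⟪ node ⟫
    width-node = cong₂ _+_ width-place (width-vec _ L _ (width-vec _ w _ width-matrix))
    width-neighbour : width neighbourᶜ ≡ ⟪ neighbour ⟫
    width-neighbour = cong₂ _+_ width-place (cong₂ _+_ width-vector (cong₂ _+_ width-vector (width-vec _ w _ width-vector)))
    width-detour : width detourᶜ ≡ ⟪ det ⟫
    width-detour = cong suc (cong₂ _+_ width-place (cong₂ _+_ (width-vec _ w _ width-matrix) (cong₂ _+_ (width-vec _ d _ (cong suc width-neighbour)) (width-vec boolᶜ w 1 refl))))
    width-lightNode : width lightNodeᶜ ≡ ⟪ lightNode ⟫
    width-lightNode = cong (ℓ +_) (cong₂ _+_ width-node (width-vec _ L _ width-detour))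
    width-label : width labelᶜ ≡ ⟪ label ⟫
    width-label = cong (ℓ +_) (cong₂ _+_ width-node (cong₂ _+_ (width-vec _ L 2 refl) (cong₂ _+_ (cong₂ _+_ width-vector width-vector) (width-vec _ ℓ _ (cong suc width-lightNode)))))

    fits : width labelᶜ ≤ labelLen constant N f
    -- The leading term comes from ℓ light ancestors with L classes, w copies and matrices of m * m
    -- bits: degree two in f and five in ℓ, raised here to the stated six.
    fits = ℕₚ.≤-trans (ℕₚ.≤-reflexive width-label) (bounded-by label {2} {6} ℕₚ.≤-refl (ℕₚ.n≤1+n 5))

module Main (c n f : ℕ) (1≤f : 1 ≤ f) where
  open Parameters c n f 1≤f
  open Labels N ℓ L w m d using (Label; decide; decide⇒; ⇒decide)
  open Wire labelᶜ (LabelSize.fits c n f 1≤f)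

  decoder : Decoder (labelLen (LabelSize.constant c) N f)
  decoder x y zs = decide K (read x) (read y) (map read zs)

  module _ (G : Graph N) where

    T : Forest G
    T = proj₁ (normalForest G)

    normal : Forest.Normal T
    normal = proj₂ (normalForest G)

    short : ∀ y → length (HeavyLight.address T y) ≤ ℓ
    short = HeavyLight.length-address T

    Ω : Space
    Ω = Seeds N q L w m

    labelOf : El Ω → Fin N → Label
    labelOf (S , g , β , α) = TrueLabels.labelOf T normal ℓ L w m d short (safeOf S) (γOf g) α β

    labeling : El Ω → Fin N → Vec Bool (labelLen (LabelSize.constant c) N f)
    labeling ω v = write (labelOf ω v)

    module _ (s t : Fin N) (F : List (Fin N)) (few : length F ≤ f) where
      open Random T normal ℓ L w m d K q k short 4N≤2^k d-large w-positive s t F (room few) (4f≤2^q few) 1<2^q using (rare-failure; accepted)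
      open Answer T normal ℓ L w m d K short s t F (room few) using (module Trial)

      decode-labels : ∀ ω → decoder (labeling ω s) (labeling ω t) (map (labeling ω) F) ≡ decide K (labelOf ω s) (labelOf ω t) (map (labelOf ω) F)
      decode-labels ω = trans (cong₂ (λ x y → decide K x y (map read (map (labeling ω) F))) (read-write (labelOf ω s)) (read-write (labelOf ω t)))
        (cong (λ zs → decide K (labelOf ω s) (labelOf ω t) zs) (trans (sym (Listₚ.map-∘ F)) (Listₚ.map-cong (λ v → read-write (labelOf ω v)) F)))

      sound : ∀ ω → decoder (labeling ω s) (labeling ω t) (map (labeling ω) F) ≡ true → WalkAvoiding G F s t
      sound ω@(S , g , β , α) h = Trial.sound (safeOf S) (γOf g) α β (Trial.accepting (decide⇒ (trans (sym (decode-labels ω)) h)))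

      complete : ∀ ω → ¬ ¬ accepted ω → decoder (labeling ω s) (labeling ω t) (map (labeling ω) F) ≡ true
      complete ω ¬¬acc = trans (decode-labels ω) (⇒decide (λ ¬a → ¬¬acc (¬a ∘ Trial.Accepts.acceptance)))

      walk? : Dec (WalkAvoiding G F s t)
      walk? = inF (s ∈ᵇ F) refl
        where
        inF : ∀ b → s ∈ᵇ F ≡ b → Dec (WalkAvoiding G F s t)
        inF true  e = no (λ p → walk-start p (∈ᵇ⇒ e))
        inF false e = reached (reach t) refl
          where
          open Component (component G F (∈ᵇ⇒∉ e)) renaming (κ to reach)
          constant-on : ∀ {y z} → WalkAvoiding G F y z → reach y ≡ reach z
          constant-on (WalkAvoiding.here _) = refl
          constant-on (WalkAvoiding.step y∉F a p) = trans (κ-adj a y∉F (walk-start p)) (constant-on p)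
          reached : ∀ b → reach t ≡ b → Dec (WalkAvoiding G F s t)
          reached true  r = yes (κ-walk r)
          reached false r = no (λ p → true≢false (trans (sym (constant-on p)) κ-self) r)

      succeeds : SucceedsWHP c G decoder (labeling ∘ sample Ω) s t F
      succeeds = cases walk?
        where
        cases : Dec (WalkAvoiding G F s t) → SucceedsWHP c G decoder (labeling ∘ sample Ω) s t F
        cases (yes p) = whp {N} {labelLen (LabelSize.constant c) N f} {c} {Ω} {G} {decoder} {labeling} {s} {t} {F} (λ ω → ¬ accepted ω) (rare-failure p (4 * N ^ c) E1 E2 (E3 few)) (λ ω ¬¬acc → sound ω , λ _ → complete ω ¬¬acc)
        -- For a disconnected pair soundness alone forces the answer `false`, so no random string
        -- fails.
        cases (no ¬p) = whp {N} {labelLen (LabelSize.constant c) N f} {c} {Ω} {G} {decoder} {labeling} {s} {t} {F} (λ _ → ⊥) (never (λ ())) (λ ω _ → sound ω , λ p → ⊥-elim (¬p p))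

mainTheorem4 : ∀ (c : ℕ) → ∃[ C ] ∀ (n f : ℕ) → 1 ≤ f →
    ∃[ dec ] ∀ (G : Graph n) → ∃[ r ] ∃[ L ]
    ∀ (s t : Fin n) (F : List (Fin n)) → Unique F → length F ≤ f →
    SucceedsWHP {n} {labelLen C n f} {r} c G dec L s t F
mainTheorem4 c = LabelSize.constant c , λ
  { zero    f 1≤f → (λ _ _ _ → false) , λ G → 0 , (λ _ ()) , λ ()
  ; (suc n) f 1≤f → Main.decoder c n f 1≤f , λ G → bits (Main.Ω c n f 1≤f G) , Main.labeling c n f 1≤f G ∘ sample (Main.Ω c n f 1≤f G) ,
      λ s t F _ few → Main.succeeds c n f 1≤f G s t F few }
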